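{- Let $q$ be a prime power and let $\mathcal{V}$ be an intersecting $k$-Sperner family of subspaces of $\mathbb{F}_q^n$. For $0 \leq j \leq n$ let $\mathcal{V}_j = \{V \in \mathcal{V} : \dim(V) = j\}$. If $\dim(V) \leq \lfloor n/2 \rfloor$ for each $V \in \mathcal{V}$, then \[\sum_{j=1}^{\lfloor n/2 \rfloor} \frac{|\mathcal{V}_j|}{\genfrac{[}{]}{0pt}{}{n-1}{j-1}} \leq k.\]
   Context: $\genfrac{[}{]}{0pt}{}{n}{k} = \prod_{0 \leq i \leq k-1}\frac{q^{n-i}-1}{q^{k-i}-1}$ is the Gaussian coefficient. A family of subspaces is intersecting if $\dim(V \cap W) > 0$ for every pair of distinct members $V, W$. A family is $k$-Sperner if every chain (subfamily totally ordered by inclusion) in it has at most $k$ members. -}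

module Defs where

open import Level using (0ℓ)
open import Data.Nat as ℕ using (ℕ; zero; suc; _≤_; _<_; _^_; _∸_)
open import Data.Nat.Primality using (Prime)
open import Data.Fin using (Fin; zero; suc)
open import Data.Bool using (Bool; true)
open import Data.Product using (Σ; ∃; _×_; _,_)
open import Data.Sum using (_⊎_)
open import Data.List using (List; foldr; applyUpTo)
open import Data.Integer using (+_)
open import Data.Rational as ℚ using (ℚ; 0ℚ; 1ℚ)
open import Relation.Nullary using (¬_; yes; no)
open import Relation.Binary.PropositionalEquality using (_≡_; _≢_)
open import Function.Bundles using (_↔_)
open import Algebra.Core using (Op₁; Op₂)
import Algebra.Structures as AS

IsPrimePower : ℕ → Set
IsPrimePower q = Σ ℕ λ p → Σ ℕ λ e → Prime p × 1 ≤ e × q ≡ p ^ e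

record FiniteField (q : ℕ) : Set₁ where
  field
    Carrier : Set
    _+_ _*_ : Op₂ Carrier
    -_      : Op₁ Carrier
    0# 1#   : Carrier
    isCommutativeRing : AS.IsCommutativeRing {A = Carrier} _≡_ _+_ _*_ -_ 0# 1#
    0≢1     : 0# ≢ 1#
    inverse : ∀ x → x ≢ 0# → Σ Carrier λ y → x * y ≡ 1#
    card    : Carrier ↔ Fin q

module LinAlg {q : ℕ} (F : FiniteField q) (n : ℕ) where
  open FiniteField F

  Vector : Set
  Vector = Fin n → Carrier

  zeroV : Vector
  zeroV _ = 0#

  _+V_ : Vector → Vector → Vector
  (u +V v) x = u x + v x

  _·V_ : Carrier → Vector → Vector
  (c ·V v) x = c * v x

  lincomb : (j : ℕ) → (Fin j → Carrier) → (Fin j → Vector) → Vector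
  lincomb zero    c b = zeroV
  lincomb (suc j) c b = (c zero ·V b zero) +V lincomb j (λ i → c (suc i)) (λ i → b (suc i))

  record Subspace : Set where
    field
      mem     : Vector → Bool
      mem-0   : mem zeroV ≡ true
      mem-+   : ∀ u v → mem u ≡ true → mem v ≡ true → mem (u +V v) ≡ true
      mem-·   : ∀ c v → mem v ≡ true → mem (c ·V v) ≡ true
  open Subspace public

  _≐_ : Subspace → Subspace → Set
  V ≐ W = ∀ v → mem V v ≡ mem W v

  _⊆_ : Subspace → Subspace → Set
  V ⊆ W = ∀ v → mem V v ≡ true → mem W v ≡ true

  _∩_ : Subspace → Subspace → Subspace
  V ∩ W = record
    { mem   = λ v → mem V v Data.Bool.∧ mem W v
    ; mem-0 = both (mem-0 V) (mem-0 W)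
    ; mem-+ = λ u v hu hv → both (mem-+ V u v (l hu) (l hv)) (mem-+ W u v (r hu) (r hv))
    ; mem-· = λ c v hv → both (mem-· V c v (l hv)) (mem-· W c v (r hv))
    }
    where
    open Data.Bool using (_∧_; false)
    both : ∀ {a b} → a ≡ true → b ≡ true → (a ∧ b) ≡ true
    both {true} {true} _ _ = Relation.Binary.PropositionalEquality.refl
    l : ∀ {a b} → (a ∧ b) ≡ true → a ≡ true
    l {true} _ = Relation.Binary.PropositionalEquality.refl
    r : ∀ {a b} → (a ∧ b) ≡ true → b ≡ true
    r {true}  h = h

  LinIndep : (j : ℕ) → (Fin j → Vector) → Set
  LinIndep j b = ∀ c → (∀ x → lincomb j c b x ≡ 0#) → ∀ i → c i ≡ 0#

  Spans : (j : ℕ) → (Fin j → Vector) → Subspace → Set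
  Spans j b V = ∀ v → (mem V v ≡ true → Σ (Fin j → Carrier) λ c → ∀ x → v x ≡ lincomb j c b x)
                    × ((Σ (Fin j → Carrier) λ c → ∀ x → v x ≡ lincomb j c b x) → mem V v ≡ true)

  HasDim : Subspace → ℕ → Set
  HasDim V j = Σ (Fin j → Vector) λ b → LinIndep j b × Spans j b V

count : (m : ℕ) → (Fin m → ℕ) → ℕ → ℕ
count zero    d j = 0
count (suc m) d j with d zero ℕ.≟ j
... | yes _ = suc (count m (λ i → d (suc i)) j)
... | no  _ = count m (λ i → d (suc i)) j

ofℕ : ℕ → ℚ
ofℕ n = ℚ._/_ (+ n) 1

sumℚ : List ℚ → ℚ
sumℚ = foldr ℚ._+_ 0ℚ

prodℚ : List ℚ → ℚ
prodℚ = foldr ℚ._*_ 1ℚ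

-- division in ℚ, with the (never used here) convention p / 0 = 0
_÷₀_ : ℚ → ℚ → ℚ
p ÷₀ r with r ℚ.≟ 0ℚ
... | yes _ = 0ℚ
... | no r≢0 = ℚ._÷_ p r {{ℚ.≢-nonZero r≢0}}

gauss : ℕ → ℕ → ℕ → ℚ
gauss q n k = prodℚ (applyUpTo (λ i → (ℚ._-_ (ofℕ (q ^ (n ∸ i))) 1ℚ)
                                   ÷₀ (ℚ._-_ (ofℕ (q ^ (k ∸ i))) 1ℚ)) k)

{-# OPTIONS --safe #-}

-- Peeling off minimal members k times splits a k-Sperner family into k antichains, so it
-- suffices to bound the sum by 1 for an intersecting antichain. Let B_j be the set of
-- j-dimensional subspaces containing a member. Then B_{j+1} contains, disjointly, the
-- upper shadow of B_j and the members of dimension j + 1, and two facts finish the proof.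
--
-- Shadows: for intersecting A in dimension j <= n/2, the upper shadow of A has density, relative
-- to a star, at least that of A. Averaging over the 2j-dimensional subspaces X reduces this to
-- |A| <= |shadow of A| inside X. There the map f |-> (z |-> sum of f over the v below z) is
-- injective on functions supported on A: if it kills f, then for w in A the sums of f over
-- { v : dim (v meet w) = i } satisfy a two-term recursion in i; they start at 0 because A is
-- intersecting, and end at f w.
--
-- Erdős-Ko-Rado in dimension K = n/2: Hoffman's bound for the graph of trivially intersecting
-- K-subspaces. The operators up and down satisfy dn up = up dn + scalar, which yields an
-- orthogonal decomposition into the images under iterated up of the harmonic functions (ker dn) of
-- each level t; the same kind of two-term recursion evaluates the graph on a harmonic function, and
-- the resulting eigenvalues decrease in absolute value from t = 1 on.
module Submission where

-- Divided by the Gaussian coefficient [n - 1, j - 1], the size of B_j becomes a running total that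
-- dominates the terms of the sum up to dimension j. The shadow fact only compares consecutive
-- levels, so an absolute bound is needed on the last of them, for an arbitrary intersecting family:
-- this is exactly Erdős-Ko-Rado. Passing from members to all subspaces above them is harmless,
-- because subspaces containing intersecting members intersect. The intersection hypothesis concerns
-- distinct members, while both facts ask every member to meet itself as well. The zero subspace is
-- therefore discarded, which the sum allows since it starts at dimension 1. All eigenvalues are
-- rational, so no spectral theorem is called for: the decomposition is built level by level by
-- inverting dn up on each component, and Hoffman's bound becomes an inequality between finitely
-- many squared norms. Of the vector space only a finite modular lattice with a dimension enters, in
-- which an interval of height d has [d] covers of its bottom.

module Prelude where

  open import Data.Empty public using (⊥-elim)
  open import Data.Nat public using (ℕ; zero; suc)
  open import Data.Product public using (_×_; _,_; proj₁; proj₂; Σ; ∃)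
  open import Data.Rational public hiding (_⊔_; _⊓_)
  open import Data.Rational.Properties public hiding (_≟_; *-rawMonoid; +-rawMonoid)
  open import Data.Rational.Solver using (module +-*-Solver)
  open import Relation.Nullary public using (Dec; yes; no; ¬_; does)
  open import Relation.Nullary.Decidable public
    using (_×-dec_; _→-dec_; ¬?; map′; recompute; dec-true; decidable-stable)
  open import Relation.Binary.PropositionalEquality public
  open ≡-Reasoning public
  open +-*-Solver public using (solve; _:+_; _:*_; _:-_; :-_; _:=_; con)

-- Indicators and finite sums of rationals

module FiniteSums where

  open Prelude
  open import Data.Bool using (Bool; if_then_else_)
  open import Data.List using (List; []; _∷_; map; _++_)
  open import Level using (Level)

  private variable
    ℓ ℓ′ : Level
    A B : Set
    P : Set ℓ
    Q : Set ℓ′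

  ⟦_⟧ : Dec P → ℚ
  ⟦ d ⟧ = if does d then 1ℚ else 0ℚ

  ⟦⟧-yes : (d : Dec P) → P → ⟦ d ⟧ ≡ 1ℚ
  ⟦⟧-yes (yes _) p = refl
  ⟦⟧-yes (no ¬p) p = ⊥-elim (¬p p)

  ⟦⟧-no : (d : Dec P) → ¬ P → ⟦ d ⟧ ≡ 0ℚ
  ⟦⟧-no (yes p) ¬p = ⊥-elim (¬p p)
  ⟦⟧-no (no _)  ¬p = refl

  ⟦⟧-cong : (d : Dec P) (e : Dec Q) → (P → Q) → (Q → P) → ⟦ d ⟧ ≡ ⟦ e ⟧
  ⟦⟧-cong (yes p) e f g = sym (⟦⟧-yes e (f p))
  ⟦⟧-cong (no ¬p) e f g = sym (⟦⟧-no e (λ q → ¬p (g q)))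

  ⟦⟧-× : (d : Dec P) (e : Dec Q) → ⟦ d ×-dec e ⟧ ≡ ⟦ d ⟧ * ⟦ e ⟧
  ⟦⟧-× (yes _) e = sym (*-identityˡ _)
  ⟦⟧-× (no _)  e = sym (*-zeroˡ ⟦ e ⟧)

  ⟦⟧-guard : (d : Dec P) {a b : ℚ} → (P → a ≡ b) → ⟦ d ⟧ * a ≡ ⟦ d ⟧ * b
  ⟦⟧-guard (yes p) f = cong (1ℚ *_) (f p)
  ⟦⟧-guard (no _)  {a} {b} f = trans (*-zeroˡ a) (sym (*-zeroˡ b))

  0≤⟦⟧ : (d : Dec P) → 0ℚ ≤ ⟦ d ⟧
  0≤⟦⟧ (yes _) = nonNegative⁻¹ 1ℚ
  0≤⟦⟧ (no _)  = ≤-refl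

  ⟦⟧-mono : (d : Dec P) (e : Dec Q) → (P → Q) → ⟦ d ⟧ ≤ ⟦ e ⟧
  ⟦⟧-mono (yes p) e f = ≤-reflexive (sym (⟦⟧-yes e (f p)))
  ⟦⟧-mono (no _)  e f = 0≤⟦⟧ e

  ⟦⟧-idem : (d : Dec P) → ⟦ d ⟧ * ⟦ d ⟧ ≡ ⟦ d ⟧
  ⟦⟧-idem (yes _) = refl
  ⟦⟧-idem (no _)  = refl

  ∑ : List A → (A → ℚ) → ℚ
  ∑ []       f = 0ℚ
  ∑ (x ∷ xs) f = f x + ∑ xs f

  ∑-cong : (xs : List A) {f g : A → ℚ} → (∀ x → f x ≡ g x) → ∑ xs f ≡ ∑ xs g
  ∑-cong []       e = refl
  ∑-cong (x ∷ xs) e = cong₂ _+_ (e x) (∑-cong xs e)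

  ∑-zero : (xs : List A) {f : A → ℚ} → (∀ x → f x ≡ 0ℚ) → ∑ xs f ≡ 0ℚ
  ∑-zero []       e = refl
  ∑-zero (x ∷ xs) e = trans (cong₂ _+_ (e x) (∑-zero xs e)) (+-identityˡ 0ℚ)

  ∑-distrib-+ : (xs : List A) (f g : A → ℚ) → ∑ xs (λ x → f x + g x) ≡ ∑ xs f + ∑ xs g
  ∑-distrib-+ []       f g = refl
  ∑-distrib-+ (x ∷ xs) f g = trans (cong ((f x + g x) +_) (∑-distrib-+ xs f g))
    (solve 4 (λ a b c d → (a :+ b) :+ (c :+ d) := (a :+ c) :+ (b :+ d)) refl (f x) (g x) (∑ xs f) (∑ xs g))

  ∑-*ˡ : (xs : List A) (c : ℚ) (f : A → ℚ) → ∑ xs (λ x → c * f x) ≡ c * ∑ xs f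
  ∑-*ˡ []       c f = sym (*-zeroʳ c)
  ∑-*ˡ (x ∷ xs) c f = trans (cong (c * f x +_) (∑-*ˡ xs c f)) (sym (*-distribˡ-+ c (f x) (∑ xs f)))

  ∑-*ʳ : (xs : List A) (c : ℚ) (f : A → ℚ) → ∑ xs (λ x → f x * c) ≡ ∑ xs f * c
  ∑-*ʳ xs c f = trans (∑-cong xs (λ x → *-comm (f x) c)) (trans (∑-*ˡ xs c f) (*-comm c _))

  ∑-distrib-- : (xs : List A) (f g : A → ℚ) → ∑ xs (λ x → f x - g x) ≡ ∑ xs f - ∑ xs g
  ∑-distrib-- []       f g = refl
  ∑-distrib-- (x ∷ xs) f g = trans (cong ((f x - g x) +_) (∑-distrib-- xs f g))
    (solve 4 (λ a b c d → (a :- b) :+ (c :- d) := (a :+ c) :- (b :+ d)) refl (f x) (g x) (∑ xs f) (∑ xs g))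

  ∑-swap : (xs : List A) (ys : List B) (f : A → B → ℚ) →
           ∑ xs (λ x → ∑ ys (f x)) ≡ ∑ ys (λ y → ∑ xs (λ x → f x y))
  ∑-swap []       ys f = sym (∑-zero ys (λ _ → refl))
  ∑-swap (x ∷ xs) ys f = trans (cong (∑ ys (f x) +_) (∑-swap xs ys f)) (sym (∑-distrib-+ ys (f x) _))

  ∑-mono : (xs : List A) {f g : A → ℚ} → (∀ x → f x ≤ g x) → ∑ xs f ≤ ∑ xs g
  ∑-mono []       e = ≤-refl
  ∑-mono (x ∷ xs) e = +-mono-≤ (e x) (∑-mono xs e)

  ∑-nonneg : (xs : List A) {f : A → ℚ} → (∀ x → 0ℚ ≤ f x) → 0ℚ ≤ ∑ xs f
  ∑-nonneg []       e = ≤-refl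
  ∑-nonneg (x ∷ xs) e = ≤-trans (≤-reflexive (sym (+-identityˡ 0ℚ))) (+-mono-≤ (e x) (∑-nonneg xs e))

  ∑-++ : (xs ys : List A) (f : A → ℚ) → ∑ (xs ++ ys) f ≡ ∑ xs f + ∑ ys f
  ∑-++ []       ys f = sym (+-identityˡ _)
  ∑-++ (x ∷ xs) ys f = trans (cong (f x +_) (∑-++ xs ys f)) (sym (+-assoc (f x) (∑ xs f) (∑ ys f)))

  ∑-map : (h : A → B) (xs : List A) (f : B → ℚ) → ∑ (map h xs) f ≡ ∑ xs (λ x → f (h x))
  ∑-map h []       f = refl
  ∑-map h (x ∷ xs) f = cong (f (h x) +_) (∑-map h xs f)

  -- Exhaustiveness and absence of repetitions are packed into one equation between sums, the form
  -- in which the counting arguments consume them; membership in the list and its uniqueness are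
  -- recovered in `Rank`.
  record Finite (A : Set) : Set where
    infix 4 _≟ᶠ_
    field
      _≟ᶠ_  : (x y : A) → Dec (x ≡ y)
      elems : List A
      ∑-δ-1 : (a : A) → ∑ elems (λ x → ⟦ x ≟ᶠ a ⟧) ≡ 1ℚ

    ∑-δ : (a : A) (f : A → ℚ) → ∑ elems (λ x → ⟦ x ≟ᶠ a ⟧ * f x) ≡ f a
    ∑-δ a f = begin
      ∑ elems (λ x → ⟦ x ≟ᶠ a ⟧ * f x) ≡⟨ ∑-cong elems (λ x → ⟦⟧-guard (x ≟ᶠ a) (cong f)) ⟩
      ∑ elems (λ x → ⟦ x ≟ᶠ a ⟧ * f a) ≡⟨ ∑-*ʳ elems (f a) (λ x → ⟦ x ≟ᶠ a ⟧) ⟩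
      ∑ elems (λ x → ⟦ x ≟ᶠ a ⟧) * f a ≡⟨ cong (_* f a) (∑-δ-1 a) ⟩
      1ℚ * f a                         ≡⟨ *-identityˡ (f a) ⟩
      f a                              ∎

    ∑-unique : (a : A) {P : A → Set ℓ} (P? : ∀ x → Dec (P x)) → P a → (∀ x → P x → x ≡ a) →
               ∑ elems (λ x → ⟦ P? x ⟧) ≡ 1ℚ
    ∑-unique a {P} P? pa u = trans (∑-cong elems (λ x → ⟦⟧-cong (P? x) (x ≟ᶠ a) (u x)
                                                    (λ e → subst P (sym e) pa))) (∑-δ-1 a)

    ∑-witness : (a : A) {P : A → Set ℓ} (P? : ∀ x → Dec (P x)) → P a → 1ℚ ≤ ∑ elems (λ x → ⟦ P? x ⟧)
    ∑-witness a {P} P? pa = ≤-trans (≤-reflexive (sym (∑-δ-1 a)))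
      (∑-mono elems (λ x → ⟦⟧-mono (x ≟ᶠ a) (P? x) (λ e → subst P (sym e) pa)))

    ∑-none : {P : A → Set ℓ} (P? : ∀ x → Dec (P x)) → (∀ x → ¬ P x) → ∑ elems (λ x → ⟦ P? x ⟧) ≡ 0ℚ
    ∑-none P? ¬p = ∑-zero elems (λ x → ⟦⟧-no (P? x) (¬p x))

-- Ordered-field arithmetic and Q-numbers

module Arithmetic where

  open Prelude
  import Data.Nat as ℕ
  import Data.Nat.Properties as ℕ
  open import Data.Sum using (inj₁; inj₂)

  private variable
    a b c d : ℚ

  *-monoˡ : 0ℚ ≤ c → a ≤ b → c * a ≤ c * b
  *-monoˡ {c} 0≤c = *-monoˡ-≤-nonNeg c {{nonNegative 0≤c}}

  *-monoʳ : 0ℚ ≤ c → a ≤ b → a * c ≤ b * c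
  *-monoʳ {c} 0≤c = *-monoʳ-≤-nonNeg c {{nonNegative 0≤c}}

  *-mono : 0ℚ ≤ a → 0ℚ ≤ d → a ≤ b → c ≤ d → a * c ≤ b * d
  *-mono 0≤a 0≤d a≤b c≤d = ≤-trans (*-monoˡ 0≤a c≤d) (*-monoʳ 0≤d a≤b)

  *-cancelˡ-≤ : 0ℚ < c → c * a ≤ c * b → a ≤ b
  *-cancelˡ-≤ {c} 0<c = *-cancelˡ-≤-pos c {{positive 0<c}}

  *-cancelˡ-≡ : 0ℚ < c → c * a ≡ c * b → a ≡ b
  *-cancelˡ-≡ 0<c e = ≤-antisym (*-cancelˡ-≤ 0<c (≤-reflexive e)) (*-cancelˡ-≤ 0<c (≤-reflexive (sym e)))

  *-pos : 0ℚ < a → 0ℚ < b → 0ℚ < a * b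
  *-pos {a} {b} 0<a 0<b = positive⁻¹ (a * b) {{pos*pos⇒pos a {{positive 0<a}} b {{positive 0<b}}}}

  *-nonneg : 0ℚ ≤ a → 0ℚ ≤ b → 0ℚ ≤ a * b
  *-nonneg {a} {b} 0≤a 0≤b = nonNegative⁻¹ (a * b) {{nonNeg*nonNeg⇒nonNeg a {{nonNegative 0≤a}} b {{nonNegative 0≤b}}}}

  +-nonneg : 0ℚ ≤ a → 0ℚ ≤ b → 0ℚ ≤ a + b
  +-nonneg 0≤a 0≤b = ≤-trans (≤-reflexive (sym (+-identityˡ 0ℚ))) (+-mono-≤ 0≤a 0≤b)

  0≤1 : 0ℚ ≤ 1ℚ
  0≤1 = nonNegative⁻¹ 1ℚ

  0<1 : 0ℚ < 1ℚ
  0<1 = positive⁻¹ 1ℚ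

  ≤⇒0≤- : a ≤ b → 0ℚ ≤ b - a
  ≤⇒0≤- {a} {b} a≤b = ≤-trans (≤-reflexive (sym (+-inverseʳ a))) (+-monoˡ-≤ (- a) a≤b)

  0≤-⇒≤ : 0ℚ ≤ b - a → a ≤ b
  0≤-⇒≤ {b} {a} 0≤b-a = ≤-trans (≤-reflexive (sym (+-identityˡ a)))
    (≤-trans (+-monoˡ-≤ a 0≤b-a) (≤-reflexive (solve 2 (λ b a → (b :- a) :+ a := b) refl b a)))

  <⇒0<- : a < b → 0ℚ < b - a
  <⇒0<- {a} {b} a<b = ≤-<-trans (≤-reflexive (sym (+-inverseʳ a))) (+-monoˡ-< (- a) a<b)

  0≤-square : ∀ a → 0ℚ ≤ a * a
  0≤-square a with ≤-total 0ℚ a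
  ... | inj₁ 0≤a = *-nonneg 0≤a 0≤a
  ... | inj₂ a≤0 = ≤-trans (*-nonneg 0≤-a 0≤-a)
        (≤-reflexive (solve 1 (λ a → (con 0ℚ :- a) :* (con 0ℚ :- a) := a :* a) refl a))
    where 0≤-a = ≤⇒0≤- a≤0

  recip : ∀ c → 0ℚ < c → ℚ
  recip c 0<c = 1/_ c {{pos⇒nonZero c {{positive 0<c}}}}

  recip-inverse : ∀ c (0<c : 0ℚ < c) → recip c 0<c * c ≡ 1ℚ
  recip-inverse c 0<c = *-inverseˡ c {{pos⇒nonZero c {{positive 0<c}}}}

  recip-pos : ∀ c (0<c : 0ℚ < c) → 0ℚ < recip c 0<c
  recip-pos c 0<c = positive⁻¹ _ {{1/pos⇒pos c {{positive 0<c}}}}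

  -- A total reciprocal, with value 0 at arguments that are not positive: quotients can then be
  -- defined for all indices, and positivity is supplied only where a cancellation takes place.
  inv : ℚ → ℚ
  inv c with 0ℚ <? c
  ... | yes 0<c = recip c 0<c
  ... | no _    = 0ℚ

  inv-* : ∀ c → 0ℚ < c → inv c * c ≡ 1ℚ
  inv-* c 0<c with 0ℚ <? c
  ... | yes p = recip-inverse c p
  ... | no ¬p = ⊥-elim (¬p 0<c)

  0<inv : ∀ c → 0ℚ < c → 0ℚ < inv c
  0<inv c 0<c with 0ℚ <? c
  ... | yes p = recip-pos c p
  ... | no ¬p = ⊥-elim (¬p 0<c)

  -- br d is the Q-number [d] = (Qᵈ - 1) / (Q - 1).
  module QNumbers (Q : ℚ) (1≤Q : 1ℚ ≤ Q) where

    pw br : ℕ → ℚ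
    pw zero    = 1ℚ
    pw (suc d) = Q * pw d
    br zero    = 0ℚ
    br (suc d) = 1ℚ + Q * br d

    0<Q : 0ℚ < Q
    0<Q = <-≤-trans 0<1 1≤Q

    0<pw : ∀ d → 0ℚ < pw d
    0<pw zero    = 0<1
    0<pw (suc d) = *-pos 0<Q (0<pw d)

    0≤br : ∀ d → 0ℚ ≤ br d
    0≤br zero    = ≤-refl
    0≤br (suc d) = +-nonneg 0≤1 (*-nonneg (<⇒≤ 0<Q) (0≤br d))

    0<br : ∀ d → 0ℚ < br (suc d)
    0<br d = <-≤-trans 0<1 (≤-trans (≤-reflexive (sym (+-identityʳ 1ℚ))) (+-monoʳ-≤ 1ℚ (*-nonneg (<⇒≤ 0<Q) (0≤br d))))

    pw-+ : ∀ a b → pw (a ℕ.+ b) ≡ pw a * pw b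
    pw-+ zero    b = sym (*-identityˡ (pw b))
    pw-+ (suc a) b = trans (cong (Q *_) (pw-+ a b)) (sym (*-assoc Q (pw a) (pw b)))

    br-+ : ∀ a b → br (a ℕ.+ b) ≡ br a + pw a * br b
    br-+ zero    b = trans (sym (*-identityˡ (br b))) (sym (+-identityˡ (1ℚ * br b)))
    br-+ (suc a) b = trans (cong (λ t → 1ℚ + Q * t) (br-+ a b))
      (solve 4 (λ Q x p y → con 1ℚ :+ Q :* (x :+ p :* y) := (con 1ℚ :+ Q :* x) :+ (Q :* p) :* y) refl Q (br a) (pw a) (br b))

    pw-br : ∀ d → pw d - 1ℚ ≡ (Q - 1ℚ) * br d
    pw-br zero    = solve 1 (λ Q → con 1ℚ :- con 1ℚ := (Q :- con 1ℚ) :* con 0ℚ) refl Q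
    pw-br (suc d) = trans (solve 2 (λ Q p → Q :* p :- con 1ℚ := (Q :- con 1ℚ) :+ Q :* (p :- con 1ℚ)) refl Q (pw d))
      (trans (cong (λ t → (Q - 1ℚ) + Q * t) (pw-br d))
             (solve 2 (λ Q b → (Q :- con 1ℚ) :+ Q :* ((Q :- con 1ℚ) :* b) := (Q :- con 1ℚ) :* (con 1ℚ :+ Q :* b)) refl Q (br d)))

    pw-mono : ∀ {a b} → a ℕ.≤ b → pw a ≤ pw b
    pw-mono {zero} {zero}  ℕ.z≤n = ≤-refl
    pw-mono {zero} {suc b} ℕ.z≤n = ≤-trans (pw-mono {zero} {b} ℕ.z≤n)
      (≤-trans (≤-reflexive (sym (*-identityˡ (pw b)))) (*-monoʳ (<⇒≤ (0<pw b)) 1≤Q))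
    pw-mono (ℕ.s≤s a≤b) = *-monoˡ (<⇒≤ 0<Q) (pw-mono a≤b)

    br-mono : ∀ {a b} → a ℕ.≤ b → br a ≤ br b
    br-mono {b = b} ℕ.z≤n = 0≤br b
    br-mono (ℕ.s≤s a≤b) = +-monoʳ-≤ 1ℚ (*-monoˡ (<⇒≤ 0<Q) (br-mono a≤b))

    br-mono-< : ∀ {a b} → a ℕ.< b → br a < br b
    br-mono-< {zero}  {suc b} (ℕ.s≤s ℕ.z≤n) = 0<br b
    br-mono-< {suc a} {suc b} (ℕ.s≤s a<b) = +-monoʳ-< 1ℚ
      (*-monoʳ-<-pos Q {{positive 0<Q}} (br-mono-< a<b))

-- The axiomatic subspace lattice and its cover counts

module SubspaceLattices where

  open Prelude
  open import Data.List using (List)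
  import Data.Nat as ℕ
  import Data.Nat.Properties as ℕ
  open FiniteSums
  open Arithmetic

  -- Abstracts the lattice of subspaces of an n-dimensional space over a field with Q elements.
  record Geometry (Q : ℚ) (1≤Q : 1ℚ ≤ Q) (n : ℕ) : Set₁ where
    open QNumbers Q 1≤Q
    infix 4 _⊑_ _⊑?_ _⋖_ _⋖?_
    infixl 7 _⊓_
    infixl 6 _⊔_
    field
      El       : Set
      finite   : Finite El
      _⊑_      : El → El → Set
      _⊑?_     : ∀ x y → Dec (x ⊑ y)
      ⊑-refl   : ∀ {x} → x ⊑ x
      ⊑-trans  : ∀ {x y z} → x ⊑ y → y ⊑ z → x ⊑ z
      _⊓_ _⊔_  : El → El → El
      ⊓-lowerˡ : ∀ x y → x ⊓ y ⊑ x
      ⊓-lowerʳ : ∀ x y → x ⊓ y ⊑ y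
      ⊓-greatest    : ∀ {x y z} → z ⊑ x → z ⊑ y → z ⊑ x ⊓ y
      ⊔-upperˡ : ∀ x y → x ⊑ x ⊔ y
      ⊔-upperʳ : ∀ x y → y ⊑ x ⊔ y
      ⊔-least    : ∀ {x y z} → x ⊑ z → y ⊑ z → x ⊔ y ⊑ z
      bot top  : El
      bot-min  : ∀ x → bot ⊑ x
      top-max  : ∀ x → x ⊑ top
      dim      : El → ℕ
      dim-bot  : dim bot ≡ 0
      dim-top  : dim top ≡ n
      dim-mono : ∀ {x y} → x ⊑ y → dim x ℕ.≤ dim y
      dim-≡    : ∀ {x y} → x ⊑ y → dim x ≡ dim y → x ≡ y
      modular  : ∀ x y → dim (x ⊔ y) ℕ.+ dim (x ⊓ y) ≡ dim x ℕ.+ dim y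

    _⋖_ : El → El → Set
    x ⋖ y = x ⊑ y × suc (dim x) ≡ dim y

    _⋖?_ : ∀ x y → Dec (x ⋖ y)
    x ⋖? y = (x ⊑? y) ×-dec (suc (dim x) ℕ.≟ dim y)

    open Finite finite public

    field
      -- The only axiom in which `Q` occurs: an interval of height d is a projective geometry with
      -- [d] points. The other counts follow from it and from modularity.
      up-count : ∀ {x y} → x ⊑ y → ∀ {d} → dim x ℕ.+ d ≡ dim y →
                 ∑ elems (λ z → ⟦ (x ⋖? z) ×-dec (z ⊑? y) ⟧) ≡ br d

  -- The tool of all double counts below: once the two sums over a relation are swapped, an inner
  -- sum collapses to a constant times the indicator of the projection `S`.
  ∑-fiber : ∀ {B S : Set} {R : B → Set} (ys : List B) (c : ℚ)
            (S? : Dec S) (R? : ∀ y → Dec (R y)) → (∀ {y} → R y → S) →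
            (S → ∑ ys (λ y → ⟦ R? y ⟧) ≡ c) → ∑ ys (λ y → ⟦ R? y ⟧) ≡ c * ⟦ S? ⟧
  ∑-fiber ys c (yes s) R? R⇒S cnt = trans (cnt s) (sym (*-identityʳ c))
  ∑-fiber ys c (no ¬s) R? R⇒S cnt = trans (∑-zero ys (λ y → ⟦⟧-no (R? y) (λ r → ¬s (R⇒S r)))) (sym (*-zeroʳ c))

  -- On `C` the indicator of `E` has only two values, `m₁` inside `D` and `m₀` outside, so that
  -- counting `E` within `C` takes no more than the sizes of `C` and `D`.
  ⟦⟧-split : ∀ {C D E : Set} (c? : Dec C) (d? : Dec D) (e? : Dec E) (m₀ m₁ : ℚ) → (D → C) →
             (C → D → ⟦ e? ⟧ ≡ m₁) → (C → ¬ D → ⟦ e? ⟧ ≡ m₀) →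
             ⟦ c? ⟧ * ⟦ e? ⟧ ≡ m₀ * ⟦ c? ⟧ + (m₁ - m₀) * ⟦ d? ⟧
  ⟦⟧-split (no ¬c) (yes d) e? m₀ m₁ f _  _  = ⊥-elim (¬c (f d))
  ⟦⟧-split (no _)  (no _)  e? m₀ m₁ _ _  _  =
    solve 3 (λ e m₀ m₁ → con 0ℚ :* e := m₀ :* con 0ℚ :+ (m₁ :- m₀) :* con 0ℚ) refl ⟦ e? ⟧ m₀ m₁
  ⟦⟧-split (yes c) (yes d) e? m₀ m₁ _ e₁ _  = trans (cong (1ℚ *_) (e₁ c d))
    (solve 2 (λ m₀ m₁ → con 1ℚ :* m₁ := m₀ :* con 1ℚ :+ (m₁ :- m₀) :* con 1ℚ) refl m₀ m₁)
  ⟦⟧-split (yes c) (no ¬d) e? m₀ m₁ _ _  e₀ = trans (cong (1ℚ *_) (e₀ c ¬d))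
    (solve 2 (λ m₀ m₁ → con 1ℚ :* m₀ := m₀ :* con 1ℚ :+ (m₁ :- m₀) :* con 0ℚ) refl m₀ m₁)

  module Counting {Q : ℚ} {1≤Q : 1ℚ ≤ Q} {n : ℕ} (G : Geometry Q 1≤Q n) where
    open Geometry G public
    open QNumbers Q 1≤Q public

    ⊑-reflexive : ∀ {x y} → x ≡ y → x ⊑ y
    ⊑-reflexive refl = ⊑-refl

    ⋖⇒⊑ : ∀ {x y} → x ⋖ y → x ⊑ y
    ⋖⇒⊑ = proj₁

    -- Double count of the pairs x ⋖ z ⊑ t ⋖ y: each `t` sees [d + 1] of the z by `up-count`, and
    -- each `z` sees [d + 1] of the t by induction, so there are as many t as z. Height 1 has to be
    -- a base case, because the factor to be cancelled would be [0] there.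
    down-count : ∀ {x y} → x ⊑ y → ∀ d → dim x ℕ.+ d ≡ dim y →
                 ∑ elems (λ t → ⟦ (x ⊑? t) ×-dec (t ⋖? y) ⟧) ≡ br d
    down-count {x} {y} x⊑y zero e =
      ∑-none (λ t → (x ⊑? t) ×-dec (t ⋖? y)) λ t (x⊑t , t⊑y , s) →
        ℕ.<⇒≱ (ℕ.≤-reflexive (trans s (trans (sym e) (ℕ.+-identityʳ _)))) (dim-mono x⊑t)
    down-count {x} {y} x⊑y (suc zero) e = trans
      (∑-unique x (λ t → (x ⊑? t) ×-dec (t ⋖? y)) (⊑-refl , x⊑y , e′)
        (λ t (x⊑t , t⊑y , s) → sym (dim-≡ x⊑t (ℕ.suc-injective (trans e′ (sym s))))))
      (solve 1 (λ Q → con 1ℚ := con 1ℚ :+ Q :* con 0ℚ) refl Q)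
      where
      e′ : suc (dim x) ≡ dim y
      e′ = trans (sym (trans (ℕ.+-suc (dim x) 0) (cong suc (ℕ.+-identityʳ _)))) e
    down-count {x} {y} x⊑y (suc (suc d)) e = *-cancelˡ-≡ (0<br d) (begin
      br (suc d) * ∑ elems (λ t → ⟦ (x ⊑? t) ×-dec (t ⋖? y) ⟧)
        ≡⟨ ∑-*ˡ elems (br (suc d)) _ ⟨
      ∑ elems (λ t → br (suc d) * ⟦ (x ⊑? t) ×-dec (t ⋖? y) ⟧)
        ≡⟨ ∑-cong elems (λ t → sym (∑-fiber elems (br (suc d)) ((x ⊑? t) ×-dec (t ⋖? y)) (R? t)
             (λ ((x⋖z , z⊑t) , t⋖y) → ⊑-trans (⋖⇒⊑ x⋖z) z⊑t , t⋖y) (below t))) ⟩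
      ∑ elems (λ t → ∑ elems (λ z → ⟦ R? t z ⟧))
        ≡⟨ ∑-swap elems elems _ ⟩
      ∑ elems (λ z → ∑ elems (λ t → ⟦ R? t z ⟧))
        ≡⟨ ∑-cong elems (λ z → ∑-fiber elems (br (suc d)) ((x ⋖? z) ×-dec (z ⊑? y)) (λ t → R? t z)
             (λ ((x⋖z , z⊑t) , t⋖y) → x⋖z , ⊑-trans z⊑t (⋖⇒⊑ t⋖y)) (above (λ z⊑y → down-count z⊑y (suc d)) z)) ⟩
      ∑ elems (λ z → br (suc d) * ⟦ (x ⋖? z) ×-dec (z ⊑? y) ⟧)
        ≡⟨ ∑-*ˡ elems (br (suc d)) _ ⟩
      br (suc d) * ∑ elems (λ z → ⟦ (x ⋖? z) ×-dec (z ⊑? y) ⟧)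
        ≡⟨ cong (br (suc d) *_) (up-count x⊑y e) ⟩
      br (suc d) * br (suc (suc d)) ∎)
      where
      R? : ∀ t z → Dec ((x ⋖ z × z ⊑ t) × t ⋖ y)
      R? t z = ((x ⋖? z) ×-dec (z ⊑? t)) ×-dec (t ⋖? y)
      below : ∀ t → x ⊑ t × t ⋖ y → ∑ elems (λ z → ⟦ R? t z ⟧) ≡ br (suc d)
      below t (x⊑t , t⋖y) = trans
        (∑-cong elems (λ z → ⟦⟧-cong (R? t z) ((x ⋖? z) ×-dec (z ⊑? t)) proj₁ (λ p → p , t⋖y)))
        (up-count x⊑t (ℕ.suc-injective (trans (sym (ℕ.+-suc (dim x) (suc d))) (trans e (sym (proj₂ t⋖y))))))
      above : (∀ {z} → z ⊑ y → dim z ℕ.+ suc d ≡ dim y → ∑ elems (λ t → ⟦ (z ⊑? t) ×-dec (t ⋖? y) ⟧) ≡ br (suc d)) →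
              ∀ z → x ⋖ z × z ⊑ y → ∑ elems (λ t → ⟦ R? t z ⟧) ≡ br (suc d)
      above down z (x⋖z , z⊑y) = trans
        (∑-cong elems (λ t → ⟦⟧-cong (R? t z) ((z ⊑? t) ×-dec (t ⋖? y))
           (λ ((_ , z⊑t) , t⋖y) → z⊑t , t⋖y) (λ (z⊑t , t⋖y) → (x⋖z , z⊑t) , t⋖y)))
        (down z⊑y (trans (cong (ℕ._+ suc d) (sym (proj₂ x⋖z)))
           (trans (sym (ℕ.+-suc (dim x) (suc d))) e)))

    #covers : ∀ x {d} → dim x ℕ.+ d ≡ n → ∑ elems (λ z → ⟦ x ⋖? z ⟧) ≡ br d
    #covers x e = trans (∑-cong elems (λ z → ⟦⟧-cong (x ⋖? z) ((x ⋖? z) ×-dec (z ⊑? top)) (λ p → p , top-max z) proj₁))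
                        (up-count (top-max x) (trans e (sym dim-top)))

    #cocovers : ∀ y → ∑ elems (λ t → ⟦ t ⋖? y ⟧) ≡ br (dim y)
    #cocovers y = trans (∑-cong elems (λ t → ⟦⟧-cong (t ⋖? y) ((bot ⊑? t) ×-dec (t ⋖? y)) (λ p → bot-min t , p) proj₂))
                        (down-count (bot-min y) (dim y) (cong (ℕ._+ dim y) dim-bot))

    dim≤n : ∀ x → dim x ℕ.≤ n
    dim≤n x = subst (dim x ℕ.≤_) dim-top (dim-mono (top-max x))

    dim-⊓≤ : ∀ x y → dim (x ⊓ y) ℕ.≤ dim x
    dim-⊓≤ x y = dim-mono (⊓-lowerˡ x y)

    ⊓≡ : ∀ {x y} → x ⊑ y → x ⊓ y ≡ x
    ⊓≡ {x} {y} x⊑y = dim-≡ (⊓-lowerˡ x y) (ℕ.≤-antisym (dim-⊓≤ x y) (dim-mono (⊓-greatest ⊑-refl x⊑y)))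

    dim-⊓≡⇒⊑ : ∀ x y → dim (x ⊓ y) ≡ dim x → x ⊑ y
    dim-⊓≡⇒⊑ x y e = ⊑-trans (⊑-reflexive (sym (dim-≡ (⊓-lowerˡ x y) e))) (⊓-lowerʳ x y)

    -- `z` and `v` have the same join with `w`, so by modularity the additional dimension of `z`
    -- goes into the meet.
    ⋖-⊓-grows : ∀ {v z} w → v ⋖ z → z ⊑ v ⊔ w → dim (z ⊓ w) ≡ suc (dim (v ⊓ w))
    ⋖-⊓-grows {v} {z} w (v⊑z , s) z⊑v⊔w = ℕ.+-cancelˡ-≡ (dim (v ⊔ w)) _ _ (begin
      dim (v ⊔ w) ℕ.+ dim (z ⊓ w)       ≡⟨ cong (ℕ._+ dim (z ⊓ w)) same ⟩
      dim (z ⊔ w) ℕ.+ dim (z ⊓ w)       ≡⟨ modular z w ⟩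
      dim z ℕ.+ dim w                   ≡⟨ cong (ℕ._+ dim w) s ⟨
      suc (dim v ℕ.+ dim w)             ≡⟨ cong suc (modular v w) ⟨
      suc (dim (v ⊔ w) ℕ.+ dim (v ⊓ w)) ≡⟨ ℕ.+-suc (dim (v ⊔ w)) _ ⟨
      dim (v ⊔ w) ℕ.+ suc (dim (v ⊓ w)) ∎)
      where
      same : dim (v ⊔ w) ≡ dim (z ⊔ w)
      same = ℕ.≤-antisym (dim-mono (⊔-least (⊑-trans v⊑z (⊔-upperˡ z w)) (⊔-upperʳ z w)))
                         (dim-mono (⊔-least z⊑v⊔w (⊔-upperʳ v w)))

    ⋖-between : ∀ {v t z} → v ⋖ z → v ⊑ t → t ⊑ z → ¬ (z ⊑ t) → t ≡ v
    ⋖-between {v} {t} {z} (v⊑z , s) v⊑t t⊑z z⋢t = sym (dim-≡ v⊑t (ℕ.≤-antisym (dim-mono v⊑t)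
      (ℕ.≤-pred (subst (dim t ℕ.<_) (sym s) (ℕ.≤∧≢⇒< (dim-mono t⊑z) λ e → z⋢t (⊑-reflexive (sym (dim-≡ t⊑z e))))))))

    -- The meet of `z` with `v ⊔ w` lies between `v` and its cover `z` and is not `z`; hence it is
    -- `v`, and it contains `z ⊓ w`.
    ⋖-⊓-stays : ∀ {v z} w → v ⋖ z → ¬ (z ⊑ v ⊔ w) → dim (z ⊓ w) ≡ dim (v ⊓ w)
    ⋖-⊓-stays {v} {z} w v⋖z z⋢v⊔w = ℕ.≤-antisym
      (dim-mono (⊓-greatest (⊑-trans (⊓-greatest (⊓-lowerˡ z w) (⊑-trans (⊓-lowerʳ z w) (⊔-upperʳ v w)))
                                 (⊑-reflexive meet)) (⊓-lowerʳ z w)))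
      (dim-mono (⊓-greatest (⊑-trans (⊓-lowerˡ v w) (proj₁ v⋖z)) (⊓-lowerʳ v w)))
      where
      meet : z ⊓ (v ⊔ w) ≡ v
      meet = ⋖-between v⋖z (⊓-greatest (proj₁ v⋖z) (⊔-upperˡ v w)) (⊓-lowerˡ z (v ⊔ w))
               (λ z⊑ → z⋢v⊔w (⊑-trans z⊑ (⊓-lowerʳ z (v ⊔ w))))

    ⋖-⊓-kept : ∀ {t v} w → t ⋖ v → v ⊓ w ⊑ t → dim (t ⊓ w) ≡ dim (v ⊓ w)
    ⋖-⊓-kept {t} {v} w (t⊑v , _) v⊓w⊑t = ℕ.≤-antisym
      (dim-mono (⊓-greatest (⊑-trans (⊓-lowerˡ t w) t⊑v) (⊓-lowerʳ t w)))
      (dim-mono (⊓-greatest v⊓w⊑t (⊓-lowerʳ v w)))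

    ⋖-⊓-drops : ∀ {t v} w → t ⋖ v → ¬ (v ⊓ w ⊑ t) → suc (dim (t ⊓ w)) ≡ dim (v ⊓ w)
    ⋖-⊓-drops {t} {v} w t⋖v v⊓w⋢t with v ⊑? t ⊔ w
    ... | yes v⊑ = sym (⋖-⊓-grows w t⋖v v⊑)
    ... | no v⋢  = ⊥-elim (v⊓w⋢t (⊑-trans (⊑-reflexive
            (sym (dim-≡ (⊓-greatest (⊑-trans (⊓-lowerˡ t w) (proj₁ t⋖v)) (⊓-lowerʳ t w)) (sym (⋖-⊓-stays w t⋖v v⋢))))) (⊓-lowerˡ t w)))

    -- Of the [b] covers of `v` below `y`, those below `v ⊔ w` raise the meet with `w` by one
    -- dimension and the others keep it. There are [a] of the former, because the codimension of `v`
    -- in `v ⊔ w` equals that of `v ⊓ w` in `w`.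
    up-count-⊓ : ∀ {v w y} i {a b} → v ⊑ y → w ⊑ y → dim v ℕ.+ b ≡ dim y → dim (v ⊓ w) ℕ.+ a ≡ dim w →
      ∑ elems (λ z → ⟦ (v ⋖? z) ×-dec (z ⊑? y) ⟧ * ⟦ dim (z ⊓ w) ℕ.≟ i ⟧)
        ≡ ⟦ dim (v ⊓ w) ℕ.≟ i ⟧ * (br b - br a) + ⟦ suc (dim (v ⊓ w)) ℕ.≟ i ⟧ * br a
    up-count-⊓ {v} {w} {y} i {a} {b} v⊑y w⊑y eb ea = begin
      ∑ elems (λ z → ⟦ c? z ⟧ * ⟦ dim (z ⊓ w) ℕ.≟ i ⟧)
        ≡⟨ ∑-cong elems pointwise ⟩
      ∑ elems (λ z → m₀ * ⟦ c? z ⟧ + (m₁ - m₀) * ⟦ g? z ⟧)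
        ≡⟨ ∑-distrib-+ elems _ _ ⟩
      ∑ elems (λ z → m₀ * ⟦ c? z ⟧) + ∑ elems (λ z → (m₁ - m₀) * ⟦ g? z ⟧)
        ≡⟨ cong₂ _+_ (∑-*ˡ elems m₀ _) (∑-*ˡ elems (m₁ - m₀) _) ⟩
      m₀ * ∑ elems (λ z → ⟦ c? z ⟧) + (m₁ - m₀) * ∑ elems (λ z → ⟦ g? z ⟧)
        ≡⟨ cong₂ (λ s t → m₀ * s + (m₁ - m₀) * t) (up-count v⊑y eb) (up-count (⊔-upperˡ v w) ea′) ⟩
      m₀ * br b + (m₁ - m₀) * br a
        ≡⟨ solve 4 (λ m₀ m₁ a b → m₀ :* b :+ (m₁ :- m₀) :* a := m₀ :* (b :- a) :+ m₁ :* a) refl m₀ m₁ (br a) (br b) ⟩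
      m₀ * (br b - br a) + m₁ * br a ∎
      where
      m₀ = ⟦ dim (v ⊓ w) ℕ.≟ i ⟧
      m₁ = ⟦ suc (dim (v ⊓ w)) ℕ.≟ i ⟧
      c? : ∀ z → Dec (v ⋖ z × z ⊑ y)
      c? z = (v ⋖? z) ×-dec (z ⊑? y)
      g? : ∀ z → Dec (v ⋖ z × z ⊑ v ⊔ w)
      g? z = (v ⋖? z) ×-dec (z ⊑? v ⊔ w)
      ea′ : dim v ℕ.+ a ≡ dim (v ⊔ w)
      ea′ = ℕ.+-cancelʳ-≡ (dim (v ⊓ w)) _ _ (begin
        dim v ℕ.+ a ℕ.+ dim (v ⊓ w)   ≡⟨ ℕ.+-assoc (dim v) a _ ⟩
        dim v ℕ.+ (a ℕ.+ dim (v ⊓ w)) ≡⟨ cong (dim v ℕ.+_) (trans (ℕ.+-comm a _) ea) ⟩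
        dim v ℕ.+ dim w               ≡⟨ modular v w ⟨
        dim (v ⊔ w) ℕ.+ dim (v ⊓ w)   ∎)
      pointwise : ∀ z → ⟦ c? z ⟧ * ⟦ dim (z ⊓ w) ℕ.≟ i ⟧ ≡ m₀ * ⟦ c? z ⟧ + (m₁ - m₀) * ⟦ g? z ⟧
      pointwise z = ⟦⟧-split (c? z) (g? z) (dim (z ⊓ w) ℕ.≟ i) m₀ m₁
        (λ (v⋖z , z⊑) → v⋖z , ⊑-trans z⊑ (⊔-least v⊑y w⊑y))
        (λ (v⋖z , _) (_ , z⊑) → ⟦⟧-cong (dim (z ⊓ w) ℕ.≟ i) (suc (dim (v ⊓ w)) ℕ.≟ i)
           (trans (sym (⋖-⊓-grows w v⋖z z⊑))) (trans (⋖-⊓-grows w v⋖z z⊑)))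
        (λ (v⋖z , _) ¬g → let z⋢ = λ z⊑ → ¬g (v⋖z , z⊑) in
           ⟦⟧-cong (dim (z ⊓ w) ℕ.≟ i) (dim (v ⊓ w) ℕ.≟ i)
             (trans (sym (⋖-⊓-stays w v⋖z z⋢))) (trans (⋖-⊓-stays w v⋖z z⋢)))

    -- The dual count: the [a] hyperplanes of `v` through `v ⊓ w` keep the meet with `w`, and all
    -- others lower it by one dimension.
    down-count-⊓ : ∀ v w i {a} → dim (v ⊓ w) ℕ.+ a ≡ dim v →
      ∑ elems (λ t → ⟦ t ⋖? v ⟧ * ⟦ dim (t ⊓ w) ℕ.≟ i ⟧)
        ≡ ⟦ dim (v ⊓ w) ℕ.≟ i ⟧ * br a + ⟦ dim (v ⊓ w) ℕ.≟ suc i ⟧ * (br (dim v) - br a)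
    down-count-⊓ v w i {a} ea = begin
      ∑ elems (λ t → ⟦ t ⋖? v ⟧ * ⟦ dim (t ⊓ w) ℕ.≟ i ⟧)
        ≡⟨ ∑-cong elems pointwise ⟩
      ∑ elems (λ t → m₁ * ⟦ t ⋖? v ⟧ + (m₀ - m₁) * ⟦ k? t ⟧)
        ≡⟨ ∑-distrib-+ elems _ _ ⟩
      ∑ elems (λ t → m₁ * ⟦ t ⋖? v ⟧) + ∑ elems (λ t → (m₀ - m₁) * ⟦ k? t ⟧)
        ≡⟨ cong₂ _+_ (∑-*ˡ elems m₁ _) (∑-*ˡ elems (m₀ - m₁) _) ⟩
      m₁ * ∑ elems (λ t → ⟦ t ⋖? v ⟧) + (m₀ - m₁) * ∑ elems (λ t → ⟦ k? t ⟧)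
        ≡⟨ cong₂ (λ s t → m₁ * s + (m₀ - m₁) * t) (#cocovers v) (down-count (⊓-lowerˡ v w) a ea) ⟩
      m₁ * br (dim v) + (m₀ - m₁) * br a
        ≡⟨ solve 4 (λ m₀ m₁ a b → m₁ :* b :+ (m₀ :- m₁) :* a := m₀ :* a :+ m₁ :* (b :- a)) refl m₀ m₁ (br a) (br (dim v)) ⟩
      m₀ * br a + m₁ * (br (dim v) - br a) ∎
      where
      m₀ = ⟦ dim (v ⊓ w) ℕ.≟ i ⟧
      m₁ = ⟦ dim (v ⊓ w) ℕ.≟ suc i ⟧
      k? : ∀ t → Dec (v ⊓ w ⊑ t × t ⋖ v)
      k? t = (v ⊓ w ⊑? t) ×-dec (t ⋖? v)
      pointwise : ∀ t → ⟦ t ⋖? v ⟧ * ⟦ dim (t ⊓ w) ℕ.≟ i ⟧ ≡ m₁ * ⟦ t ⋖? v ⟧ + (m₀ - m₁) * ⟦ k? t ⟧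
      pointwise t = ⟦⟧-split (t ⋖? v) (k? t) (dim (t ⊓ w) ℕ.≟ i) m₁ m₀ proj₂
        (λ t⋖v (⊑t , _) → ⟦⟧-cong (dim (t ⊓ w) ℕ.≟ i) (dim (v ⊓ w) ℕ.≟ i)
           (trans (sym (⋖-⊓-kept w t⋖v ⊑t))) (trans (⋖-⊓-kept w t⋖v ⊑t)))
        (λ t⋖v ¬k → let ⋢t = λ ⊑t → ¬k (⊑t , t⋖v) in
           ⟦⟧-cong (dim (t ⊓ w) ℕ.≟ i) (dim (v ⊓ w) ℕ.≟ suc i)
             (λ e → trans (sym (⋖-⊓-drops w t⋖v ⋢t)) (cong suc e))
             (λ e → ℕ.suc-injective (trans (⋖-⊓-drops w t⋖v ⋢t) e)))

-- The operators up and down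

module UpDown where

  open Prelude
  import Data.Nat as ℕ
  import Data.Nat.Properties as ℕ
  open FiniteSums
  open Arithmetic
  open SubspaceLattices

  module Operators {Q : ℚ} {1≤Q : 1ℚ ≤ Q} {n : ℕ} (G : Geometry Q 1≤Q n) where
    open Counting G public

    up dn : (El → ℚ) → El → ℚ
    up f v = ∑ elems (λ t → ⟦ t ⋖? v ⟧ * f t)
    dn f t = ∑ elems (λ v → ⟦ t ⋖? v ⟧ * f v)

    ⟨_,_⟩ : (f g : El → ℚ) → ℚ
    ⟨ f , g ⟩ = ∑ elems (λ x → f x * g x)

    -- Reduces identities between composed operators to identities between their kernels.
    ∑-exchange : (k : El → El → ℚ) (m : El → El → ℚ) (f : El → ℚ) → ∀ x →
      ∑ elems (λ y → k x y * ∑ elems (λ z → m y z * f z)) ≡ ∑ elems (λ z → ∑ elems (λ y → k x y * m y z) * f z)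
    ∑-exchange k m f x = begin
      ∑ elems (λ y → k x y * ∑ elems (λ z → m y z * f z))   ≡⟨ ∑-cong elems (λ y → sym (∑-*ˡ elems (k x y) _)) ⟩
      ∑ elems (λ y → ∑ elems (λ z → k x y * (m y z * f z))) ≡⟨ ∑-swap elems elems _ ⟩
      ∑ elems (λ z → ∑ elems (λ y → k x y * (m y z * f z))) ≡⟨ ∑-cong elems (λ z → ∑-cong elems (λ y → sym (*-assoc (k x y) (m y z) (f z)))) ⟩
      ∑ elems (λ z → ∑ elems (λ y → k x y * m y z * f z))   ≡⟨ ∑-cong elems (λ z → ∑-*ʳ elems (f z) _) ⟩
      ∑ elems (λ z → ∑ elems (λ y → k x y * m y z) * f z)   ∎

    adjoint : ∀ f g → ⟨ up f , g ⟩ ≡ ⟨ f , dn g ⟩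
    adjoint f g = begin
      ∑ elems (λ v → up f v * g v)                            ≡⟨ ∑-cong elems (λ v → sym (∑-*ʳ elems (g v) _)) ⟩
      ∑ elems (λ v → ∑ elems (λ t → ⟦ t ⋖? v ⟧ * f t * g v)) ≡⟨ ∑-swap elems elems _ ⟩
      ∑ elems (λ t → ∑ elems (λ v → ⟦ t ⋖? v ⟧ * f t * g v))
        ≡⟨ ∑-cong elems (λ t → ∑-cong elems (λ v → solve 3 (λ a b c → a :* b :* c := b :* (a :* c)) refl ⟦ t ⋖? v ⟧ (f t) (g v))) ⟩
      ∑ elems (λ t → ∑ elems (λ v → f t * (⟦ t ⋖? v ⟧ * g v))) ≡⟨ ∑-cong elems (λ t → ∑-*ˡ elems (f t) _) ⟩
      ∑ elems (λ t → f t * dn g t)                            ∎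

    ⟨⟩-comm : ∀ f g → ⟨ f , g ⟩ ≡ ⟨ g , f ⟩
    ⟨⟩-comm f g = ∑-cong elems (λ x → *-comm (f x) (g x))

    ⟨⟩-congʳ : ∀ f {g h} → g ≗ h → ⟨ f , g ⟩ ≡ ⟨ f , h ⟩
    ⟨⟩-congʳ f e = ∑-cong elems (λ x → cong (f x *_) (e x))

    ⟨⟩-congˡ : ∀ {f g} h → f ≗ g → ⟨ f , h ⟩ ≡ ⟨ g , h ⟩
    ⟨⟩-congˡ h e = ∑-cong elems (λ x → cong (_* h x) (e x))

    ⟨⟩-scaleʳ : ∀ f c g → ⟨ f , (λ x → c * g x) ⟩ ≡ c * ⟨ f , g ⟩
    ⟨⟩-scaleʳ f c g = trans (∑-cong elems (λ x → solve 3 (λ a b c → a :* (b :* c) := b :* (a :* c)) refl (f x) c (g x))) (∑-*ˡ elems c _)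

    up-cong : ∀ {f g} → f ≗ g → up f ≗ up g
    up-cong e v = ∑-cong elems (λ t → cong (⟦ t ⋖? v ⟧ *_) (e t))

    dn-cong : ∀ {f g} → f ≗ g → dn f ≗ dn g
    dn-cong e t = ∑-cong elems (λ v → cong (⟦ t ⋖? v ⟧ *_) (e v))

    up-scale : ∀ c f → up (λ x → c * f x) ≗ (λ v → c * up f v)
    up-scale c f v = trans (∑-cong elems (λ t → solve 3 (λ a b c → a :* (b :* c) := b :* (a :* c)) refl ⟦ t ⋖? v ⟧ c (f t))) (∑-*ˡ elems c _)

    dn-scale : ∀ c f → dn (λ x → c * f x) ≗ (λ v → c * dn f v)
    dn-scale c f t = trans (∑-cong elems (λ v → solve 3 (λ a b c → a :* (b :* c) := b :* (a :* c)) refl ⟦ t ⋖? v ⟧ c (f v))) (∑-*ˡ elems c _)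

    dn-+ : ∀ f g → dn (λ x → f x + g x) ≗ (λ v → dn f v + dn g v)
    dn-+ f g t = trans (∑-cong elems (λ v → *-distribˡ-+ ⟦ t ⋖? v ⟧ (f v) (g v))) (∑-distrib-+ elems _ _)

    ⊑-antisym : ∀ {x y} → x ⊑ y → y ⊑ x → x ≡ y
    ⊑-antisym x⊑y y⊑x = dim-≡ x⊑y (ℕ.≤-antisym (dim-mono x⊑y) (dim-mono y⊑x))

    join-unique : ∀ {v w z} → v ≢ w → v ⋖ z → w ⋖ z → z ≡ v ⊔ w
    join-unique {v} {w} {z} v≢w v⋖z w⋖z with z ⊑? v ⊔ w
    ... | yes z⊑ = ⊑-antisym z⊑ (⊔-least (proj₁ v⋖z) (proj₁ w⋖z))
    ... | no z⋢  = ⊥-elim (v≢w (sym (dim-≡ (subst (w ⊑_) (⋖-between v⋖z (⊔-upperˡ v w)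
        (⊔-least (proj₁ v⋖z) (proj₁ w⋖z)) z⋢) (⊔-upperʳ v w)) (ℕ.suc-injective (trans (proj₂ w⋖z) (sym (proj₂ v⋖z)))))))

    meet-unique : ∀ {v w t} → v ≢ w → t ⋖ v → t ⋖ w → t ≡ v ⊓ w
    meet-unique {v} {w} {t} v≢w t⋖v t⋖w with v ⊑? v ⊓ w
    ... | no v⋢  = sym (⋖-between t⋖v (⊓-greatest (proj₁ t⋖v) (proj₁ t⋖w)) (⊓-lowerˡ v w) v⋢)
    ... | yes v⊑ = ⊥-elim (v≢w (dim-≡ (⊑-trans v⊑ (⊓-lowerʳ v w)) (trans (sym (proj₂ t⋖v)) (proj₂ t⋖w))))

    join⇒meet : ∀ {v w} → v ⋖ v ⊔ w → w ⋖ v ⊔ w → v ⊓ w ⋖ v × v ⊓ w ⋖ w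
    join⇒meet {v} {w} (_ , e) (_ , e′) = (⊓-lowerˡ v w , lower e′ (modular v w)) ,
      (⊓-lowerʳ v w , lower e (trans (modular v w) (ℕ.+-comm (dim v) (dim w))))
      where
      lower : ∀ {a b j m} → suc b ≡ j → j ℕ.+ m ≡ a ℕ.+ b → suc m ≡ a
      lower {a} {b} {_} {m} refl p = ℕ.+-cancelʳ-≡ b _ _ (trans (cong suc (ℕ.+-comm m b)) p)

    meet⇒join : ∀ {v w} → v ⊓ w ⋖ v → v ⊓ w ⋖ w → v ⋖ v ⊔ w × w ⋖ v ⊔ w
    meet⇒join {v} {w} (_ , e) (_ , e′) = (⊔-upperˡ v w , raise e′ (modular v w)) ,
      (⊔-upperʳ v w , raise e (trans (modular v w) (ℕ.+-comm (dim v) (dim w))))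
      where
      raise : ∀ {a b j m} → suc m ≡ b → j ℕ.+ m ≡ a ℕ.+ b → suc a ≡ j
      raise {a} {_} {j} {m} refl p = ℕ.+-cancelʳ-≡ m _ _ (sym (trans p (ℕ.+-suc a m)))

    -- A common cover can only be the join and a common cocover only the meet, and by modularity the
    -- one occurs exactly when the other does: both counts are 1 or both are 0.
    common-covers : ∀ v w → v ≢ w →
      ∑ elems (λ z → ⟦ (v ⋖? z) ×-dec (w ⋖? z) ⟧) ≡ ∑ elems (λ t → ⟦ (t ⋖? v) ×-dec (t ⋖? w) ⟧)
    common-covers v w v≢w with (v ⋖? v ⊔ w) ×-dec (w ⋖? v ⊔ w)
    ... | yes (v⋖ , w⋖) = trans
        (∑-unique (v ⊔ w) (λ z → (v ⋖? z) ×-dec (w ⋖? z)) (v⋖ , w⋖) (λ z (p , q) → join-unique v≢w p q))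
        (sym (∑-unique (v ⊓ w) (λ t → (t ⋖? v) ×-dec (t ⋖? w)) (join⇒meet v⋖ w⋖) (λ t (p , q) → meet-unique v≢w p q)))
    ... | no ¬join = trans
        (∑-none (λ z → (v ⋖? z) ×-dec (w ⋖? z)) (λ z (p , q) → ¬join
          (subst (λ z → v ⋖ z × w ⋖ z) (join-unique v≢w p q) (p , q))))
        (sym (∑-none (λ t → (t ⋖? v) ×-dec (t ⋖? w)) (λ t (p , q) → ¬join
          (let (p′ , q′) = subst (λ t → t ⋖ v × t ⋖ w) (meet-unique v≢w p q) (p , q) in meet⇒join p′ q′))))

    -- Off the diagonal the two kernels agree by `common-covers`; on it they count the covers and
    -- the cocovers of `v`, whose difference is the scalar.
    commutation : ∀ f v {d} → dim v ℕ.+ d ≡ n → dn (up f) v ≡ up (dn f) v + (br d - br (dim v)) * f v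
    commutation f v {d} e = begin
      dn (up f) v
        ≡⟨ ∑-exchange (λ v z → ⟦ v ⋖? z ⟧) (λ z w → ⟦ w ⋖? z ⟧) f v ⟩
      ∑ elems (λ w → ∑ elems (λ z → ⟦ v ⋖? z ⟧ * ⟦ w ⋖? z ⟧) * f w)
        ≡⟨ ∑-cong elems (λ w → trans (cong (_* f w) (kernel w (w ≟ᶠ v)))
             (solve 4 (λ k x c y → (k :+ x :* c) :* y := k :* y :+ c :* (x :* y)) refl (K w) ⟦ w ≟ᶠ v ⟧ c (f w))) ⟩
      ∑ elems (λ w → K w * f w + c * (⟦ w ≟ᶠ v ⟧ * f w))
        ≡⟨ ∑-distrib-+ elems _ _ ⟩
      ∑ elems (λ w → K w * f w) + ∑ elems (λ w → c * (⟦ w ≟ᶠ v ⟧ * f w))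
        ≡⟨ cong₂ _+_ (sym (∑-exchange (λ v t → ⟦ t ⋖? v ⟧) (λ t w → ⟦ t ⋖? w ⟧) f v))
             (trans (∑-*ˡ elems c _) (cong (c *_) (∑-δ v f))) ⟩
      up (dn f) v + c * f v ∎
      where
      c = br d - br (dim v)
      K : El → ℚ
      K w = ∑ elems (λ t → ⟦ t ⋖? v ⟧ * ⟦ t ⋖? w ⟧)
      kernel : ∀ w (w≟v : Dec (w ≡ v)) → ∑ elems (λ z → ⟦ v ⋖? z ⟧ * ⟦ w ⋖? z ⟧) ≡ K w + ⟦ w≟v ⟧ * c
      kernel w (no w≢v) = begin
        ∑ elems (λ z → ⟦ v ⋖? z ⟧ * ⟦ w ⋖? z ⟧)
          ≡⟨ ∑-cong elems (λ z → sym (⟦⟧-× (v ⋖? z) (w ⋖? z))) ⟩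
        ∑ elems (λ z → ⟦ (v ⋖? z) ×-dec (w ⋖? z) ⟧)
          ≡⟨ common-covers v w (λ v≡w → w≢v (sym v≡w)) ⟩
        ∑ elems (λ t → ⟦ (t ⋖? v) ×-dec (t ⋖? w) ⟧)
          ≡⟨ ∑-cong elems (λ t → ⟦⟧-× (t ⋖? v) (t ⋖? w)) ⟩
        K w
          ≡⟨ solve 2 (λ k c → k := k :+ con 0ℚ :* c) refl (K w) c ⟩
        K w + 0ℚ * c ∎
      kernel w (yes refl) = begin
        ∑ elems (λ z → ⟦ v ⋖? z ⟧ * ⟦ v ⋖? z ⟧) ≡⟨ ∑-cong elems (λ z → ⟦⟧-idem (v ⋖? z)) ⟩
        ∑ elems (λ z → ⟦ v ⋖? z ⟧)              ≡⟨ #covers v e ⟩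
        br d                                    ≡⟨ solve 2 (λ a b → a := b :+ con 1ℚ :* (a :- b)) refl (br d) (br (dim v)) ⟩
        br (dim v) + 1ℚ * c                     ≡⟨ cong (_+ 1ℚ * c) (#cocovers v) ⟨
        ∑ elems (λ t → ⟦ t ⋖? v ⟧) + 1ℚ * c     ≡⟨ cong (_+ 1ℚ * c) (∑-cong elems (λ t → sym (⟦⟧-idem (t ⋖? v)))) ⟩
        K v + 1ℚ * c ∎

-- Decomposition of a level into lifts of harmonic functions

module IsotypicDecomposition where

  open Prelude
  open import Data.List using (List; downFrom)
  import Data.Nat as ℕ
  import Data.Nat.Properties as ℕ
  open FiniteSums
  open Arithmetic
  open SubspaceLattices
  open UpDown

  ∑-downFrom-cong : ∀ m {f g : ℕ → ℚ} → (∀ t → t ℕ.< m → f t ≡ g t) → ∑ (downFrom m) f ≡ ∑ (downFrom m) g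
  ∑-downFrom-cong zero    e = refl
  ∑-downFrom-cong (suc m) e = cong₂ _+_ (e m ℕ.≤-refl) (∑-downFrom-cong m (λ t t<m → e t (ℕ.m<n⇒m<1+n t<m)))

  ∑-downFrom-mono : ∀ m {f g : ℕ → ℚ} → (∀ t → t ℕ.< m → f t ≤ g t) → ∑ (downFrom m) f ≤ ∑ (downFrom m) g
  ∑-downFrom-mono zero    e = ≤-refl
  ∑-downFrom-mono (suc m) e = +-mono-≤ (e m ℕ.≤-refl) (∑-downFrom-mono m (λ t t<m → e t (ℕ.m<n⇒m<1+n t<m)))

  module Isotypic {Q : ℚ} {1≤Q : 1ℚ ≤ Q} {n : ℕ} (G : Geometry Q 1≤Q n) where
    open Operators G public

    Level : ℕ → (El → ℚ) → Set
    Level j f = ∀ v → dim v ≢ j → f v ≡ 0ℚ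

    -- Iso t j is the image of the harmonic functions of level t under up ^ (j - t).
    data Iso (t : ℕ) : ℕ → (El → ℚ) → Set where
      harmonic : ∀ {h} → Level t h → (∀ v → dn h v ≡ 0ℚ) → Iso t t h
      lift     : ∀ {j e e′} → Iso t j e → e′ ≗ up e → Iso t (suc j) e′

    Level-up : ∀ {j f} → Level j f → Level (suc j) (up f)
    Level-up {j} {f} L v ne = ∑-zero elems λ t → trans
      (⟦⟧-guard (t ⋖? v) {f t} {0ℚ} (λ (_ , s) → L t (λ e → ne (trans (sym s) (cong suc e))))) (*-zeroʳ ⟦ t ⋖? v ⟧)

    Level-dn : ∀ {j f} → Level (suc j) f → Level j (dn f)
    Level-dn {j} {f} L t ne = ∑-zero elems λ v → trans
      (⟦⟧-guard (t ⋖? v) {f v} {0ℚ} (λ (_ , s) → L v (λ e → ne (ℕ.suc-injective (trans s e))))) (*-zeroʳ ⟦ t ⋖? v ⟧)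

    Level0-harmonic : ∀ {f} → Level 0 f → ∀ t → dn f t ≡ 0ℚ
    Level0-harmonic {f} L t = ∑-zero elems λ v → trans
      (⟦⟧-guard (t ⋖? v) {f v} {0ℚ} (λ (_ , s) → L v (λ e → ℕ.1+n≢0 (trans s e)))) (*-zeroʳ ⟦ t ⋖? v ⟧)

    Iso-level : ∀ {t j e} → Iso t j e → Level j e
    Iso-level (harmonic L _)  = L
    Iso-level (lift I e) v ne = trans (e v) (Level-up (Iso-level I) v ne)

    Iso-scale : ∀ {t j e} c → Iso t j e → Iso t j (λ v → c * e v)
    Iso-scale {e = h} c (harmonic L d) = harmonic (λ v ne → trans (cong (c *_) (L v ne)) (*-zeroʳ c))
      (λ v → trans (dn-scale c h v) (trans (cong (c *_) (d v)) (*-zeroʳ c)))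
    Iso-scale c (lift {e = e} I eq) = lift (Iso-scale c I) (λ v → trans (cong (c *_) (eq v)) (sym (up-scale c e v)))

    private
      br-gap : ∀ {j} → j ℕ.+ j ℕ.< n → 0ℚ < br (n ℕ.∸ j) - br j
      br-gap {j} lt = <⇒0<- (br-mono-< (ℕ.m+n≤o⇒m≤o∸n (suc j) lt))

    half : ∀ {j} → suc j ℕ.+ suc j ℕ.≤ n → j ℕ.+ j ℕ.< n
    half {j} le = ℕ.≤-trans (ℕ.s≤s (ℕ.≤-trans (ℕ.n≤1+n _) (ℕ.≤-reflexive (sym (ℕ.+-suc j j))))) le

    -- Harmonic functions have up dn e = 0, and a lift turns the eigenvalue of dn up below it into
    -- one of up dn; `commutation` then adds [n - j] - [j], which is positive as long as 2j < n.
    -- Positivity is what makes dn up invertible on the component.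
    eigenvalue : ∀ {t j e} → Iso t j e → j ℕ.+ j ℕ.< n → Σ ℚ λ c → 0ℚ < c × (∀ v → dn (up e) v ≡ c * e v)
    eigenvalue {t} {j} {e} I lt with step I lt
      where
      step : ∀ {t j e} → Iso t j e → j ℕ.+ j ℕ.< n →
             Σ ℚ λ b → 0ℚ ≤ b × (∀ v → dim v ≡ j → up (dn e) v ≡ b * e v)
      step {e = h} (harmonic L d) lt = 0ℚ , ≤-refl , λ v _ →
        trans (∑-zero elems (λ t → trans (cong (⟦ t ⋖? v ⟧ *_) (d t)) (*-zeroʳ ⟦ t ⋖? v ⟧))) (sym (*-zeroˡ (h v)))
      step (lift {e = e} {e′} I eq) lt with eigenvalue I (half (ℕ.<⇒≤ lt))
      ... | c , 0<c , E = c , <⇒≤ 0<c , λ v _ → begin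
          up (dn e′) v            ≡⟨ up-cong (dn-cong eq) v ⟩
          up (dn (up e)) v        ≡⟨ up-cong E v ⟩
          up (λ x → c * e x) v    ≡⟨ up-scale c e v ⟩
          c * up e v              ≡⟨ cong (c *_) (eq v) ⟨
          c * e′ v                ∎
    ... | b , 0≤b , S = b + (br (n ℕ.∸ j) - br j) , ≤-<-trans (≤-reflexive (sym (+-identityˡ 0ℚ))) (+-mono-≤-< 0≤b (br-gap {j} lt)) , E
      where
      c = br (n ℕ.∸ j) - br j
      E : ∀ v → dn (up e) v ≡ (b + c) * e v
      E v with dim v ℕ.≟ j
      ... | no ne = trans (Level-dn (Level-up (Iso-level I)) v ne)
                      (sym (trans (cong ((b + c) *_) (Iso-level I v ne)) (*-zeroʳ (b + c))))
      ... | yes refl = trans (commutation e v (ℕ.m+[n∸m]≡n (dim≤n v)))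
                         (trans (cong (_+ c * e v) (S v refl)) (sym (*-distribʳ-+ (e v) b c)))

    -- Moving `up` across the inner product makes both functions descend one level at the price of a
    -- scalar, until one of them is harmonic; then `dn` kills it against a lift. Two harmonic
    -- functions on one level would have t = t′.
    orthogonal : ∀ {t t′ j e e′} → Iso t j e → Iso t′ j e′ → t ≢ t′ → j ℕ.+ j ℕ.≤ n → ⟨ e , e′ ⟩ ≡ 0ℚ
    orthogonal (harmonic _ _) (harmonic _ _) ne le = ⊥-elim (ne refl)
    orthogonal {e = h} {e′} (harmonic _ d) (lift {e = e} I eq) ne le = begin
      ⟨ h , e′ ⟩   ≡⟨ ⟨⟩-congʳ h eq ⟩
      ⟨ h , up e ⟩ ≡⟨ ⟨⟩-comm h (up e) ⟩
      ⟨ up e , h ⟩ ≡⟨ adjoint e h ⟩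
      ⟨ e , dn h ⟩ ≡⟨ ∑-zero elems (λ x → trans (cong (e x *_) (d x)) (*-zeroʳ (e x))) ⟩
      0ℚ           ∎
    orthogonal {e = e′} {h} (lift {e = e} I eq) (harmonic _ d) ne le = begin
      ⟨ e′ , h ⟩   ≡⟨ ⟨⟩-congˡ h eq ⟩
      ⟨ up e , h ⟩ ≡⟨ adjoint e h ⟩
      ⟨ e , dn h ⟩ ≡⟨ ∑-zero elems (λ x → trans (cong (e x *_) (d x)) (*-zeroʳ (e x))) ⟩
      0ℚ           ∎
    orthogonal {e = e₁} {e₂} (lift {e = d₁} I₁ eq₁) (lift {e = d₂} I₂ eq₂) ne le with eigenvalue I₂ (half le)
    ... | c , _ , E = begin
      ⟨ e₁ , e₂ ⟩                ≡⟨ trans (⟨⟩-congˡ e₂ eq₁) (⟨⟩-congʳ (up d₁) eq₂) ⟩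
      ⟨ up d₁ , up d₂ ⟩          ≡⟨ adjoint d₁ (up d₂) ⟩
      ⟨ d₁ , dn (up d₂) ⟩        ≡⟨ ⟨⟩-congʳ d₁ E ⟩
      ⟨ d₁ , (λ x → c * d₂ x) ⟩  ≡⟨ ⟨⟩-scaleʳ d₁ c d₂ ⟩
      c * ⟨ d₁ , d₂ ⟩            ≡⟨ cong (c *_) (orthogonal I₁ I₂ ne (ℕ.<⇒≤ (half le))) ⟩
      c * 0ℚ                     ≡⟨ *-zeroʳ c ⟩
      0ℚ                         ∎

    up-∑ : ∀ {A : Set} (ts : List A) (F : A → El → ℚ) → up (λ x → ∑ ts (λ t → F t x)) ≗ (λ v → ∑ ts (λ t → up (F t) v))
    up-∑ ts F v = trans (∑-cong elems (λ x → sym (∑-*ˡ ts ⟦ x ⋖? v ⟧ _))) (∑-swap elems ts _)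

    dn-∑ : ∀ {A : Set} (ts : List A) (F : A → El → ℚ) → dn (λ x → ∑ ts (λ t → F t x)) ≗ (λ v → ∑ ts (λ t → dn (F t) v))
    dn-∑ ts F v = trans (∑-cong elems (λ x → sym (∑-*ˡ ts ⟦ v ⋖? x ⟧ _))) (∑-swap elems ts _)

    record Decomposition (j : ℕ) (f : El → ℚ) : Set where
      field
        component : ℕ → El → ℚ
        isotypic  : ∀ t → t ℕ.≤ j → Iso t j (component t)
        total     : ∀ v → f v ≡ ∑ (downFrom (suc j)) (λ t → component t v)

    dn-up-invertible : ∀ {t j e} → Iso t j e → j ℕ.+ j ℕ.< n → Σ ℚ λ r → ∀ v → r * dn (up e) v ≡ e v
    dn-up-invertible {e = e} I lt with eigenvalue I lt
    ... | c , 0<c , E = recip c 0<c , λ v → begin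
      recip c 0<c * dn (up e) v ≡⟨ cong (recip c 0<c *_) (E v) ⟩
      recip c 0<c * (c * e v)   ≡⟨ *-assoc (recip c 0<c) c (e v) ⟨
      recip c 0<c * c * e v     ≡⟨ cong (_* e v) (recip-inverse c 0<c) ⟩
      1ℚ * e v                  ≡⟨ *-identityˡ (e v) ⟩
      e v                       ∎

    -- Inverting dn up on each component of `dn f` gives a function `Σg` on level j with dn (up Σg)
    -- = dn f. Hence f - up Σg is harmonic and is the one new component, that of t = j + 1.
    decompose-step : ∀ j f → Level (suc j) f → suc j ℕ.+ suc j ℕ.≤ n → Decomposition j (dn f) → Decomposition (suc j) f
    decompose-step j f L le D = record
      { component = component′
      ; isotypic  = isotypic′
      ; total     = total′
      }
      where
      open Decomposition D
      -- The scalar exists for t <= j only; the value 0 elsewhere makes `r` a total function of `t`.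
      inverse : ∀ t → Dec (t ℕ.≤ j) → Σ ℚ λ r → t ℕ.≤ j → ∀ v → r * dn (up (component t)) v ≡ component t v
      inverse t (yes t≤j) = let (r , E) = dn-up-invertible (isotypic t t≤j) (half le) in r , λ _ → E
      inverse t (no t≰j)  = 0ℚ , λ t≤j → ⊥-elim (t≰j t≤j)
      r : ℕ → ℚ
      r t = proj₁ (inverse t (t ℕ.≤? j))
      g : ℕ → El → ℚ
      g t x = r t * component t x
      Σg h : El → ℚ
      Σg x = ∑ (downFrom (suc j)) (λ t → g t x)
      h x = f x + (- 1ℚ) * up Σg x
      dn-up-Σg : ∀ v → dn (up Σg) v ≡ dn f v
      dn-up-Σg v = begin
        dn (up Σg) v
          ≡⟨ dn-cong (up-∑ (downFrom (suc j)) g) v ⟩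
        dn (λ x → ∑ (downFrom (suc j)) (λ t → up (g t) x)) v
          ≡⟨ dn-∑ (downFrom (suc j)) (λ t → up (g t)) v ⟩
        ∑ (downFrom (suc j)) (λ t → dn (up (g t)) v)
          ≡⟨ ∑-downFrom-cong (suc j) (λ t t<1+j →
               trans (trans (dn-cong (up-scale (r t) (component t)) v) (dn-scale (r t) (up (component t)) v))
                     (proj₂ (inverse t (t ℕ.≤? j)) (ℕ.≤-pred t<1+j) v)) ⟩
        ∑ (downFrom (suc j)) (λ t → component t v)
          ≡⟨ total v ⟨
        dn f v ∎
      h-harmonic : ∀ v → dn h v ≡ 0ℚ
      h-harmonic v = begin
        dn h v                              ≡⟨ dn-+ f (λ x → (- 1ℚ) * up Σg x) v ⟩
        dn f v + dn (λ x → (- 1ℚ) * up Σg x) v ≡⟨ cong (dn f v +_) (trans (dn-scale (- 1ℚ) (up Σg) v) (cong ((- 1ℚ) *_) (dn-up-Σg v))) ⟩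
        dn f v + (- 1ℚ) * dn f v            ≡⟨ solve 1 (λ a → a :+ con (- 1ℚ) :* a := con 0ℚ) refl (dn f v) ⟩
        0ℚ ∎
      Σg-level : Level j Σg
      Σg-level v ne = trans (∑-downFrom-cong (suc j) {g = λ _ → 0ℚ} (λ t t<1+j →
          trans (cong (r t *_) (Iso-level (isotypic t (ℕ.≤-pred t<1+j)) v ne)) (*-zeroʳ (r t))))
        (∑-zero (downFrom (suc j)) (λ _ → refl))
      h-level : Level (suc j) h
      h-level v ne = trans (cong₂ (λ a b → a + (- 1ℚ) * b) (L v ne) (Level-up Σg-level v ne))
                           (solve 0 (con 0ℚ :+ con (- 1ℚ) :* con 0ℚ := con 0ℚ) refl)
      choose : ∀ t → Dec (t ≡ suc j) → El → ℚ
      choose t (yes _) = h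
      choose t (no _)  = up (g t)
      component′ : ℕ → El → ℚ
      component′ t = choose t (t ℕ.≟ suc j)
      isotypic′ : ∀ t → t ℕ.≤ suc j → Iso t (suc j) (component′ t)
      isotypic′ t t≤ with t ℕ.≟ suc j
      ... | yes refl = harmonic h-level h-harmonic
      ... | no t≢    = lift (Iso-scale (r t) (isotypic t (ℕ.≤-pred (ℕ.≤∧≢⇒< t≤ t≢)))) (λ _ → refl)
      choose-top : ∀ d v → choose (suc j) d v ≡ h v
      choose-top (yes _) v = refl
      choose-top (no ne) v = ⊥-elim (ne refl)
      choose-low : ∀ t d → t ℕ.< suc j → ∀ v → choose t d v ≡ up (g t) v
      choose-low t (yes refl) lt v = ⊥-elim (ℕ.<-irrefl refl lt)
      choose-low t (no _)     lt v = refl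
      total′ : ∀ v → f v ≡ ∑ (downFrom (suc (suc j))) (λ t → component′ t v)
      total′ v = sym (begin
        component′ (suc j) v + ∑ (downFrom (suc j)) (λ t → component′ t v)
          ≡⟨ cong₂ _+_ (choose-top (suc j ℕ.≟ suc j) v)
               (∑-downFrom-cong (suc j) (λ t lt → choose-low t (t ℕ.≟ suc j) lt v)) ⟩
        h v + ∑ (downFrom (suc j)) (λ t → up (g t) v)
          ≡⟨ cong (h v +_) (up-∑ (downFrom (suc j)) g v) ⟨
        h v + up Σg v
          ≡⟨ solve 2 (λ f u → (f :+ con (- 1ℚ) :* u) :+ u := f) refl (f v) (up Σg v) ⟩
        f v ∎)

    decompose : ∀ j f → Level j f → j ℕ.+ j ℕ.≤ n → Decomposition j f
    decompose zero f L le = record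
      { component = λ _ → f
      ; isotypic  = λ where zero ℕ.z≤n → harmonic L (Level0-harmonic L)
      ; total     = λ v → sym (+-identityʳ (f v))
      }
    decompose (suc j) f L le = decompose-step j f L le (decompose j (dn f) (Level-dn L) (ℕ.<⇒≤ (half le)))

-- The graph of trivially intersecting subspaces on harmonic functions

module Hoffman where

  open Prelude
  import Data.Nat as ℕ
  import Data.Nat.Properties as ℕ
  open FiniteSums
  open Arithmetic
  open SubspaceLattices
  open UpDown
  open IsotypicDecomposition

  module Kneser {Q : ℚ} {1≤Q : 1ℚ ≤ Q} {n : ℕ} (G : Geometry Q 1≤Q n) where
    open Isotypic G public

    -- `disj` is the adjacency operator of the graph and `incl` the inclusion operator. Both accept
    -- functions on any level, so that their quotient can be followed along a tower of lifts up to
    -- level k, where `incl` becomes the identity.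
    disj incl : (El → ℚ) → El → ℚ
    disj e w = ∑ elems (λ v → ⟦ dim (v ⊓ w) ℕ.≟ 0 ⟧ * e v)
    incl e w = ∑ elems (λ v → ⟦ v ⊑? w ⟧ * e v)

    ∑-level-cong : ∀ {j e} {K K′ : El → ℚ} → Level j e → (∀ t → dim t ≡ j → K t ≡ K′ t) →
                   ∑ elems (λ t → K t * e t) ≡ ∑ elems (λ t → K′ t * e t)
    ∑-level-cong {j} {e} {K} {K′} L eq = ∑-cong elems pointwise
      where
      pointwise : ∀ t → K t * e t ≡ K′ t * e t
      pointwise t with dim t ℕ.≟ j
      ... | yes d = cong (_* e t) (eq t d)
      ... | no ¬d = trans (trans (cong (K t *_) (L t ¬d)) (*-zeroʳ (K t)))
                          (sym (trans (cong (K′ t *_) (L t ¬d)) (*-zeroʳ (K′ t))))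

    module _ {k : ℕ} {w : El} (dim-w : dim w ≡ k) where


      -- If `t` meets `w` trivially, then of its [n - j] covers precisely the [k] below `t ⊔ w` meet
      -- `w`; if `t` meets `w` already, all of its covers do.
      disj-up : ∀ {j e} → Level j e → disj (up e) w ≡ (br (n ℕ.∸ j) - br k) * disj e w
      disj-up {j} {e} L = begin
        disj (up e) w
          ≡⟨ ∑-exchange (λ _ v → ⟦ dim (v ⊓ w) ℕ.≟ 0 ⟧) (λ v t → ⟦ t ⋖? v ⟧) e w ⟩
        ∑ elems (λ t → ∑ elems (λ v → ⟦ dim (v ⊓ w) ℕ.≟ 0 ⟧ * ⟦ t ⋖? v ⟧) * e t)
          ≡⟨ ∑-level-cong L kernel ⟩
        ∑ elems (λ t → (D * ⟦ dim (t ⊓ w) ℕ.≟ 0 ⟧) * e t)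
          ≡⟨ ∑-cong elems (λ t → *-assoc D ⟦ dim (t ⊓ w) ℕ.≟ 0 ⟧ (e t)) ⟩
        ∑ elems (λ t → D * (⟦ dim (t ⊓ w) ℕ.≟ 0 ⟧ * e t))
          ≡⟨ ∑-*ˡ elems D _ ⟩
        D * disj e w ∎
        where
        D = br (n ℕ.∸ j) - br k
        kernel : ∀ t → dim t ≡ j → ∑ elems (λ v → ⟦ dim (v ⊓ w) ℕ.≟ 0 ⟧ * ⟦ t ⋖? v ⟧) ≡ D * ⟦ dim (t ⊓ w) ℕ.≟ 0 ⟧
        kernel t refl = begin
          ∑ elems (λ v → ⟦ dim (v ⊓ w) ℕ.≟ 0 ⟧ * ⟦ t ⋖? v ⟧)
            ≡⟨ ∑-cong elems (λ v → trans (*-comm ⟦ dim (v ⊓ w) ℕ.≟ 0 ⟧ ⟦ t ⋖? v ⟧)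
                 (cong (_* ⟦ dim (v ⊓ w) ℕ.≟ 0 ⟧) (⟦⟧-cong (t ⋖? v) ((t ⋖? v) ×-dec (v ⊑? top)) (λ p → p , top-max v) proj₁))) ⟩
          ∑ elems (λ v → ⟦ (t ⋖? v) ×-dec (v ⊑? top) ⟧ * ⟦ dim (v ⊓ w) ℕ.≟ 0 ⟧)
            ≡⟨ up-count-⊓ 0 {a} (top-max t) (top-max w) (trans (ℕ.m+[n∸m]≡n (dim≤n t)) (sym dim-top)) a-eq ⟩
          ⟦ dim (t ⊓ w) ℕ.≟ 0 ⟧ * (br (n ℕ.∸ dim t) - br a) + 0ℚ * br a
            ≡⟨ cong₂ _+_ (⟦⟧-guard (dim (t ⊓ w) ℕ.≟ 0) (λ z → cong (λ a → br (n ℕ.∸ dim t) - br a)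
                 (trans (cong (ℕ._+ a) (sym z)) (trans a-eq dim-w)))) (*-zeroˡ (br a)) ⟩
          ⟦ dim (t ⊓ w) ℕ.≟ 0 ⟧ * D + 0ℚ
            ≡⟨ trans (+-identityʳ _) (*-comm ⟦ dim (t ⊓ w) ℕ.≟ 0 ⟧ D) ⟩
          D * ⟦ dim (t ⊓ w) ℕ.≟ 0 ⟧ ∎
          where
          a = dim w ℕ.∸ dim (t ⊓ w)
          a-eq : dim (t ⊓ w) ℕ.+ a ≡ dim w
          a-eq = ℕ.m+[n∸m]≡n (dim-mono (⊓-lowerʳ t w))

      incl-up : ∀ {j e} → Level j e → j ℕ.≤ k → incl (up e) w ≡ br (k ℕ.∸ j) * incl e w
      incl-up {j} {e} L j≤k = begin
        incl (up e) w
          ≡⟨ ∑-exchange (λ _ v → ⟦ v ⊑? w ⟧) (λ v t → ⟦ t ⋖? v ⟧) e w ⟩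
        ∑ elems (λ t → ∑ elems (λ v → ⟦ v ⊑? w ⟧ * ⟦ t ⋖? v ⟧) * e t)
          ≡⟨ ∑-level-cong L kernel ⟩
        ∑ elems (λ t → (b * ⟦ t ⊑? w ⟧) * e t)
          ≡⟨ ∑-cong elems (λ t → *-assoc b ⟦ t ⊑? w ⟧ (e t)) ⟩
        ∑ elems (λ t → b * (⟦ t ⊑? w ⟧ * e t))
          ≡⟨ ∑-*ˡ elems b _ ⟩
        b * incl e w ∎
        where
        b = br (k ℕ.∸ j)
        kernel : ∀ t → dim t ≡ j → ∑ elems (λ v → ⟦ v ⊑? w ⟧ * ⟦ t ⋖? v ⟧) ≡ b * ⟦ t ⊑? w ⟧
        kernel t refl = begin
          ∑ elems (λ v → ⟦ v ⊑? w ⟧ * ⟦ t ⋖? v ⟧)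
            ≡⟨ ∑-cong elems (λ v → trans (*-comm ⟦ v ⊑? w ⟧ ⟦ t ⋖? v ⟧) (sym (⟦⟧-× (t ⋖? v) (v ⊑? w)))) ⟩
          ∑ elems (λ v → ⟦ (t ⋖? v) ×-dec (v ⊑? w) ⟧)
            ≡⟨ ∑-fiber elems b (t ⊑? w) (λ v → (t ⋖? v) ×-dec (v ⊑? w)) (λ (t⋖v , v⊑w) → ⊑-trans (proj₁ t⋖v) v⊑w)
                 (λ t⊑w → up-count t⊑w (trans (ℕ.m+[n∸m]≡n j≤k) (sym dim-w))) ⟩
          b * ⟦ t ⊑? w ⟧ ∎

      incl-level : ∀ {e} → Level k e → incl e w ≡ e w
      incl-level {e} L = trans (∑-level-cong {K′ = λ v → ⟦ v ≟ᶠ w ⟧} L (λ v d → ⟦⟧-cong (v ⊑? w) (v ≟ᶠ w)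
          (λ v⊑w → dim-≡ v⊑w (trans d (sym dim-w))) ⊑-reflexive))
        (∑-δ w e)

    -- `fac` is the Q-factorial, and `sgn t` is (-1)^t Q^(t(t - 1)/2).
    fac sgn : ℕ → ℚ
    fac zero    = 1ℚ
    fac (suc d) = br (suc d) * fac d
    sgn zero    = 1ℚ
    sgn (suc t) = - (pw t * sgn t)

    0<fac : ∀ d → 0ℚ < fac d
    0<fac zero    = 0<1
    0<fac (suc d) = *-pos (0<br d) (0<fac d)

    module _ {t : ℕ} {h : El → ℚ} (L : Level t h) (dn-h : ∀ v → dn h v ≡ 0ℚ) (w : El) where


      meetSum : ℕ → ℚ
      meetSum i = ∑ elems (λ v → ⟦ dim (v ⊓ w) ℕ.≟ i ⟧ * h v)

      -- The sum of dn h over all `u` with dim (u ⊓ w) = i, evaluated by `down-count-⊓`: only `v`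
      -- whose meet with `w` has dimension i or i + 1 contribute, with weights [d + 1] and [t] - [d]
      -- = Q^d [i + 1].
      meetSum-step : ∀ i d → i ℕ.+ suc d ≡ t → br (suc d) * meetSum i + pw d * br (suc i) * meetSum (suc i) ≡ 0ℚ
      meetSum-step i d e = begin
        br (suc d) * meetSum i + c * meetSum (suc i)
          ≡⟨ cong₂ _+_ (sym (∑-*ˡ elems (br (suc d)) _)) (sym (∑-*ˡ elems c _)) ⟩
        ∑ elems (λ v → br (suc d) * (⟦ dim (v ⊓ w) ℕ.≟ i ⟧ * h v)) + ∑ elems (λ v → c * (⟦ dim (v ⊓ w) ℕ.≟ suc i ⟧ * h v))
          ≡⟨ ∑-distrib-+ elems _ _ ⟨
        ∑ elems (λ v → br (suc d) * (⟦ dim (v ⊓ w) ℕ.≟ i ⟧ * h v) + c * (⟦ dim (v ⊓ w) ℕ.≟ suc i ⟧ * h v))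
          ≡⟨ ∑-cong elems (λ v → solve 5 (λ a x c y h → a :* (x :* h) :+ c :* (y :* h) := (x :* a :+ y :* c) :* h) refl
               (br (suc d)) ⟦ dim (v ⊓ w) ℕ.≟ i ⟧ c ⟦ dim (v ⊓ w) ℕ.≟ suc i ⟧ (h v)) ⟩
        ∑ elems (λ v → (⟦ dim (v ⊓ w) ℕ.≟ i ⟧ * br (suc d) + ⟦ dim (v ⊓ w) ℕ.≟ suc i ⟧ * c) * h v)
          ≡⟨ ∑-level-cong L kernel ⟨
        ∑ elems (λ v → ∑ elems (λ u → ⟦ dim (u ⊓ w) ℕ.≟ i ⟧ * ⟦ u ⋖? v ⟧) * h v)
          ≡⟨ ∑-exchange (λ _ u → ⟦ dim (u ⊓ w) ℕ.≟ i ⟧) (λ u v → ⟦ u ⋖? v ⟧) h w ⟨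
        ∑ elems (λ u → ⟦ dim (u ⊓ w) ℕ.≟ i ⟧ * dn h u)
          ≡⟨ ∑-zero elems (λ u → trans (cong (⟦ dim (u ⊓ w) ℕ.≟ i ⟧ *_) (dn-h u)) (*-zeroʳ ⟦ dim (u ⊓ w) ℕ.≟ i ⟧)) ⟩
        0ℚ ∎
        where
        c = pw d * br (suc i)
        kernel : ∀ v → dim v ≡ t → ∑ elems (λ u → ⟦ dim (u ⊓ w) ℕ.≟ i ⟧ * ⟦ u ⋖? v ⟧)
                 ≡ ⟦ dim (v ⊓ w) ℕ.≟ i ⟧ * br (suc d) + ⟦ dim (v ⊓ w) ℕ.≟ suc i ⟧ * c
        kernel v dim-v = begin
          ∑ elems (λ u → ⟦ dim (u ⊓ w) ℕ.≟ i ⟧ * ⟦ u ⋖? v ⟧)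
            ≡⟨ ∑-cong elems (λ u → *-comm ⟦ dim (u ⊓ w) ℕ.≟ i ⟧ ⟦ u ⋖? v ⟧) ⟩
          ∑ elems (λ u → ⟦ u ⋖? v ⟧ * ⟦ dim (u ⊓ w) ℕ.≟ i ⟧)
            ≡⟨ down-count-⊓ v w i {a} a-eq ⟩
          ⟦ dim (v ⊓ w) ℕ.≟ i ⟧ * br a + ⟦ dim (v ⊓ w) ℕ.≟ suc i ⟧ * (br (dim v) - br a)
            ≡⟨ cong₂ _+_
                 (⟦⟧-guard (dim (v ⊓ w) ℕ.≟ i) (λ m → cong br (a-is (suc d) m e)))
                 (⟦⟧-guard (dim (v ⊓ w) ℕ.≟ suc i) (λ m → diff (a-is d m (trans (sym (ℕ.+-suc i d)) e)))) ⟩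
          ⟦ dim (v ⊓ w) ℕ.≟ i ⟧ * br (suc d) + ⟦ dim (v ⊓ w) ℕ.≟ suc i ⟧ * c ∎
          where
          a = dim v ℕ.∸ dim (v ⊓ w)
          a-eq : dim (v ⊓ w) ℕ.+ a ≡ dim v
          a-eq = ℕ.m+[n∸m]≡n (dim-⊓≤ v w)
          a-is : ∀ {m} b → dim (v ⊓ w) ≡ m → m ℕ.+ b ≡ t → a ≡ b
          a-is {m} b refl p = ℕ.+-cancelˡ-≡ m _ _ (trans a-eq (trans dim-v (sym p)))
          diff : a ≡ d → br (dim v) - br a ≡ c
          diff refl = begin
            br (dim v) - br a                    ≡⟨ cong (λ m → br m - br a) (trans dim-v (trans (sym e) (trans (ℕ.+-suc i a) (ℕ.+-comm (suc i) a)))) ⟩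
            br (a ℕ.+ suc i) - br a              ≡⟨ cong (_- br a) (br-+ a (suc i)) ⟩
            (br a + pw a * br (suc i)) - br a    ≡⟨ solve 2 (λ x y → (x :+ y) :- x := y) refl (br a) (pw a * br (suc i)) ⟩
            pw a * br (suc i)                    ∎

      -- The recursion solved downwards from i = t: the quotient of `meetSum i` and `meetSum t` is
      -- `sgn d` times the Gaussian coefficient [t, d], written with factorials to avoid division.
      meetSum-closed : ∀ d i → i ℕ.+ d ≡ t → meetSum i * (fac d * fac i) ≡ sgn d * (fac t * meetSum t)
      meetSum-closed zero i e with trans (sym (ℕ.+-identityʳ i)) e
      ... | refl = solve 2 (λ s f → s :* (con 1ℚ :* f) := con 1ℚ :* (f :* s)) refl (meetSum i) (fac i)
      meetSum-closed (suc d) i e = begin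
        meetSum i * ((br (suc d) * fac d) * fac i)
          ≡⟨ solve 6 (λ s b f g p s′ → s :* ((b :* f) :* g) := (b :* s :+ p :* s′) :* (f :* g) :- p :* s′ :* (f :* g)) refl
               (meetSum i) (br (suc d)) (fac d) (fac i) (pw d * br (suc i)) (meetSum (suc i)) ⟩
        (br (suc d) * meetSum i + pw d * br (suc i) * meetSum (suc i)) * (fac d * fac i) - pw d * br (suc i) * meetSum (suc i) * (fac d * fac i)
          ≡⟨ cong (λ z → z * (fac d * fac i) - pw d * br (suc i) * meetSum (suc i) * (fac d * fac i)) (meetSum-step i d e) ⟩
        0ℚ * (fac d * fac i) - pw d * br (suc i) * meetSum (suc i) * (fac d * fac i)
          ≡⟨ solve 5 (λ p b s f g → con 0ℚ :* (f :* g) :- p :* b :* s :* (f :* g) := :- (p :* (s :* (f :* (b :* g))))) refl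
               (pw d) (br (suc i)) (meetSum (suc i)) (fac d) (fac i) ⟩
        - (pw d * (meetSum (suc i) * (fac d * fac (suc i))))
          ≡⟨ cong (λ z → - (pw d * z)) (meetSum-closed d (suc i) (trans (sym (ℕ.+-suc i d)) e)) ⟩
        - (pw d * (sgn d * (fac t * meetSum t)))
          ≡⟨ solve 3 (λ p s z → :- (p :* (s :* z)) := (:- (p :* s)) :* z) refl (pw d) (sgn d) (fac t * meetSum t) ⟩
        sgn (suc d) * (fac t * meetSum t) ∎

      -- The case i = 0 of `meetSum-closed`. At the other end, dim (v ⊓ w) = t = dim v means that
      -- `v` lies below `w`.
      disj-harmonic : disj h w ≡ sgn t * incl h w
      disj-harmonic = *-cancelˡ-≡ (0<fac t) (begin
        fac t * meetSum 0                ≡⟨ solve 2 (λ f s → f :* s := s :* (f :* con 1ℚ)) refl (fac t) (meetSum 0) ⟩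
        meetSum 0 * (fac t * fac 0)      ≡⟨ meetSum-closed t 0 refl ⟩
        sgn t * (fac t * meetSum t)      ≡⟨ cong (λ s → sgn t * (fac t * s)) all-inside ⟩
        sgn t * (fac t * incl h w)       ≡⟨ solve 3 (λ s f x → s :* (f :* x) := f :* (s :* x)) refl (sgn t) (fac t) (incl h w) ⟩
        fac t * (sgn t * incl h w)       ∎)
        where
        all-inside : meetSum t ≡ incl h w
        all-inside = ∑-level-cong L (λ v d → ⟦⟧-cong (dim (v ⊓ w) ℕ.≟ t) (v ⊑? w)
          (λ p → dim-⊓≡⇒⊑ v w (trans p (sym d))) (λ v⊑w → trans (cong dim (⊓≡ v⊑w)) d))

-- Eigenvalues and the Erdős-Ko-Rado bound

module ErdosKoRado where

  open Prelude
  open import Data.List using (List; downFrom)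
  import Data.Nat as ℕ
  import Data.Nat.Properties as ℕ
  open FiniteSums
  open Arithmetic
  open SubspaceLattices
  open UpDown
  open IsotypicDecomposition
  open Hoffman

  ∑-downFrom-δ : ∀ m i → i ℕ.< m → (f : ℕ → ℚ) → ∑ (downFrom m) (λ t → ⟦ t ℕ.≟ i ⟧ * f t) ≡ f i
  ∑-downFrom-δ (suc m) i i<1+m f = by (m ℕ.≟ i)
    where
    by : Dec (m ≡ i) → ∑ (downFrom (suc m)) (λ t → ⟦ t ℕ.≟ i ⟧ * f t) ≡ f i
    by (yes refl) = begin
      ⟦ m ℕ.≟ m ⟧ * f m + ∑ (downFrom m) (λ t → ⟦ t ℕ.≟ m ⟧ * f t)
        ≡⟨ cong₂ _+_ (cong (_* f m) (⟦⟧-yes (m ℕ.≟ m) refl)) (∑-downFrom-cong m {g = λ _ → 0ℚ} (λ t t<m →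
             trans (cong (_* f t) (⟦⟧-no (t ℕ.≟ m) (ℕ.<⇒≢ t<m))) (*-zeroˡ (f t)))) ⟩
      1ℚ * f m + ∑ (downFrom m) (λ _ → 0ℚ)
        ≡⟨ cong₂ _+_ (*-identityˡ (f m)) (∑-zero (downFrom m) (λ _ → refl)) ⟩
      f m + 0ℚ
        ≡⟨ +-identityʳ (f m) ⟩
      f m ∎
    by (no ne) = begin
      ⟦ m ℕ.≟ i ⟧ * f m + ∑ (downFrom m) (λ t → ⟦ t ℕ.≟ i ⟧ * f t)
        ≡⟨ cong₂ _+_ (trans (cong (_* f m) (⟦⟧-no (m ℕ.≟ i) ne)) (*-zeroˡ (f m)))
             (∑-downFrom-δ m i (ℕ.≤∧≢⇒< (ℕ.≤-pred i<1+m) (λ e → ne (sym e))) f) ⟩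
      0ℚ + f i
        ≡⟨ +-identityˡ (f i) ⟩
      f i ∎

  module KneserSpectrum {Q : ℚ} {1≤Q : 1ℚ ≤ Q} {n : ℕ} (G : Geometry Q 1≤Q n) (k : ℕ) (2k≤n : k ℕ.+ k ℕ.≤ n) where
    open Kneser G public

    gap : ℕ → ℚ
    gap t = br (n ℕ.∸ t) - br k

    k<n∸t : ∀ {t} → t ℕ.< k → k ℕ.< n ℕ.∸ t
    k<n∸t {t} t<k = ℕ.m+n≤o⇒m≤o∸n (suc k) (ℕ.≤-trans (ℕ.≤-trans (ℕ.≤-reflexive (sym (ℕ.+-suc k t))) (ℕ.+-monoʳ-≤ k t<k)) 2k≤n)

    0<gap : ∀ {t} → t ℕ.< k → 0ℚ < gap t
    0<gap t<k = <⇒0<- (br-mono-< (k<n∸t t<k))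

    0<br-∸ : ∀ {t} → t ℕ.< k → 0ℚ < br (k ℕ.∸ t)
    0<br-∸ {t} t<k = br-mono-< {0} (ℕ.m<n⇒0<n∸m t<k)

    -- The quotient, up to sign, of the eigenvalues for t + 1 and t. Going from t to t + 1
    -- multiplies `sgn` by -Q^t and saves the lift from level t to t + 1, which contributes `gap t`
    -- to `disj` and [k - t] to `incl`.
    ratio : ℕ → ℚ
    ratio t = (pw t * br (k ℕ.∸ t)) * inv (gap t)

    -- β k * σ t is the eigenvalue of disj on the t-th isotypic component of level k.
    β σ τ : ℕ → ℚ
    β zero    = 1ℚ
    β (suc j) = β j * (gap j * inv (br (k ℕ.∸ j)))
    σ zero    = 1ℚ
    σ (suc t) = - (σ t * ratio t)
    τ zero    = 1ℚ
    τ (suc t) = τ t * ratio t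

    0<β : ∀ j → j ℕ.≤ k → 0ℚ < β j
    0<β zero    _   = 0<1
    0<β (suc j) j<k = *-pos (0<β j (ℕ.<⇒≤ j<k)) (*-pos (0<gap j<k) (0<inv _ (0<br-∸ j<k)))

    0≤ratio : ∀ {t} → t ℕ.< k → 0ℚ ≤ ratio t
    0≤ratio {t} t<k = <⇒≤ (*-pos (*-pos (0<pw t) (0<br-∸ t<k)) (0<inv _ (0<gap t<k)))

    -- The denominator [n - t] - [k] equals Q^k [n - t - k]. It dominates Q^t [k - t] factor by
    -- factor, the second factor because 2k <= n.
    ratio≤1 : ∀ {t} → t ℕ.< k → ratio t ≤ 1ℚ
    ratio≤1 {t} t<k = ≤-trans (*-monoʳ (<⇒≤ (0<inv _ (0<gap t<k))) num≤gap)
      (≤-reflexive (trans (*-comm (gap t) (inv (gap t))) (inv-* _ (0<gap t<k))))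
      where
      rest = n ℕ.∸ t ℕ.∸ k
      gap-eq : gap t ≡ pw k * br rest
      gap-eq = trans (cong (λ m → br m - br k) (sym (ℕ.m+[n∸m]≡n (ℕ.<⇒≤ (k<n∸t t<k)))))
        (trans (cong (_- br k) (br-+ k rest)) (solve 2 (λ x y → (x :+ y) :- x := y) refl (br k) (pw k * br rest)))
      k∸t≤rest : k ℕ.∸ t ℕ.≤ rest
      k∸t≤rest = subst (k ℕ.∸ t ℕ.≤_) (trans (ℕ.∸-+-assoc n k t) (trans (cong (n ℕ.∸_) (ℕ.+-comm k t)) (sym (ℕ.∸-+-assoc n t k))))
        (ℕ.∸-monoˡ-≤ t (ℕ.m+n≤o⇒m≤o∸n k 2k≤n))
      num≤gap : pw t * br (k ℕ.∸ t) ≤ gap t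
      num≤gap = ≤-trans (*-mono (<⇒≤ (0<pw t)) (0≤br rest) (pw-mono (ℕ.<⇒≤ t<k)) (br-mono k∸t≤rest))
                        (≤-reflexive (sym gap-eq))

    0≤τ : ∀ t → t ℕ.≤ k → 0ℚ ≤ τ t
    0≤τ zero    _   = 0≤1
    0≤τ (suc t) t<k = *-nonneg (0≤τ t (ℕ.<⇒≤ t<k)) (0≤ratio t<k)

    τ≤τ₁ : ∀ t → suc t ℕ.≤ k → τ (suc t) ≤ τ 1
    τ≤τ₁ zero    _   = ≤-refl
    τ≤τ₁ (suc t) t<k = ≤-trans (≤-trans (*-monoˡ (0≤τ (suc t) (ℕ.<⇒≤ t<k)) (ratio≤1 t<k)) (≤-reflexive (*-identityʳ _)))
                               (τ≤τ₁ t (ℕ.<⇒≤ t<k))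

    -- The bound of |σ t| by τ t. Both halves are carried along because the sign change in σ derives
    -- each of them from the other.
    σ-bounds : ∀ t → t ℕ.≤ k → 0ℚ ≤ σ t + τ t × 0ℚ ≤ τ t - σ t
    σ-bounds zero    _   = +-nonneg 0≤1 0≤1 , ≤-refl
    σ-bounds (suc t) t<k with σ-bounds t (ℕ.<⇒≤ t<k)
    ... | lo , hi =
      ≤-trans (*-nonneg hi (0≤ratio t<k)) (≤-reflexive
        (solve 3 (λ s t r → (t :- s) :* r := :- (s :* r) :+ t :* r) refl (σ t) (τ t) (ratio t))) ,
      ≤-trans (*-nonneg lo (0≤ratio t<k)) (≤-reflexive
        (solve 3 (λ s t r → (s :+ t) :* r := t :* r :- (:- (s :* r))) refl (σ t) (τ t) (ratio t)))

    -- Thus `τ 1` is [k] / ([n] - [k]), which makes Hoffman's fraction τ 1 / (1 + τ 1) equal to [k]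
    -- / [n].
    τ₁-gap : 0 ℕ.< k → τ 1 * gap 0 ≡ br k
    τ₁-gap 0<k = trans (solve 3 (λ b i g → (con 1ℚ :* ((con 1ℚ :* b) :* i)) :* g := b :* (i :* g)) refl (br k) (inv (gap 0)) (gap 0))
      (trans (cong (br k *_) (inv-* _ (0<gap 0<k))) (*-identityʳ (br k)))


    -- The start of the induction in `disj-isotypic`. Since `β` collects the factors of all lifts
    -- from level 0 on, `σ` divides out those below level t; at level k the dependence on t then
    -- sits in `σ` alone.
    sgn≡βσ : ∀ t → t ℕ.≤ k → sgn t ≡ β t * σ t
    sgn≡βσ zero    _   = refl
    sgn≡βσ (suc t) t<k = sym (begin
      (β t * (gap t * inv b)) * (- (σ t * ((pw t * b) * inv (gap t))))
        ≡⟨ solve 7 (λ β g i σ p b j → (β :* (g :* i)) :* (:- (σ :* ((p :* b) :* j))) := :- (p :* (β :* σ)) :* ((i :* b) :* (j :* g))) refl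
             (β t) (gap t) (inv b) (σ t) (pw t) b (inv (gap t)) ⟩
      - (pw t * (β t * σ t)) * ((inv b * b) * (inv (gap t) * gap t))
        ≡⟨ cong₂ (λ x y → - (pw t * (β t * σ t)) * (x * y)) (inv-* b (0<br-∸ t<k)) (inv-* (gap t) (0<gap t<k)) ⟩
      - (pw t * (β t * σ t)) * (1ℚ * 1ℚ)
        ≡⟨ *-identityʳ (- (pw t * (β t * σ t))) ⟩
      - (pw t * (β t * σ t))
        ≡⟨ cong (λ x → - (pw t * x)) (sgn≡βσ t (ℕ.<⇒≤ t<k)) ⟨
      - (pw t * sgn t) ∎)
      where b = br (k ℕ.∸ t)

    -- A lift multiplies `disj` by `gap j` and `incl` by [k - j], so their quotient picks up exactly
    -- the factor from `β j` to `β (suc j)`.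
    disj-isotypic : ∀ {t j e} → Iso t j e → j ℕ.≤ k → ∀ {w} → dim w ≡ k → disj e w ≡ β j * σ t * incl e w
    disj-isotypic {t} {e = h} (harmonic L d) t≤k {w} dim-w =
      trans (disj-harmonic L d w) (cong (_* incl h w) (sgn≡βσ t t≤k))
    disj-isotypic {t} (lift {j} {e} {e′} I eq) j<k {w} dim-w = begin
      disj e′ w
        ≡⟨ ∑-cong elems (λ v → cong (⟦ dim (v ⊓ w) ℕ.≟ 0 ⟧ *_) (eq v)) ⟩
      disj (up e) w
        ≡⟨ disj-up dim-w (Iso-level I) ⟩
      gap j * disj e w
        ≡⟨ cong (gap j *_) (disj-isotypic I (ℕ.<⇒≤ j<k) dim-w) ⟩
      gap j * (β j * σ t * incl e w)
        ≡⟨ solve 4 (λ g β σ x → g :* (β :* σ :* x) := (β :* g :* σ :* x) :* con 1ℚ) refl (gap j) (β j) (σ t) (incl e w) ⟩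
      β j * gap j * σ t * incl e w * 1ℚ
        ≡⟨ cong (β j * gap j * σ t * incl e w *_) (inv-* b (0<br-∸ j<k)) ⟨
      β j * gap j * σ t * incl e w * (inv b * b)
        ≡⟨ solve 6 (λ β g σ x i b → β :* g :* σ :* x :* (i :* b) := (β :* (g :* i)) :* σ :* (b :* x)) refl
             (β j) (gap j) (σ t) (incl e w) (inv b) b ⟩
      β (suc j) * σ t * (b * incl e w)
        ≡⟨ cong (β (suc j) * σ t *_) (incl-up dim-w (Iso-level I) (ℕ.<⇒≤ j<k)) ⟨
      β (suc j) * σ t * incl (up e) w
        ≡⟨ cong (β (suc j) * σ t *_) (∑-cong elems (λ v → cong (⟦ v ⊑? w ⟧ *_) (eq v))) ⟨
      β (suc j) * σ t * incl e′ w ∎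
      where b = br (k ℕ.∸ j)

    -- Summing dn h = 0 over all subspaces counts every value of `h` with weight [t], which is
    -- positive; each further lift multiplies the total by [n - j].
    ∑-isotypic : ∀ {t j e} → Iso t j e → 0 ℕ.< t → ∑ elems e ≡ 0ℚ
    ∑-isotypic (harmonic {h} L d) (ℕ.s≤s {n = t} _) = *-cancelˡ-≡ (0<br t) (begin
      br (suc t) * ∑ elems h                        ≡⟨ ∑-*ˡ elems (br (suc t)) h ⟨
      ∑ elems (λ v → br (suc t) * h v)              ≡⟨ ∑-level-cong {K′ = λ v → ∑ elems (λ t → ⟦ t ⋖? v ⟧)} L
                                                         (λ v e → trans (cong br (sym e)) (sym (#cocovers v))) ⟩
      ∑ elems (λ v → ∑ elems (λ t → ⟦ t ⋖? v ⟧) * h v) ≡⟨ ∑-cong elems (λ v → sym (∑-*ʳ elems (h v) _)) ⟩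
      ∑ elems (λ v → ∑ elems (λ t → ⟦ t ⋖? v ⟧ * h v)) ≡⟨ ∑-swap elems elems _ ⟩
      ∑ elems (dn h)                                ≡⟨ ∑-zero elems d ⟩
      0ℚ                                            ≡⟨ *-zeroʳ (br (suc t)) ⟨
      br (suc t) * 0ℚ                               ∎)
    ∑-isotypic {t} (lift {j} {e} {e′} I eq) 0<t = begin
      ∑ elems e′                                          ≡⟨ ∑-cong elems eq ⟩
      ∑ elems (up e)                                      ≡⟨ ∑-swap elems elems _ ⟩
      ∑ elems (λ t → ∑ elems (λ v → ⟦ t ⋖? v ⟧ * e t))   ≡⟨ ∑-cong elems (λ t → ∑-*ʳ elems (e t) _) ⟩
      ∑ elems (λ t → ∑ elems (λ v → ⟦ t ⋖? v ⟧) * e t)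
        ≡⟨ ∑-level-cong {K′ = λ _ → br (n ℕ.∸ j)} (Iso-level I) (λ t d → #covers t (trans (cong (ℕ._+ (n ℕ.∸ j)) d)
             (ℕ.m+[n∸m]≡n (subst (ℕ._≤ n) d (dim≤n t))))) ⟩
      ∑ elems (λ t → br (n ℕ.∸ j) * e t)                  ≡⟨ ∑-*ˡ elems (br (n ℕ.∸ j)) e ⟩
      br (n ℕ.∸ j) * ∑ elems e                            ≡⟨ cong (br (n ℕ.∸ j) *_) (∑-isotypic I 0<t) ⟩
      br (n ℕ.∸ j) * 0ℚ                                   ≡⟨ *-zeroʳ (br (n ℕ.∸ j)) ⟩
      0ℚ                                                  ∎

    bot-unique : ∀ {v} → dim v ≡ 0 → v ≡ bot
    bot-unique d = sym (dim-≡ (bot-min _) (trans dim-bot (sym d)))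

    -- Level 0 holds the bottom alone, and lifting the indicator of level j gives [j + 1] times that
    -- of level j + 1.
    constant : ∀ {j e} → Iso 0 j e → Σ ℚ λ c → ∀ v → e v ≡ c * ⟦ dim v ℕ.≟ j ⟧
    constant (harmonic {h} L _) = h bot , λ v → value v (dim v ℕ.≟ 0)
      where
      value : ∀ v (d : Dec (dim v ≡ 0)) → h v ≡ h bot * ⟦ d ⟧
      value v (yes d) = trans (cong h (bot-unique d)) (sym (*-identityʳ (h bot)))
      value v (no ¬d) = trans (L v ¬d) (sym (*-zeroʳ (h bot)))
    constant (lift {j} {e} {e′} I eq) with constant I
    ... | c , E = c * br (suc j) , value
      where
      value : ∀ v → e′ v ≡ c * br (suc j) * ⟦ dim v ℕ.≟ suc j ⟧
      value v = begin
        e′ v                                        ≡⟨ eq v ⟩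
        ∑ elems (λ t → ⟦ t ⋖? v ⟧ * e t)            ≡⟨ ∑-cong elems pointwise ⟩
        ∑ elems (λ t → ⟦ t ⋖? v ⟧ * (c * ⟦ dim v ℕ.≟ suc j ⟧)) ≡⟨ ∑-*ʳ elems (c * ⟦ dim v ℕ.≟ suc j ⟧) _ ⟩
        ∑ elems (λ t → ⟦ t ⋖? v ⟧) * (c * ⟦ dim v ℕ.≟ suc j ⟧) ≡⟨ cong (_* (c * ⟦ dim v ℕ.≟ suc j ⟧)) (#cocovers v) ⟩
        br (dim v) * (c * ⟦ dim v ℕ.≟ suc j ⟧)      ≡⟨ solve 3 (λ b c x → b :* (c :* x) := c :* (x :* b)) refl (br (dim v)) c ⟦ dim v ℕ.≟ suc j ⟧ ⟩
        c * (⟦ dim v ℕ.≟ suc j ⟧ * br (dim v))      ≡⟨ cong (c *_) (⟦⟧-guard (dim v ℕ.≟ suc j) (cong br)) ⟩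
        c * (⟦ dim v ℕ.≟ suc j ⟧ * br (suc j))      ≡⟨ solve 3 (λ b c x → c :* (x :* b) := c :* b :* x) refl (br (suc j)) c ⟦ dim v ℕ.≟ suc j ⟧ ⟩
        c * br (suc j) * ⟦ dim v ℕ.≟ suc j ⟧        ∎
        where
        pointwise : ∀ t → ⟦ t ⋖? v ⟧ * e t ≡ ⟦ t ⋖? v ⟧ * (c * ⟦ dim v ℕ.≟ suc j ⟧)
        pointwise t = ⟦⟧-guard (t ⋖? v) (λ (_ , s) → trans (E t) (cong (c *_)
          (⟦⟧-cong (dim t ℕ.≟ j) (dim v ℕ.≟ suc j) (λ d → trans (sym s) (cong suc d)) (λ d → ℕ.suc-injective (trans s d)))))

    module _ {A : El → Set} (A? : ∀ x → Dec (A x)) (A-dim : ∀ {x} → A x → dim x ≡ k)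
             (A-meet : ∀ {x y} → A x → A y → dim (x ⊓ y) ≢ 0) (0<k : 0 ℕ.< k) where

      private
        f : El → ℚ
        f x = ⟦ A? x ⟧

        f-level : Level k f
        f-level v ne = ⟦⟧-no (A? v) (λ a → ne (A-dim a))

        open Decomposition (decompose k f f-level 2k≤n)

        ts : List ℕ
        ts = downFrom (suc k)

        size levelSize : ℚ
        size = ∑ elems f
        levelSize = ∑ elems (λ v → ⟦ dim v ℕ.≟ k ⟧)

        norm : ℕ → ℚ
        norm t = ⟨ component t , component t ⟩

        iso : ∀ t → t ℕ.< suc k → Iso t k (component t)
        iso t lt = isotypic t (ℕ.≤-pred lt)

        ⟨f,⟩ : ∀ t → t ℕ.< suc k → ⟨ f , component t ⟩ ≡ norm t
        ⟨f,⟩ t lt = begin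
          ⟨ f , component t ⟩
            ≡⟨ ∑-cong elems (λ v → trans (cong (_* component t v) (total v)) (sym (∑-*ʳ ts (component t v) (λ u → component u v)))) ⟩
          ∑ elems (λ v → ∑ ts (λ u → component u v * component t v))
            ≡⟨ ∑-swap elems ts _ ⟩
          ∑ ts (λ u → ⟨ component u , component t ⟩)
            ≡⟨ ∑-downFrom-cong (suc k) (λ u lu → diagonal u lu (u ℕ.≟ t)) ⟩
          ∑ ts (λ u → ⟦ u ℕ.≟ t ⟧ * norm u)
            ≡⟨ ∑-downFrom-δ (suc k) t lt norm ⟩
          norm t ∎
          where
          diagonal : ∀ u → u ℕ.< suc k → (d : Dec (u ≡ t)) → ⟨ component u , component t ⟩ ≡ ⟦ d ⟧ * norm u
          diagonal u lu (yes refl) = sym (*-identityˡ _)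
          diagonal u lu (no ne)    = trans (orthogonal (iso u lu) (iso t lt) ne 2k≤n) (sym (*-zeroˡ (norm u)))

        no-disjoint : ∀ w → f w * disj f w ≡ 0ℚ
        no-disjoint w with A? w
        ... | no _  = *-zeroˡ (disj f w)
        ... | yes a = trans (cong (1ℚ *_) (∑-zero elems λ v →
                trans (⟦⟧-guard (dim (v ⊓ w) ℕ.≟ 0) {⟦ A? v ⟧} {0ℚ} (λ z → ⟦⟧-no (A? v) (λ a′ → A-meet a′ a z)))
                      (*-zeroʳ ⟦ dim (v ⊓ w) ℕ.≟ 0 ⟧)))
              (*-zeroʳ 1ℚ)

        disj-f : ∀ w → dim w ≡ k → disj f w ≡ β k * ∑ ts (λ t → σ t * component t w)
        disj-f w dim-w = begin
          disj f w
            ≡⟨ ∑-cong elems (λ v → trans (cong (⟦ dim (v ⊓ w) ℕ.≟ 0 ⟧ *_) (total v)) (sym (∑-*ˡ ts ⟦ dim (v ⊓ w) ℕ.≟ 0 ⟧ (λ t → component t v)))) ⟩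
          ∑ elems (λ v → ∑ ts (λ t → ⟦ dim (v ⊓ w) ℕ.≟ 0 ⟧ * component t v))
            ≡⟨ ∑-swap elems ts _ ⟩
          ∑ ts (λ t → disj (component t) w)
            ≡⟨ ∑-downFrom-cong (suc k) (λ t lt → trans (disj-isotypic (iso t lt) ℕ.≤-refl dim-w)
                 (trans (cong (β k * σ t *_) (incl-level dim-w (Iso-level (iso t lt)))) (*-assoc (β k) (σ t) (component t w)))) ⟩
          ∑ ts (λ t → β k * (σ t * component t w))
            ≡⟨ ∑-*ˡ ts (β k) (λ t → σ t * component t w) ⟩
          β k * ∑ ts (λ t → σ t * component t w) ∎

        -- The expansion of ⟨ f , disj f ⟩, which vanishes because no two members of `A`, equal or
        -- not, meet trivially; the common factor `β k` is cancelled.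
        spectral : ∑ ts (λ t → σ t * norm t) ≡ 0ℚ
        spectral = *-cancelˡ-≡ (0<β k ℕ.≤-refl) (begin
          β k * ∑ ts (λ t → σ t * norm t)
            ≡⟨ cong (β k *_) (∑-downFrom-cong (suc k) (λ t lt → trans (cong (σ t *_) (sym (⟨f,⟩ t lt))) (sym (∑-*ˡ elems (σ t) _)))) ⟩
          β k * ∑ ts (λ t → ∑ elems (λ w → σ t * (f w * component t w)))
            ≡⟨ cong (β k *_) (∑-swap ts elems _) ⟩
          β k * ∑ elems (λ w → ∑ ts (λ t → σ t * (f w * component t w)))
            ≡⟨ ∑-*ˡ elems (β k) _ ⟨
          ∑ elems (λ w → β k * ∑ ts (λ t → σ t * (f w * component t w)))
            ≡⟨ ∑-cong elems (λ w → cong (β k *_) (trans (∑-cong ts (λ t →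
                 solve 3 (λ a b c → a :* (b :* c) := b :* (a :* c)) refl (σ t) (f w) (component t w))) (∑-*ˡ ts (f w) (λ t → σ t * component t w)))) ⟩
          ∑ elems (λ w → β k * (f w * ∑ ts (λ t → σ t * component t w)))
            ≡⟨ ∑-cong elems (λ w → solve 3 (λ a b c → a :* (b :* c) := (a :* c) :* b) refl (β k) (f w) (∑ ts (λ t → σ t * component t w))) ⟩
          ∑ elems (λ w → (β k * ∑ ts (λ t → σ t * component t w)) * f w)
            ≡⟨ ∑-level-cong {K′ = disj f} f-level (λ w d → sym (disj-f w d)) ⟩
          ∑ elems (λ w → disj f w * f w)
            ≡⟨ ∑-zero elems (λ w → trans (*-comm (disj f w) (f w)) (no-disjoint w)) ⟩
          0ℚ
            ≡⟨ *-zeroʳ (β k) ⟨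
          β k * 0ℚ ∎)

        ∑norm : ∑ ts norm ≡ size
        ∑norm = begin
          ∑ ts norm                                     ≡⟨ ∑-downFrom-cong (suc k) (λ t lt → sym (⟨f,⟩ t lt)) ⟩
          ∑ ts (λ t → ∑ elems (λ v → f v * component t v)) ≡⟨ ∑-swap ts elems _ ⟩
          ∑ elems (λ v → ∑ ts (λ t → f v * component t v)) ≡⟨ ∑-cong elems (λ v → trans (∑-*ˡ ts (f v) (λ t → component t v)) (cong (f v *_) (sym (total v)))) ⟩
          ∑ elems (λ v → f v * f v)                     ≡⟨ ∑-cong elems (λ v → ⟦⟧-idem (A? v)) ⟩
          size                                          ∎

        norm₀-bound : (1ℚ + τ 1) * norm 0 ≤ τ 1 * size
        norm₀-bound = 0≤-⇒≤ (≤-trans (≤-reflexive lhs) (≤-trans (∑-downFrom-mono (suc k) pointwise) (≤-reflexive rhs)))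
          where
          lhs : 0ℚ ≡ ∑ ts (λ _ → 0ℚ)
          lhs = sym (∑-zero ts (λ _ → refl))
          g : ℕ → ℚ
          g t = σ t * norm t + τ 1 * norm t
          0≤norm : ∀ t → 0ℚ ≤ norm t
          0≤norm t = ∑-nonneg elems (λ v → 0≤-square (component t v))
          pointwise : ∀ t → t ℕ.< suc k → 0ℚ ≤ g t - ⟦ t ℕ.≟ 0 ⟧ * ((1ℚ + τ 1) * norm t)
          pointwise zero lt = ≤-reflexive (solve 2 (λ τ x → con 0ℚ := (con 1ℚ :* x :+ τ :* x) :- con 1ℚ :* ((con 1ℚ :+ τ) :* x)) refl (τ 1) (norm 0))
          pointwise (suc t) lt = ≤-trans
            (*-nonneg (≤-trans (proj₁ (σ-bounds (suc t) (ℕ.≤-pred lt))) (+-monoʳ-≤ (σ (suc t)) (τ≤τ₁ t (ℕ.≤-pred lt)))) (0≤norm (suc t)))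
            (≤-reflexive (solve 4 (λ s τ x y → (s :+ τ) :* x := (s :* x :+ τ :* x) :- con 0ℚ :* y) refl
              (σ (suc t)) (τ 1) (norm (suc t)) ((1ℚ + τ 1) * norm (suc t))))
          rhs : ∑ ts (λ t → g t - ⟦ t ℕ.≟ 0 ⟧ * ((1ℚ + τ 1) * norm t)) ≡ τ 1 * size - (1ℚ + τ 1) * norm 0
          rhs = begin
            ∑ ts (λ t → g t - ⟦ t ℕ.≟ 0 ⟧ * ((1ℚ + τ 1) * norm t))
              ≡⟨ ∑-distrib-- ts g (λ t → ⟦ t ℕ.≟ 0 ⟧ * ((1ℚ + τ 1) * norm t)) ⟩
            ∑ ts g - ∑ ts (λ t → ⟦ t ℕ.≟ 0 ⟧ * ((1ℚ + τ 1) * norm t))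
              ≡⟨ cong₂ _-_ (trans (∑-distrib-+ ts (λ t → σ t * norm t) (λ t → τ 1 * norm t)) (cong₂ _+_ spectral (trans (∑-*ˡ ts (τ 1) norm) (cong (τ 1 *_) ∑norm))))
                           (∑-downFrom-δ (suc k) 0 (ℕ.s≤s ℕ.z≤n) (λ t → (1ℚ + τ 1) * norm t)) ⟩
            (0ℚ + τ 1 * size) - (1ℚ + τ 1) * norm 0
              ≡⟨ cong (_- (1ℚ + τ 1) * norm 0) (+-identityˡ (τ 1 * size)) ⟩
            τ 1 * size - (1ℚ + τ 1) * norm 0 ∎

        -- The trivial component is the constant size / levelSize on level k, since the other
        -- components have sum 0.
        levelSize*norm₀ : levelSize * norm 0 ≡ size * size
        levelSize*norm₀ with constant (iso 0 (ℕ.s≤s ℕ.z≤n))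
        ... | c , E = begin
          levelSize * norm 0          ≡⟨ cong (levelSize *_) norm₀ ⟩
          levelSize * (c * size)      ≡⟨ solve 3 (λ n c s → n :* (c :* s) := (c :* n) :* s) refl levelSize c size ⟩
          (c * levelSize) * size      ≡⟨ cong (_* size) size-eq ⟨
          size * size                 ∎
          where
          norm₀ : norm 0 ≡ c * size
          norm₀ = begin
            norm 0                                      ≡⟨ ⟨f,⟩ 0 (ℕ.s≤s ℕ.z≤n) ⟨
            ∑ elems (λ v → f v * component 0 v)         ≡⟨ ∑-cong elems (λ v → *-comm (f v) (component 0 v)) ⟩
            ∑ elems (λ v → component 0 v * f v)         ≡⟨ ∑-level-cong {K′ = λ _ → c} f-level (λ v d → trans (E v)
                                                             (trans (cong (c *_) (⟦⟧-yes (dim v ℕ.≟ k) d)) (*-identityʳ c))) ⟩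
            ∑ elems (λ v → c * f v)                     ≡⟨ ∑-*ˡ elems c f ⟩
            c * size                                    ∎
          size-eq : size ≡ c * levelSize
          size-eq = begin
            ∑ elems f                                   ≡⟨ ∑-cong elems total ⟩
            ∑ elems (λ v → ∑ ts (λ t → component t v))  ≡⟨ ∑-swap elems ts _ ⟩
            ∑ ts (λ t → ∑ elems (component t))          ≡⟨ ∑-downFrom-cong (suc k) only₀ ⟩
            ∑ ts (λ t → ⟦ t ℕ.≟ 0 ⟧ * ∑ elems (component t)) ≡⟨ ∑-downFrom-δ (suc k) 0 (ℕ.s≤s ℕ.z≤n) (λ t → ∑ elems (component t)) ⟩
            ∑ elems (component 0)                       ≡⟨ ∑-cong elems E ⟩
            ∑ elems (λ v → c * ⟦ dim v ℕ.≟ k ⟧)         ≡⟨ ∑-*ˡ elems c _ ⟩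
            c * levelSize                               ∎
            where
            only₀ : ∀ t → t ℕ.< suc k → ∑ elems (component t) ≡ ⟦ t ℕ.≟ 0 ⟧ * ∑ elems (component t)
            only₀ zero    lt = sym (*-identityˡ _)
            only₀ (suc t) lt = trans (∑-isotypic (iso (suc t) lt) (ℕ.s≤s ℕ.z≤n)) (sym (*-zeroˡ (∑ elems (component (suc t)))))

      -- `norm₀-bound` multiplied by `levelSize` and `gap 0`: by `levelSize*norm₀` and `τ₁-gap` its
      -- sides become size * size * [n] and size * [k] * levelSize.
      erdős-ko-rado : ∑ elems (λ x → ⟦ A? x ⟧) * br n ≤ br k * ∑ elems (λ x → ⟦ dim x ℕ.≟ k ⟧)
      erdős-ko-rado with 0ℚ <? size
      -- The empty family stands apart, since a factor `size` is cancelled in the other case.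
      ... | no ¬0< = ≤-trans (≤-reflexive (trans (cong (_* br n) (≤-antisym (≮⇒≥ ¬0<) (∑-nonneg elems (λ v → 0≤⟦⟧ (A? v))))) (*-zeroˡ (br n))))
                             (*-nonneg (0≤br k) (∑-nonneg elems (λ v → 0≤⟦⟧ (dim v ℕ.≟ k))))
      ... | yes 0<size = *-cancelˡ-≤ 0<size (≤-trans (≤-reflexive left) (≤-trans
              (*-monoʳ (<⇒≤ (0<gap 0<k)) (*-monoˡ (∑-nonneg elems (λ v → 0≤⟦⟧ (dim v ℕ.≟ k))) norm₀-bound)) (≤-reflexive right)))
        where
        left : size * (size * br n) ≡ levelSize * ((1ℚ + τ 1) * norm 0) * gap 0
        left = begin
          size * (size * br n)
            ≡⟨ solve 4 (λ s b c x → s :* (s :* b) := (b :- c :+ c) :* (s :* s)) refl size (br n) (br k) (τ 1) ⟩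
          (gap 0 + br k) * (size * size)
            ≡⟨ cong₂ (λ x y → (gap 0 + x) * y) (τ₁-gap 0<k) levelSize*norm₀ ⟨
          (gap 0 + τ 1 * gap 0) * (levelSize * norm 0)
            ≡⟨ solve 4 (λ g t l m → (g :+ t :* g) :* (l :* m) := l :* ((con 1ℚ :+ t) :* m) :* g) refl (gap 0) (τ 1) levelSize (norm 0) ⟩
          levelSize * ((1ℚ + τ 1) * norm 0) * gap 0 ∎
        right : levelSize * (τ 1 * size) * gap 0 ≡ size * (br k * levelSize)
        right = trans (solve 4 (λ l t s g → l :* (t :* s) :* g := s :* ((t :* g) :* l)) refl levelSize (τ 1) size (gap 0))
                      (cong (λ x → size * (x * levelSize)) (τ₁-gap 0<k))

-- Linear systems and comparison of cardinalities by rank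

module LinearSystems where

  open Prelude
  open import Data.Fin using (Fin; zero; suc; punchIn)
  open import Data.Fin.Properties using (any?)
  open import Data.List as List using (List; []; _∷_; filter; length)
  open import Data.List.Membership.Propositional using (_∈_)
  open import Data.List.Membership.Propositional.Properties using (∈-filter⁻; ∈-filter⁺; ∈-lookup)
  open import Data.List.Relation.Unary.All as All using (All; []; _∷_)
  open import Data.List.Relation.Unary.AllPairs using ([]; _∷_)
  open import Data.List.Relation.Unary.Any as Any using (here; there)
  open import Data.List.Relation.Unary.Unique.Propositional using (Unique)
  import Data.List.Relation.Unary.Unique.Propositional.Properties as Unique
  import Data.Nat as ℕ
  import Data.Nat.Properties as ℕ
  open import Data.Vec.Functional using (insertAt)
  open import Data.Vec.Functional.Properties using (insertAt-lookup; insertAt-punchIn)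
  open import Algebra.Bundles using (CommutativeRing)
  open import Algebra.Properties.CommutativeMonoid.Sum (CommutativeRing.+-commutativeMonoid +-*-commutativeRing)
    using (sum; sum-remove; sum-cong-≗)
  open FiniteSums
  open Arithmetic

  sum-zero : ∀ {c} {f : Fin c → ℚ} → (∀ i → f i ≡ 0ℚ) → sum f ≡ 0ℚ
  sum-zero {zero}  e = refl
  sum-zero {suc c} e = cong₂ _+_ (e zero) (sum-zero (λ i → e (suc i)))

  sum-+ : ∀ {c} (a : ℚ) (f g : Fin c → ℚ) → sum (λ i → f i + a * g i) ≡ sum f + a * sum g
  sum-+ {zero}  a f g = sym (trans (+-identityˡ (a * 0ℚ)) (*-zeroʳ a))
  sum-+ {suc c} a f g = trans (cong (f zero + a * g zero +_) (sum-+ a (λ i → f (suc i)) (λ i → g (suc i))))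
    (solve 5 (λ a x y z w → (x :+ a :* y) :+ (z :+ a :* w) := (x :+ z) :+ a :* (y :+ w)) refl a (f zero) (g zero) _ _)

  -- Gaussian elimination on the first row: a zero row is dropped; otherwise the column of a pivot
  -- `p` is eliminated from the other rows, and the first equation is solved for the unknown at `p`.
  dependency : ∀ {r c} → r ℕ.< c → (M : Fin r → Fin c → ℚ) →
               Σ (Fin c → ℚ) λ x → (∃ λ i → x i ≢ 0ℚ) × (∀ a → sum (λ i → M a i * x i) ≡ 0ℚ)
  dependency {zero}  {suc c} _ M = (λ _ → 1ℚ) , (zero , λ ()) , λ ()
  dependency {suc r} {suc c} (ℕ.s≤s r<c) M with any? (λ p → ¬? (M zero p ≟ 0ℚ))
  ... | no ¬pivot with dependency (ℕ.m<n⇒m<1+n r<c) (λ a → M (suc a))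
  ...   | x , x≢0 , eqs = x , x≢0 , λ where
            zero    → sum-zero (λ i → trans (cong (_* x i) (decidable-stable (M zero i ≟ 0ℚ) (λ ne → ¬pivot (i , ne)))) (*-zeroˡ (x i)))
            (suc a) → eqs a
  dependency {suc r} {suc c} (ℕ.s≤s r<c) M | yes (p , m≢0) = solution
    where
    m = M zero p
    m⁻¹ = 1/_ m {{≢-nonZero m≢0}}
    row : Fin (suc r) → Fin c → ℚ
    row a j = M a (punchIn p j)
    reduced : Fin r → Fin c → ℚ
    reduced a j = row (suc a) j - M (suc a) p * m⁻¹ * row zero j
    solution : Σ (Fin (suc c) → ℚ) λ x → (∃ λ i → x i ≢ 0ℚ) × (∀ a → sum (λ i → M a i * x i) ≡ 0ℚ)
    solution with dependency r<c reduced
    ... | x , (i , xi≢0) , eqs = insertAt x p v , (punchIn p i , λ e → xi≢0 (trans (sym (insertAt-punchIn x p v i)) e)) , check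
      where
      dot : Fin (suc r) → ℚ
      dot a = sum (λ j → row a j * x j)
      v = - (m⁻¹ * dot zero)
      split : ∀ a → sum (λ i → M a i * insertAt x p v i) ≡ M a p * v + dot a
      split a = trans (sum-remove {i = p} (λ i → M a i * insertAt x p v i))
        (cong₂ _+_ (cong (M a p *_) (insertAt-lookup x p v)) (sum-cong-≗ (λ j → cong (row a j *_) (insertAt-punchIn x p v j))))
      check : ∀ a → sum (λ i → M a i * insertAt x p v i) ≡ 0ℚ
      check zero = trans (split zero) (trans
        (solve 3 (λ m i d → m :* (:- (i :* d)) :+ d := (con 1ℚ :- i :* m) :* d) refl m m⁻¹ (dot zero))
        (trans (cong (λ t → (1ℚ - t) * dot zero) (*-inverseˡ m {{≢-nonZero m≢0}})) (*-zeroˡ (dot zero))))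
      check (suc a) = trans (split (suc a)) (begin
        M (suc a) p * v + dot (suc a)
          ≡⟨ solve 4 (λ b i d e → b :* (:- (i :* d)) :+ e := e :+ (:- (b :* i)) :* d) refl (M (suc a) p) m⁻¹ (dot zero) (dot (suc a)) ⟩
        dot (suc a) + (- (M (suc a) p * m⁻¹)) * dot zero
          ≡⟨ sum-+ (- (M (suc a) p * m⁻¹)) (λ j → row (suc a) j * x j) (λ j → row zero j * x j) ⟨
        sum (λ j → row (suc a) j * x j + (- (M (suc a) p * m⁻¹)) * (row zero j * x j))
          ≡⟨ sum-cong-≗ (λ j → solve 4 (λ y b z x → y :* x :+ (:- b) :* (z :* x) := (y :- b :* z) :* x) refl
               (row (suc a) j) (M (suc a) p * m⁻¹) (row zero j) (x j)) ⟩
        sum (λ j → reduced a j * x j)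
          ≡⟨ eqs a ⟩
        0ℚ ∎)

  ∑-filter : ∀ {A : Set} {P : A → Set} (P? : ∀ x → Dec (P x)) (xs : List A) (f : A → ℚ) →
             ∑ (filter P? xs) f ≡ ∑ xs (λ x → ⟦ P? x ⟧ * f x)
  ∑-filter P? []       f = refl
  ∑-filter P? (x ∷ xs) f with P? x
  ... | yes _ = cong₂ _+_ (sym (*-identityˡ (f x))) (∑-filter P? xs f)
  ... | no _  = trans (∑-filter P? xs f) (sym (trans (cong (_+ _) (*-zeroˡ (f x))) (+-identityˡ _)))

  ∑-1-mono : ∀ {A B : Set} (xs : List A) (ys : List B) → length xs ℕ.≤ length ys → ∑ xs (λ _ → 1ℚ) ≤ ∑ ys (λ _ → 1ℚ)
  ∑-1-mono []       ys       _ = ∑-nonneg ys (λ _ → 0≤1)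
  ∑-1-mono (x ∷ xs) (y ∷ ys) (ℕ.s≤s le) = +-monoʳ-≤ 1ℚ (∑-1-mono xs ys le)

  lookup-injective : ∀ {A : Set} {xs : List A} → Unique xs → ∀ i j → List.lookup xs i ≡ List.lookup xs j → i ≡ j
  lookup-injective (_ ∷ _)   zero    zero    e = refl
  lookup-injective (x∉ ∷ _)  zero    (suc j) e = ⊥-elim (All.lookup x∉ (∈-lookup j) e)
  lookup-injective (x∉ ∷ _)  (suc i) zero    e = ⊥-elim (All.lookup x∉ (∈-lookup i) (sym e))
  lookup-injective (_ ∷ xs!) (suc i) (suc j) e = cong suc (lookup-injective xs! i j e)

  sum-single : ∀ {c} (i : Fin c) (f : Fin c → ℚ) → (∀ j → j ≢ i → f j ≡ 0ℚ) → sum f ≡ f i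
  sum-single zero    f z = trans (cong (f zero +_) (sum-zero (λ j → z (suc j) (λ ())))) (+-identityʳ (f zero))
  sum-single (suc i) f z = trans (cong₂ _+_ (z zero (λ ())) (sum-single i (λ j → f (suc j)) (λ j ne → z (suc j) (λ { refl → ne refl }))))
                                 (+-identityˡ (f (suc i)))

  ∑-sum-swap : ∀ {A : Set} {c} (xs : List A) (F : A → Fin c → ℚ) →
               ∑ xs (λ x → sum (F x)) ≡ sum (λ i → ∑ xs (λ x → F x i))
  ∑-sum-swap {c = c} [] F = sym (sum-zero {c} {λ _ → 0ℚ} (λ _ → refl))
  ∑-sum-swap (x ∷ xs) F = begin
    sum (F x) + ∑ xs (λ x → sum (F x))                  ≡⟨ cong (sum (F x) +_) (∑-sum-swap xs F) ⟩
    sum (F x) + sum (λ i → ∑ xs (λ x → F x i))          ≡⟨ cong (sum (F x) +_) (*-identityˡ _) ⟨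
    sum (F x) + 1ℚ * sum (λ i → ∑ xs (λ x → F x i))     ≡⟨ sum-+ 1ℚ (F x) _ ⟨
    sum (λ i → F x i + 1ℚ * ∑ xs (λ x → F x i))         ≡⟨ sum-cong-≗ (λ i → cong (F x i +_) (*-identityˡ (∑ xs (λ x → F x i)))) ⟩
    sum (λ i → F x i + ∑ xs (λ x → F x i))              ∎

  module Rank {E : Set} (fin : Finite E) where
    open Finite fin

    ∈⇒1≤∑ : ∀ {a} {xs : List E} → a ∈ xs → 1ℚ ≤ ∑ xs (λ x → ⟦ x ≟ᶠ a ⟧)
    ∈⇒1≤∑ {a} {x ∷ xs} (here refl) = ≤-trans (≤-reflexive (sym (+-identityʳ 1ℚ)))
      (+-mono-≤ (≤-reflexive (sym (⟦⟧-yes (a ≟ᶠ a) refl))) (∑-nonneg xs (λ x → 0≤⟦⟧ (x ≟ᶠ a))))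
    ∈⇒1≤∑ {a} {x ∷ xs} (there a∈xs) = ≤-trans (≤-reflexive (sym (+-identityˡ 1ℚ))) (+-mono-≤ (0≤⟦⟧ (x ≟ᶠ a)) (∈⇒1≤∑ a∈xs))

    ∑≤1⇒Unique : (xs : List E) → (∀ a → ∑ xs (λ x → ⟦ x ≟ᶠ a ⟧) ≤ 1ℚ) → Unique xs
    ∑≤1⇒Unique []       _ = []
    ∑≤1⇒Unique (x ∷ xs) b = All.tabulate fresh ∷ ∑≤1⇒Unique xs (λ a → ≤-trans
        (≤-trans (≤-reflexive (sym (+-identityˡ _))) (+-monoˡ-≤ _ (0≤⟦⟧ (x ≟ᶠ a)))) (b a))
      where
      fresh : ∀ {y} → y ∈ xs → x ≢ y
      fresh y∈xs refl = <-irrefl refl (<-≤-trans {1ℚ} {1ℚ + 1ℚ}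
        (≤-<-trans (≤-reflexive (sym (+-identityʳ 1ℚ))) (+-monoʳ-< 1ℚ 0<1))
        (≤-trans (+-mono-≤ (≤-reflexive (sym (⟦⟧-yes (x ≟ᶠ x) refl))) (∈⇒1≤∑ y∈xs)) (b x)))

    elems! : Unique elems
    elems! = ∑≤1⇒Unique elems (λ a → ≤-reflexive (∑-δ-1 a))

    ∈-elems : ∀ a → a ∈ elems
    ∈-elems a = go elems (λ e → <⇒≢ 0<1 (trans (sym e) (∑-δ-1 a)))
      where
      go : ∀ xs → ∑ xs (λ x → ⟦ x ≟ᶠ a ⟧) ≢ 0ℚ → a ∈ xs
      go []       ne = ⊥-elim (ne refl)
      go (x ∷ xs) ne with x ≟ᶠ a
      ... | yes refl = here refl
      ... | no _     = there (go xs (λ e → ne (trans (+-identityˡ _) e)))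

    -- With more unknowns, indexed by `A`, than equations, indexed by `B`, `dependency` would give a
    -- nonzero function on `A` that the matrix kills.
    rank : {A B : E → Set} (A? : ∀ x → Dec (A x)) (B? : ∀ x → Dec (B x)) (M : E → E → ℚ) →
           (∀ f → (∀ x → ¬ A x → f x ≡ 0ℚ) → (∀ z → B z → ∑ elems (λ x → M z x * f x) ≡ 0ℚ) → ∀ x → A x → f x ≡ 0ℚ) →
           ∑ elems (λ x → ⟦ A? x ⟧) ≤ ∑ elems (λ x → ⟦ B? x ⟧)
    rank {A} {B} A? B? M inj with length (filter A? elems) ℕ.≤? length (filter B? elems)
    ... | yes le = ≤-trans (≤-reflexive (size A?)) (≤-trans (∑-1-mono (filter A? elems) (filter B? elems) le) (≤-reflexive (sym (size B?))))
      where
      size : {P : E → Set} (P? : ∀ x → Dec (P x)) → ∑ elems (λ x → ⟦ P? x ⟧) ≡ ∑ (filter P? elems) (λ _ → 1ℚ)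
      size P? = sym (trans (∑-filter P? elems (λ _ → 1ℚ)) (∑-cong elems (λ x → *-identityʳ ⟦ P? x ⟧)))
    ... | no ≰ = ⊥-elim (contra (dependency (ℕ.≰⇒> ≰) (λ i j → M (b i) (a j))))
      where
      as bs : List E
      as = filter A? elems
      bs = filter B? elems
      a : Fin (length as) → E
      a = List.lookup as
      b : Fin (length bs) → E
      b = List.lookup bs
      A-a : ∀ j → A (a j)
      A-a j = proj₂ (∈-filter⁻ A? {xs = elems} (∈-lookup j))
      as! : Unique as
      as! = Unique.filter⁺ A? elems!
      contra : (Σ (Fin (length as) → ℚ) λ x → (∃ λ i → x i ≢ 0ℚ) × (∀ i → sum (λ j → M (b i) (a j) * x j) ≡ 0ℚ)) → _
      contra (x , (j , xj≢0) , eqs) = xj≢0 (trans (sym (f-a j)) (inj f support equations (a j) (A-a j)))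
        where
        f : E → ℚ
        f e = sum (λ j → ⟦ e ≟ᶠ a j ⟧ * x j)
        f-a : ∀ j → f (a j) ≡ x j
        f-a j = trans (sum-single j (λ i → ⟦ a j ≟ᶠ a i ⟧ * x i) (λ i i≢j →
                  trans (cong (_* x i) (⟦⟧-no (a j ≟ᶠ a i) (λ e → i≢j (lookup-injective as! i j (sym e))))) (*-zeroˡ (x i))))
                (trans (cong (_* x j) (⟦⟧-yes (a j ≟ᶠ a j) refl)) (*-identityˡ (x j)))
        support : ∀ e → ¬ A e → f e ≡ 0ℚ
        support e ¬Ae = sum-zero (λ j → trans (cong (_* x j) (⟦⟧-no (e ≟ᶠ a j) (λ { refl → ¬Ae (A-a j) }))) (*-zeroˡ (x j)))
        transport : ∀ z → ∑ elems (λ e → M z e * f e) ≡ sum (λ j → M z (a j) * x j)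
        transport z = begin
          ∑ elems (λ e → M z e * f e)
            ≡⟨ ∑-cong elems (λ e → sum-*ˡ (M z e) (λ j → ⟦ e ≟ᶠ a j ⟧ * x j)) ⟩
          ∑ elems (λ e → sum (λ j → M z e * (⟦ e ≟ᶠ a j ⟧ * x j)))
            ≡⟨ ∑-sum-swap elems (λ e j → M z e * (⟦ e ≟ᶠ a j ⟧ * x j)) ⟩
          sum (λ j → ∑ elems (λ e → M z e * (⟦ e ≟ᶠ a j ⟧ * x j)))
            ≡⟨ sum-cong-≗ (λ j → trans (∑-cong elems (λ e → solve 3 (λ m d x → m :* (d :* x) := d :* (m :* x)) refl (M z e) ⟦ e ≟ᶠ a j ⟧ (x j)))
                                        (∑-δ (a j) (λ e → M z e * x j))) ⟩
          sum (λ j → M z (a j) * x j) ∎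
          where
          sum-*ˡ : ∀ {c} m (g : Fin c → ℚ) → m * sum g ≡ sum (λ j → m * g j)
          sum-*ˡ {zero}  m g = *-zeroʳ m
          sum-*ˡ {suc c} m g = trans (*-distribˡ-+ m (g zero) _) (cong (m * g zero +_) (sum-*ˡ m (λ j → g (suc j))))
        equations : ∀ z → B z → ∑ elems (λ e → M z e * f e) ≡ 0ℚ
        equations z Bz = trans (transport z) (subst (λ z → sum (λ j → M z (a j) * x j) ≡ 0ℚ) (sym (lookup-index z∈bs)) (eqs (Any.index z∈bs)))
          where
          open import Data.List.Relation.Unary.Any.Properties using (lookup-index)
          z∈bs : z ∈ bs
          z∈bs = ∈-filter⁺ B? (∈-elems z) Bz

-- Upper shadows of intersecting families

module Shadows where

  open Prelude
  import Data.Nat as ℕ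
  import Data.Nat.Properties as ℕ
  open FiniteSums
  open Arithmetic
  open SubspaceLattices
  open UpDown
  open IsotypicDecomposition
  open LinearSystems

  module UpperShadow {Q : ℚ} {1≤Q : 1ℚ ≤ Q} {n : ℕ} (G : Geometry Q 1≤Q n) where
    open Isotypic G public

    -- The Gaussian coefficient [n - b + d, d], which counts the b-dimensional subspaces through a
    -- given one of dimension b - d.
    #above : ℕ → ℕ → ℚ
    #above b zero    = 1ℚ
    #above b (suc d) = inv (br (suc d)) * (br (n ℕ.∸ (b ℕ.∸ suc d)) * #above b d)

    0<#above : ∀ b d → b ℕ.≤ n → d ℕ.≤ b → 0ℚ < #above b d
    0<#above b zero    b≤n _   = 0<1
    0<#above b (suc d) b≤n d<b = *-pos (0<inv _ (0<br d))
      (*-pos (br-mono-< {0} (ℕ.m<n⇒0<n∸m (ℕ.<-≤-trans (ℕ.∸-monoʳ-< {b} {suc d} {0} (ℕ.s≤s ℕ.z≤n) d<b) b≤n)))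
             (0<#above b d b≤n (ℕ.<⇒≤ d<b)))

    -- Double count of the pairs x ⋖ z ⊑ y with dim y = b: every `y` contains [d + 1] of the covers,
    -- and every cover lies in `#above b d` of the y.
    count-above : ∀ b d x → dim x ℕ.+ d ≡ b → ∑ elems (λ y → ⟦ (x ⊑? y) ×-dec (dim y ℕ.≟ b) ⟧) ≡ #above b d
    count-above b zero    x e = ∑-unique x (λ y → (x ⊑? y) ×-dec (dim y ℕ.≟ b)) (⊑-refl , dim-x)
        (λ y (x⊑y , d) → sym (dim-≡ x⊑y (trans dim-x (sym d))))
      where
      dim-x : dim x ≡ b
      dim-x = trans (sym (ℕ.+-identityʳ _)) e
    count-above b (suc d) x e = *-cancelˡ-≡ (0<br d) (begin
      br (suc d) * ∑ elems (λ y → ⟦ (x ⊑? y) ×-dec (dim y ℕ.≟ b) ⟧)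
        ≡⟨ ∑-*ˡ elems (br (suc d)) _ ⟨
      ∑ elems (λ y → br (suc d) * ⟦ (x ⊑? y) ×-dec (dim y ℕ.≟ b) ⟧)
        ≡⟨ ∑-cong elems (λ y → sym (∑-fiber elems (br (suc d)) ((x ⊑? y) ×-dec (dim y ℕ.≟ b)) (R? y)
             (λ ((x⋖z , z⊑y) , dim-y) → ⊑-trans (⋖⇒⊑ x⋖z) z⊑y , dim-y) (between y))) ⟩
      ∑ elems (λ y → ∑ elems (λ z → ⟦ R? y z ⟧))
        ≡⟨ ∑-swap elems elems _ ⟩
      ∑ elems (λ z → ∑ elems (λ y → ⟦ R? y z ⟧))
        ≡⟨ ∑-cong elems (λ z → ∑-fiber elems (#above b d) (x ⋖? z) (λ y → R? y z) (λ ((x⋖z , _) , _) → x⋖z) (above z)) ⟩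
      ∑ elems (λ z → #above b d * ⟦ x ⋖? z ⟧)
        ≡⟨ ∑-*ˡ elems (#above b d) _ ⟩
      #above b d * ∑ elems (λ z → ⟦ x ⋖? z ⟧)
        ≡⟨ cong (#above b d *_) (#covers x (trans (cong (ℕ._+ (n ℕ.∸ (b ℕ.∸ suc d))) dim-x) (ℕ.m+[n∸m]≡n (subst (ℕ._≤ n) dim-x (dim≤n x))))) ⟩
      #above b d * N
        ≡⟨ solve 2 (λ a n → a :* n := con 1ℚ :* (n :* a)) refl (#above b d) N ⟩
      1ℚ * (N * #above b d)
        ≡⟨ cong (_* (N * #above b d)) (trans (sym (inv-* _ (0<br d))) (*-comm (inv (br (suc d))) (br (suc d)))) ⟩
      br (suc d) * inv (br (suc d)) * (N * #above b d)
        ≡⟨ *-assoc (br (suc d)) (inv (br (suc d))) (N * #above b d) ⟩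
      br (suc d) * #above b (suc d) ∎)
      where
      N = br (n ℕ.∸ (b ℕ.∸ suc d))
      dim-x : dim x ≡ b ℕ.∸ suc d
      dim-x = sym (trans (cong (ℕ._∸ suc d) (sym e)) (ℕ.m+n∸n≡m (dim x) (suc d)))
      R? : ∀ y z → Dec ((x ⋖ z × z ⊑ y) × dim y ≡ b)
      R? y z = ((x ⋖? z) ×-dec (z ⊑? y)) ×-dec (dim y ℕ.≟ b)
      between : ∀ y → x ⊑ y × dim y ≡ b → ∑ elems (λ z → ⟦ R? y z ⟧) ≡ br (suc d)
      between y (x⊑y , dim-y) = trans (∑-cong elems (λ z → ⟦⟧-cong (R? y z) ((x ⋖? z) ×-dec (z ⊑? y)) proj₁ (_, dim-y)))
        (up-count x⊑y (trans e (sym dim-y)))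
      above : ∀ z → x ⋖ z → ∑ elems (λ y → ⟦ R? y z ⟧) ≡ #above b d
      above z x⋖z = trans (∑-cong elems (λ y → ⟦⟧-cong (R? y z) ((z ⊑? y) ×-dec (dim y ℕ.≟ b))
          (λ ((_ , z⊑y) , dim-y) → z⊑y , dim-y) (λ (z⊑y , dim-y) → (x⋖z , z⊑y) , dim-y)))
        (count-above b d z (trans (cong (ℕ._+ d) (sym (proj₂ x⋖z))) (trans (sym (ℕ.+-suc (dim x) d)) e)))

    module _ {j : ℕ} {A B : El → Set} (A? : ∀ x → Dec (A x)) (B? : ∀ x → Dec (B x))
             (A-dim : ∀ {x} → A x → dim x ≡ j) (A-meet : ∀ {x y} → A x → A y → dim (x ⊓ y) ≢ 0)
             (shadow : ∀ {v z} → A v → v ⋖ z → B z) where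

      module _ {X : El} (dim-X : dim X ≡ j ℕ.+ j) where

        module _ {f : El → ℚ} (supp : ∀ v → ¬ (A v × v ⊑ X) → f v ≡ 0ℚ)
                 (up-f : ∀ z → z ⊑ X → up f z ≡ 0ℚ) {w : El} (Aw : A w) (w⊑X : w ⊑ X) where

          private
            f-level : Level j f
            f-level v ne = supp v (λ (a , _) → ne (A-dim a))

            meetSum : ℕ → ℚ
            meetSum i = ∑ elems (λ v → ⟦ dim (v ⊓ w) ℕ.≟ i ⟧ * f v)

            supp-cong : ∀ {K K′ : El → ℚ} → (∀ v → A v → v ⊑ X → K v ≡ K′ v) → ∑ elems (λ v → K v * f v) ≡ ∑ elems (λ v → K′ v * f v)
            supp-cong {K} {K′} e = ∑-cong elems pointwise
              where
              pointwise : ∀ v → K v * f v ≡ K′ v * f v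
              pointwise v with A? v ×-dec (v ⊑? X)
              ... | yes (a , v⊑X) = cong (_* f v) (e v a v⊑X)
              ... | no ¬p = trans (trans (cong (K v *_) (supp v ¬p)) (*-zeroʳ (K v)))
                                  (sym (trans (cong (K′ v *_) (supp v ¬p)) (*-zeroʳ (K′ v))))

          -- Summing up f over the z below X with dim (z ⊓ w) = i + 1 links two consecutive meet sums.
          meetSum-link : ∀ i → i ℕ.< j → br (j ℕ.∸ i) * meetSum i + (br j - br (j ℕ.∸ suc i)) * meetSum (suc i) ≡ 0ℚ
          meetSum-link i i<j = begin
            c₀ * meetSum i + c₁ * meetSum (suc i)
              ≡⟨ cong₂ _+_ (sym (∑-*ˡ elems c₀ _)) (sym (∑-*ˡ elems c₁ _)) ⟩
            ∑ elems (λ v → c₀ * (⟦ dim (v ⊓ w) ℕ.≟ i ⟧ * f v)) + ∑ elems (λ v → c₁ * (⟦ dim (v ⊓ w) ℕ.≟ suc i ⟧ * f v))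
              ≡⟨ ∑-distrib-+ elems _ _ ⟨
            ∑ elems (λ v → c₀ * (⟦ dim (v ⊓ w) ℕ.≟ i ⟧ * f v) + c₁ * (⟦ dim (v ⊓ w) ℕ.≟ suc i ⟧ * f v))
              ≡⟨ ∑-cong elems (λ v → solve 5 (λ a x c y h → a :* (x :* h) :+ c :* (y :* h) := (y :* c :+ x :* a) :* h) refl
                   c₀ ⟦ dim (v ⊓ w) ℕ.≟ i ⟧ c₁ ⟦ dim (v ⊓ w) ℕ.≟ suc i ⟧ (f v)) ⟩
            ∑ elems (λ v → (⟦ dim (v ⊓ w) ℕ.≟ suc i ⟧ * c₁ + ⟦ dim (v ⊓ w) ℕ.≟ i ⟧ * c₀) * f v)
              ≡⟨ supp-cong kernel ⟨
            ∑ elems (λ v → ∑ elems (λ z → g z * ⟦ v ⋖? z ⟧) * f v)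
              ≡⟨ ∑-exchange (λ _ z → g z) (λ z v → ⟦ v ⋖? z ⟧) f w ⟨
            ∑ elems (λ z → g z * up f z)
              ≡⟨ ∑-zero elems vanish ⟩
            0ℚ ∎
            where
            c₀ = br (j ℕ.∸ i)
            c₁ = br j - br (j ℕ.∸ suc i)
            g : El → ℚ
            g z = ⟦ z ⊑? X ⟧ * ⟦ dim (z ⊓ w) ℕ.≟ suc i ⟧
            vanish : ∀ z → g z * up f z ≡ 0ℚ
            vanish z with z ⊑? X
            ... | yes z⊑X = trans (cong (1ℚ * ⟦ dim (z ⊓ w) ℕ.≟ suc i ⟧ *_) (up-f z z⊑X)) (*-zeroʳ (1ℚ * ⟦ dim (z ⊓ w) ℕ.≟ suc i ⟧))
            ... | no _    = solve 2 (λ m u → (con 0ℚ :* m) :* u := con 0ℚ) refl ⟦ dim (z ⊓ w) ℕ.≟ suc i ⟧ (up f z)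
            kernel : ∀ v → A v → v ⊑ X → ∑ elems (λ z → g z * ⟦ v ⋖? z ⟧)
                     ≡ ⟦ dim (v ⊓ w) ℕ.≟ suc i ⟧ * c₁ + ⟦ dim (v ⊓ w) ℕ.≟ i ⟧ * c₀
            kernel v Av v⊑X = begin
              ∑ elems (λ z → g z * ⟦ v ⋖? z ⟧)
                ≡⟨ ∑-cong elems (λ z → trans (solve 3 (λ a b c → (a :* b) :* c := (c :* a) :* b) refl ⟦ z ⊑? X ⟧ ⟦ dim (z ⊓ w) ℕ.≟ suc i ⟧ ⟦ v ⋖? z ⟧)
                     (cong (_* ⟦ dim (z ⊓ w) ℕ.≟ suc i ⟧) (sym (⟦⟧-× (v ⋖? z) (z ⊑? X))))) ⟩
              ∑ elems (λ z → ⟦ (v ⋖? z) ×-dec (z ⊑? X) ⟧ * ⟦ dim (z ⊓ w) ℕ.≟ suc i ⟧)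
                ≡⟨ up-count-⊓ (suc i) {a} {j} v⊑X w⊑X (trans (cong (ℕ._+ j) (A-dim Av)) (sym dim-X)) a-eq ⟩
              ⟦ dim (v ⊓ w) ℕ.≟ suc i ⟧ * (br j - br a) + ⟦ suc (dim (v ⊓ w)) ℕ.≟ suc i ⟧ * br a
                ≡⟨ cong₂ _+_ (⟦⟧-guard (dim (v ⊓ w) ℕ.≟ suc i) (λ m → cong (λ a → br j - br a) (a-is m)))
                     (trans (cong (_* br a) (⟦⟧-cong (suc (dim (v ⊓ w)) ℕ.≟ suc i) (dim (v ⊓ w) ℕ.≟ i) ℕ.suc-injective (cong suc)))
                            (⟦⟧-guard (dim (v ⊓ w) ℕ.≟ i) (λ m → cong br (a-is m)))) ⟩
              ⟦ dim (v ⊓ w) ℕ.≟ suc i ⟧ * c₁ + ⟦ dim (v ⊓ w) ℕ.≟ i ⟧ * c₀ ∎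
              where
              a = j ℕ.∸ dim (v ⊓ w)
              a-eq : dim (v ⊓ w) ℕ.+ a ≡ dim w
              a-eq = trans (ℕ.m+[n∸m]≡n (subst (dim (v ⊓ w) ℕ.≤_) (A-dim Av) (dim-⊓≤ v w))) (sym (A-dim Aw))
              a-is : ∀ {m} → dim (v ⊓ w) ≡ m → a ≡ j ℕ.∸ m
              a-is refl = refl

          meetSum-zero : ∀ i → i ℕ.≤ j → meetSum i ≡ 0ℚ
          meetSum-zero zero    _   = trans (supp-cong {K′ = λ _ → 0ℚ} (λ v Av _ → ⟦⟧-no (dim (v ⊓ w) ℕ.≟ 0) (A-meet Av Aw)))
                                           (∑-zero elems (λ v → *-zeroˡ (f v)))
          meetSum-zero (suc i) i<j = *-cancelˡ-≡ (<⇒0<- (br-mono-< (ℕ.∸-monoʳ-< {j} (ℕ.s≤s ℕ.z≤n) i<j))) (begin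
            c₁ * meetSum (suc i)
              ≡⟨ solve 3 (λ a b x → x := (a :* con 0ℚ :+ x)) refl (br (j ℕ.∸ i)) c₁ (c₁ * meetSum (suc i)) ⟩
            br (j ℕ.∸ i) * 0ℚ + c₁ * meetSum (suc i)
              ≡⟨ cong (λ s → br (j ℕ.∸ i) * s + c₁ * meetSum (suc i)) (meetSum-zero i (ℕ.<⇒≤ i<j)) ⟨
            br (j ℕ.∸ i) * meetSum i + c₁ * meetSum (suc i)
              ≡⟨ meetSum-link i i<j ⟩
            0ℚ
              ≡⟨ *-zeroʳ c₁ ⟨
            c₁ * 0ℚ ∎)
            where c₁ = br j - br (j ℕ.∸ suc i)

          up-injective : f w ≡ 0ℚ
          up-injective = begin
            f w                                  ≡⟨ ∑-δ w f ⟨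
            ∑ elems (λ v → ⟦ v ≟ᶠ w ⟧ * f v)     ≡⟨ supp-cong (λ v Av _ → ⟦⟧-cong (v ≟ᶠ w) (dim (v ⊓ w) ℕ.≟ j)
                                                      (λ { refl → trans (cong dim (⊓≡ ⊑-refl)) (A-dim Av) })
                                                      (λ d → dim-≡ (dim-⊓≡⇒⊑ v w (trans d (sym (A-dim Av)))) (trans (A-dim Av) (sym (A-dim Aw))))) ⟩
            meetSum j                            ≡⟨ meetSum-zero j ℕ.≤-refl ⟩
            0ℚ                                   ∎

        -- `rank` supplies the vanishing of up f only at members of `B`. At any other `z` it is
        -- automatic, since `shadow` leaves no member of `A` just below such a z.
        shadow-inside : ∑ elems (λ v → ⟦ A? v ×-dec (v ⊑? X) ⟧) ≤ ∑ elems (λ z → ⟦ B? z ×-dec (z ⊑? X) ⟧)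
        shadow-inside = rank (λ v → A? v ×-dec (v ⊑? X)) (λ z → B? z ×-dec (z ⊑? X)) (λ z v → ⟦ v ⋖? z ⟧)
          λ f supp eqs w (Aw , w⊑X) → up-injective supp (λ z z⊑X → up-zero f supp eqs z z⊑X (B? z)) Aw w⊑X
          where
          open Rank finite
          up-zero : ∀ f → (∀ v → ¬ (A v × v ⊑ X) → f v ≡ 0ℚ) → (∀ z → B z × z ⊑ X → up f z ≡ 0ℚ) →
                    ∀ z → z ⊑ X → Dec (B z) → up f z ≡ 0ℚ
          up-zero f supp eqs z z⊑X (yes b) = eqs z (b , z⊑X)
          up-zero f supp eqs z z⊑X (no ¬b) = ∑-zero elems λ v → trans
            (⟦⟧-guard (v ⋖? z) {f v} {0ℚ} (λ v⋖z → supp v (λ (a , _) → ¬b (shadow a v⋖z)))) (*-zeroʳ ⟦ v ⋖? z ⟧)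

      -- Summing `shadow-inside` over all X of dimension 2j counts each member of `A` and of `B` as
      -- often as there are such X above it. These multiplicities are consecutive values of
      -- `#above`, with quotient [n - j] / [j].
      upper-shadow : (∀ {z} → B z → dim z ≡ suc j) → 0 ℕ.< j → j ℕ.+ j ℕ.≤ n →
        ∑ elems (λ v → ⟦ A? v ⟧) * br (n ℕ.∸ j) ≤ br j * ∑ elems (λ z → ⟦ B? z ⟧)
      upper-shadow B-dim 0<j 2j≤n = bound j 0<j refl
        where
        -- For X of dimension b the second coefficient in the recursion for the meet sums would be
        -- [b - j] - [j - i - 1], and the averaged bound would have [b - j] in place of [j]. Small b
        -- thus gives the stronger bound, and 2j is the least b that keeps all these coefficients
        -- positive.
        b = j ℕ.+ j
        double-count : {P : El → Set} (P? : ∀ x → Dec (P x)) (d : ℕ) → (∀ {x} → P x → dim x ℕ.+ d ≡ b) →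
          ∑ elems (λ X → ⟦ dim X ℕ.≟ b ⟧ * ∑ elems (λ x → ⟦ P? x ×-dec (x ⊑? X) ⟧)) ≡ #above b d * ∑ elems (λ x → ⟦ P? x ⟧)
        double-count P? d P-dim = begin
          ∑ elems (λ X → ⟦ dim X ℕ.≟ b ⟧ * ∑ elems (λ x → ⟦ P? x ×-dec (x ⊑? X) ⟧))
            ≡⟨ ∑-cong elems (λ X → trans (sym (∑-*ˡ elems ⟦ dim X ℕ.≟ b ⟧ _)) (∑-cong elems (λ x → rearrange X x))) ⟩
          ∑ elems (λ X → ∑ elems (λ x → ⟦ P? x ×-dec ((x ⊑? X) ×-dec (dim X ℕ.≟ b)) ⟧))
            ≡⟨ ∑-swap elems elems _ ⟩
          ∑ elems (λ x → ∑ elems (λ X → ⟦ P? x ×-dec ((x ⊑? X) ×-dec (dim X ℕ.≟ b)) ⟧))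
            ≡⟨ ∑-cong elems (λ x → ∑-fiber elems (#above b d) (P? x) (λ X → P? x ×-dec ((x ⊑? X) ×-dec (dim X ℕ.≟ b))) proj₁
                 (λ p → trans (∑-cong elems (λ X → ⟦⟧-cong (P? x ×-dec ((x ⊑? X) ×-dec (dim X ℕ.≟ b))) ((x ⊑? X) ×-dec (dim X ℕ.≟ b)) proj₂ (p ,_)))
                              (count-above b d x (P-dim p)))) ⟩
          ∑ elems (λ x → #above b d * ⟦ P? x ⟧)
            ≡⟨ ∑-*ˡ elems (#above b d) _ ⟩
          #above b d * ∑ elems (λ x → ⟦ P? x ⟧) ∎
          where
          rearrange : ∀ X x → ⟦ dim X ℕ.≟ b ⟧ * ⟦ P? x ×-dec (x ⊑? X) ⟧ ≡ ⟦ P? x ×-dec ((x ⊑? X) ×-dec (dim X ℕ.≟ b)) ⟧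
          rearrange X x = trans (sym (⟦⟧-× (dim X ℕ.≟ b) (P? x ×-dec (x ⊑? X))))
            (⟦⟧-cong ((dim X ℕ.≟ b) ×-dec (P? x ×-dec (x ⊑? X))) (P? x ×-dec ((x ⊑? X) ×-dec (dim X ℕ.≟ b)))
               (λ (d , p , s) → p , s , d) (λ (p , s , d) → d , p , s))
        inside : ∀ X (d : Dec (dim X ≡ b)) → ⟦ d ⟧ * ∑ elems (λ v → ⟦ A? v ×-dec (v ⊑? X) ⟧) ≤ ⟦ d ⟧ * ∑ elems (λ z → ⟦ B? z ×-dec (z ⊑? X) ⟧)
        inside X (yes d) = *-monoˡ 0≤1 (shadow-inside d)
        inside X (no _)  = ≤-reflexive (trans (*-zeroˡ (∑ elems (λ v → ⟦ A? v ×-dec (v ⊑? X) ⟧))) (sym (*-zeroˡ (∑ elems (λ z → ⟦ B? z ×-dec (z ⊑? X) ⟧)))))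
        bound : ∀ i → 0 ℕ.< i → i ≡ j → ∑ elems (λ v → ⟦ A? v ⟧) * br (n ℕ.∸ j) ≤ br j * ∑ elems (λ z → ⟦ B? z ⟧)
        -- The index equal to `j` is matched to name its predecessor `d`, the codimension in X of a
        -- member of `B`.
        bound (suc d) _ refl = *-cancelˡ-≤ (*-pos (0<inv _ (0<br d)) (0<#above b d 2j≤n (ℕ.≤-trans (ℕ.n≤1+n d) (ℕ.m≤m+n j j))))
          (≤-trans (≤-reflexive left) (≤-trans
            (∑-mono elems (λ X → inside X (dim X ℕ.≟ b))) (≤-reflexive right)))
          where
          sA = ∑ elems (λ v → ⟦ A? v ⟧)
          sB = ∑ elems (λ z → ⟦ B? z ⟧)
          left : inv (br j) * #above b d * (sA * br (n ℕ.∸ j)) ≡ ∑ elems (λ X → ⟦ dim X ℕ.≟ b ⟧ * ∑ elems (λ x → ⟦ A? x ×-dec (x ⊑? X) ⟧))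
          left = begin
            inv (br j) * #above b d * (sA * br (n ℕ.∸ j))
              ≡⟨ solve 4 (λ i u s m → i :* u :* (s :* m) := (i :* (m :* u)) :* s) refl (inv (br j)) (#above b d) sA (br (n ℕ.∸ j)) ⟩
            inv (br j) * (br (n ℕ.∸ j) * #above b d) * sA
              ≡⟨ cong (λ m → inv (br j) * (br (n ℕ.∸ m) * #above b d) * sA) (ℕ.m+n∸n≡m j j) ⟨
            #above b j * sA
              ≡⟨ double-count A? j (λ a → cong (ℕ._+ j) (A-dim a)) ⟨
            ∑ elems (λ X → ⟦ dim X ℕ.≟ b ⟧ * ∑ elems (λ x → ⟦ A? x ×-dec (x ⊑? X) ⟧)) ∎
          right : ∑ elems (λ X → ⟦ dim X ℕ.≟ b ⟧ * ∑ elems (λ x → ⟦ B? x ×-dec (x ⊑? X) ⟧)) ≡ inv (br j) * #above b d * (br j * sB)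
          right = begin
            ∑ elems (λ X → ⟦ dim X ℕ.≟ b ⟧ * ∑ elems (λ x → ⟦ B? x ×-dec (x ⊑? X) ⟧))
              ≡⟨ double-count B? d (λ {x} Bx → trans (cong (ℕ._+ d) (B-dim Bx)) (sym (ℕ.+-suc j d))) ⟩
            #above b d * sB
              ≡⟨ *-identityˡ (#above b d * sB) ⟨
            1ℚ * (#above b d * sB)
              ≡⟨ cong (_* (#above b d * sB)) (inv-* (br j) (0<br d)) ⟨
            inv (br j) * br j * (#above b d * sB)
              ≡⟨ solve 4 (λ i b u s → i :* b :* (u :* s) := i :* u :* (b :* s)) refl (inv (br j)) (br j) (#above b d) sB ⟩
            inv (br j) * #above b d * (br j * sB) ∎

-- Antichains, layers and the weight of a k-Sperner family

module SpernerFamilies where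

  open Prelude
  open import Data.Fin using (Fin; zero; suc)
  import Data.Fin as Fin
  open import Data.List using (List; downFrom)
  open import Data.List.Membership.Propositional using (lose; find)
  open import Data.List.Relation.Unary.Any using (any?)
  import Data.Nat as ℕ
  import Data.Nat.Properties as ℕ
  open FiniteSums
  open Arithmetic
  open SubspaceLattices
  open UpDown
  open IsotypicDecomposition
  open LinearSystems
  open ErdosKoRado
  open Shadows

  ⟦⟧-partition : {A B C : Set} (a : Dec A) (b : Dec B) (c : Dec C) → (A → C) → (B → C → A) →
                 ⟦ a ⟧ ≡ ⟦ a ×-dec ¬? b ⟧ + ⟦ b ×-dec c ⟧
  ⟦⟧-partition (yes _)  (yes _) (yes _) f g = refl
  ⟦⟧-partition (yes x)  b       (no ¬c) f g = ⊥-elim (¬c (f x))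
  ⟦⟧-partition (yes _)  (no _)  (yes _) f g = refl
  ⟦⟧-partition (no ¬a)  (yes b) (yes c) f g = ⊥-elim (¬a (g b c))
  ⟦⟧-partition (no _)   (yes _) (no _)  f g = refl
  ⟦⟧-partition (no _)   (no _)  _       f g = refl

  module Families {Q : ℚ} {1≤Q : 1ℚ ≤ Q} {n : ℕ} (G : Geometry Q 1≤Q n) where
    open Isotypic G public
    open Rank finite using (∈-elems)

    ∃? : {P : El → Set} → (∀ x → Dec (P x)) → Dec (∃ P)
    ∃? P? = map′ (λ p → let (x , _ , px) = find p in x , px) (λ (x , px) → lose (∈-elems x) px) (any? P? elems)

    # : {P : El → Set} → (∀ x → Dec (P x)) → ℚ
    # P? = ∑ elems (λ x → ⟦ P? x ⟧)

    at : {P : El → Set} → (∀ x → Dec (P x)) → (j : ℕ) → ∀ x → Dec (P x × dim x ≡ j)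
    at P? j x = P? x ×-dec (dim x ℕ.≟ j)

    -- star j is the Gaussian coefficient [n - 1 , j], the number of subspaces of dimension j + 1 through a point.
    star : ℕ → ℚ
    star zero    = 1ℚ
    star (suc j) = star j * br (n ℕ.∸ suc j) * inv (br (suc j))

    0<star : ∀ j → j ℕ.< n → 0ℚ < star j
    0<star zero    _   = 0<1
    0<star (suc j) j<n = *-pos (*-pos (0<star j (ℕ.<-trans (ℕ.n<1+n j) j<n)) (br-mono-< {0} (ℕ.m<n⇒0<n∸m j<n))) (0<inv _ (0<br j))

    -- Double count of the covering pairs between two consecutive levels.
    level-ratio : ∀ j → # (λ x → dim x ℕ.≟ suc j) * br (suc j) ≡ # (λ x → dim x ℕ.≟ j) * br (n ℕ.∸ j)
    level-ratio j = begin
      ∑ elems (λ v → ⟦ dim v ℕ.≟ suc j ⟧) * br (suc j)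
        ≡⟨ trans (*-comm _ (br (suc j))) (sym (∑-*ˡ elems (br (suc j)) _)) ⟩
      ∑ elems (λ v → br (suc j) * ⟦ dim v ℕ.≟ suc j ⟧)
        ≡⟨ ∑-cong elems (λ v → sym (∑-fiber elems (br (suc j)) (dim v ℕ.≟ suc j) (λ t → R? v t)
             (λ (t⋖v , d) → trans (sym (proj₂ t⋖v)) (cong suc d)) (down v))) ⟩
      ∑ elems (λ v → ∑ elems (λ t → ⟦ R? v t ⟧))
        ≡⟨ ∑-swap elems elems _ ⟩
      ∑ elems (λ t → ∑ elems (λ v → ⟦ R? v t ⟧))
        ≡⟨ ∑-cong elems (λ t → ∑-fiber elems (br (n ℕ.∸ j)) (dim t ℕ.≟ j) (λ v → R? v t) proj₂ (covers t)) ⟩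
      ∑ elems (λ t → br (n ℕ.∸ j) * ⟦ dim t ℕ.≟ j ⟧)
        ≡⟨ trans (∑-*ˡ elems (br (n ℕ.∸ j)) _) (*-comm (br (n ℕ.∸ j)) _) ⟩
      ∑ elems (λ t → ⟦ dim t ℕ.≟ j ⟧) * br (n ℕ.∸ j) ∎
      where
      R? : ∀ v t → Dec (t ⋖ v × dim t ≡ j)
      R? v t = (t ⋖? v) ×-dec (dim t ℕ.≟ j)
      down : ∀ v → dim v ≡ suc j → ∑ elems (λ t → ⟦ R? v t ⟧) ≡ br (suc j)
      down v d = trans (∑-cong elems (λ t → ⟦⟧-cong (R? v t) (t ⋖? v) proj₁ (λ p → p , ℕ.suc-injective (trans (proj₂ p) d))))
                       (trans (#cocovers v) (cong br d))
      covers : ∀ t → dim t ≡ j → ∑ elems (λ v → ⟦ R? v t ⟧) ≡ br (n ℕ.∸ j)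
      covers t d = trans (∑-cong elems (λ v → ⟦⟧-cong (R? v t) (t ⋖? v) proj₁ (_, d)))
                         (#covers t (trans (cong (ℕ._+ (n ℕ.∸ j)) d) (ℕ.m+[n∸m]≡n (subst (ℕ._≤ n) d (dim≤n t)))))

    -- The absorption identity for Gaussian coefficients. It shows that the bound in `erdős-ko-rado`
    -- is exactly the size of a star.
    level-star : ∀ j → # (λ x → dim x ℕ.≟ suc j) * br (suc j) ≡ br n * star j
    level-star zero = trans (level-ratio 0) (trans (cong (_* br n) (trans
        (∑-unique bot (λ x → dim x ℕ.≟ 0) dim-bot (λ x d → sym (dim-≡ (bot-min x) (trans dim-bot (sym d))))) refl)) (*-comm 1ℚ (br n)))
    level-star (suc j) = begin
      # (λ x → dim x ℕ.≟ suc (suc j)) * br (suc (suc j))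
        ≡⟨ level-ratio (suc j) ⟩
      L * m
        ≡⟨ solve 2 (λ l m → l :* m := con 1ℚ :* (l :* m)) refl L m ⟩
      1ℚ * (L * m)
        ≡⟨ cong (_* (L * m)) (inv-* b (0<br j)) ⟨
      inv b * b * (L * m)
        ≡⟨ solve 4 (λ i b l m → i :* b :* (l :* m) := (l :* b) :* (m :* i)) refl (inv b) b L m ⟩
      L * b * (m * inv b)
        ≡⟨ cong (_* (m * inv b)) (level-star j) ⟩
      br n * star j * (m * inv b)
        ≡⟨ solve 4 (λ n s m i → n :* s :* (m :* i) := n :* (s :* m :* i)) refl (br n) (star j) m (inv b) ⟩
      br n * star (suc j) ∎
      where
      L = # (λ x → dim x ℕ.≟ suc j)
      m = br (n ℕ.∸ suc j)
      b = br (suc j)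

    -- The quotient of consecutive stars is the constant of `upper-shadow` in dimension j + 1, so
    -- that the shadow bound says that the density relative to a star does not decrease.
    star-ratio : ∀ j → suc j ℕ.< n → inv (star j) * br (suc j) ≡ inv (star (suc j)) * br (n ℕ.∸ suc j)
    star-ratio j j<n = begin
      inv s * b
        ≡⟨ solve 2 (λ i b → i :* b := con 1ℚ :* (i :* b)) refl (inv s) b ⟩
      1ℚ * (inv s * b)
        ≡⟨ cong (_* (inv s * b)) (inv-* s′ (0<star (suc j) j<n)) ⟨
      inv s′ * (s * m * inv b) * (inv s * b)
        ≡⟨ solve 6 (λ i′ s m ib is b → i′ :* (s :* m :* ib) :* (is :* b) := i′ :* m :* ((is :* s) :* (ib :* b))) refl (inv s′) s m (inv b) (inv s) b ⟩
      inv s′ * m * ((inv s * s) * (inv b * b))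
        ≡⟨ cong₂ (λ x y → inv s′ * m * (x * y)) (inv-* s (0<star j (ℕ.<-trans (ℕ.n<1+n j) j<n))) (inv-* b (0<br j)) ⟩
      inv s′ * m * (1ℚ * 1ℚ)
        ≡⟨ *-identityʳ (inv s′ * m) ⟩
      inv s′ * m ∎
      where
      s = star j
      s′ = star (suc j)
      m = br (n ℕ.∸ suc j)
      b = br (suc j)

    next : (El → Set) → El → Set
    next P x = P x × ∃ λ y → P y × y ⊑ x × dim y ℕ.< dim x

    next? : {P : El → Set} → (∀ x → Dec (P x)) → ∀ x → Dec (next P x)
    next? P? x = P? x ×-dec ∃? (λ y → P? y ×-dec ((y ⊑? x) ×-dec (dim y ℕ.<? dim x)))

    -- layer P k consists of the members of P that top a chain of k + 1 members of P.
    layer : (El → Set) → ℕ → El → Set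
    layer P zero    = P
    layer P (suc k) = layer (next P) k

    minimal? : {P : El → Set} (P? : ∀ x → Dec (P x)) → ∀ x → Dec (P x × ¬ (∃ λ y → P y × y ⊑ x × dim y ℕ.< dim x))
    minimal? P? x = P? x ×-dec ¬? (∃? (λ y → P? y ×-dec ((y ⊑? x) ×-dec (dim y ℕ.<? dim x))))

    -- The chain found in `next P` consists of members that have a member of `P` strictly below
    -- them; the one below its bottom term is put in front.
    layer-chain : ∀ k {P x} → layer P k x → Σ (Fin (suc k) → El) λ c →
                  (∀ i → P (c i)) × (∀ i j → i Fin.< j → c i ⊑ c j × dim (c i) ℕ.< dim (c j))
    layer-chain zero    {x = x} Px = (λ _ → x) , (λ _ → Px) , λ where zero zero ()
    layer-chain (suc k) {P} l with layer-chain k l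
    ... | c , Pc , mono with Pc zero
    ...   | _ , y , Py , y⊑ , y< = c′ , P′ , mono′
      where
      c′ : Fin (suc (suc k)) → El
      c′ zero    = y
      c′ (suc i) = c i
      P′ : ∀ i → P (c′ i)
      P′ zero    = Py
      P′ (suc i) = proj₁ (Pc i)
      mono′ : ∀ i j → i Fin.< j → c′ i ⊑ c′ j × dim (c′ i) ℕ.< dim (c′ j)
      mono′ zero    (suc zero)    _           = y⊑ , y<
      mono′ zero    (suc (suc j)) _           = let (s , d) = mono zero (suc j) (ℕ.s≤s ℕ.z≤n) in ⊑-trans y⊑ s , ℕ.<-trans y< d
      mono′ (suc i) (suc j)       (ℕ.s≤s i<j) = mono i j i<j

    module _ (K : ℕ) (2K≤n : K ℕ.+ K ℕ.≤ n) where

      -- Term `j` belongs to dimension j + 1, whose star is `star j`; by this shift dimension 0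
      -- stays out of the sum.
      weight : {P : El → Set} → (∀ x → Dec (P x)) → ℚ
      weight P? = ∑ (downFrom K) (λ j → # (at P? (suc j)) * inv (star j))

      private
        K≤n : K ℕ.≤ n
        K≤n = ℕ.≤-trans (ℕ.m≤m+n K K) 2K≤n

        0<inv-star : ∀ j → j ℕ.< K → 0ℚ < inv (star j)
        0<inv-star j j<K = 0<inv _ (0<star j (ℕ.<-≤-trans j<K K≤n))

      module _ {P : El → Set} (P? : ∀ x → Dec (P x)) (P-meet : ∀ {x y} → P x → P y → dim (x ⊓ y) ≢ 0)
               (antichain : ∀ {x y} → P x → P y → x ⊑ y → x ≡ y) where

        -- The B_j of the overview. It inherits the intersecting property from `P`; the antichain
        -- property belongs to `P` and keeps new members apart from the shadow.
        Above : ℕ → El → Set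
        Above j x = (∃ λ y → P y × y ⊑ x) × dim x ≡ j

        above? : ∀ j x → Dec (Above j x)
        above? j = at (λ x → ∃? (λ y → P? y ×-dec (y ⊑? x))) j

        Above-meet : ∀ {i j x y} → Above i x → Above j y → dim (x ⊓ y) ≢ 0
        Above-meet {x = x} {y} ((p , Pp , p⊑x) , _) ((q , Pq , q⊑y) , _) d = P-meet Pp Pq (ℕ.n≤0⇒n≡0 (subst (dim (p ⊓ q) ℕ.≤_) d
          (dim-mono (⊓-greatest (⊑-trans (⊓-lowerˡ p q) p⊑x) (⊑-trans (⊓-lowerʳ p q) q⊑y)))))

        above-step : ∀ j → suc j ℕ.< K →
          # (above? (suc j)) * inv (star j) + # (at P? (suc (suc j))) * inv (star (suc j)) ≤ # (above? (suc (suc j))) * inv (star (suc j))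
        above-step j j<K = ≤-trans (+-monoˡ-≤ (p * i′) shadow-bound) (≤-reflexive (trans (sym (*-distribʳ-+ i′ b′ p)) (cong (_* i′) (sym split))))
          where
          -- `New` still contains the upper shadow of `Above (suc j)`: a member of `P` covering a
          -- subspace above the member y would lie strictly above y, against the antichain property.
          -- Taking `P` out makes the members of dimension j + 2 a disjoint summand in `split`.
          New : El → Set
          New x = Above (suc (suc j)) x × ¬ P x
          new? : ∀ x → Dec (New x)
          new? x = above? (suc (suc j)) x ×-dec ¬? (P? x)
          b = # (above? (suc j))
          b′ = # new?
          p = # (at P? (suc (suc j)))
          i = inv (star j)
          i′ = inv (star (suc j))
          split : # (above? (suc (suc j))) ≡ b′ + p
          split = trans (∑-cong elems (λ x → ⟦⟧-partition (above? (suc (suc j)) x) (P? x) (dim x ℕ.≟ suc (suc j))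
            proj₂ (λ Px d → (x , Px , ⊑-refl) , d))) (∑-distrib-+ elems _ _)
          shadow : b * br (n ℕ.∸ suc j) ≤ br (suc j) * b′
          shadow = UpperShadow.upper-shadow G (above? (suc j)) new? proj₂ Above-meet
            (λ ((y , Py , y⊑v) , d) (v⊑z , s) → ((y , Py , ⊑-trans y⊑v v⊑z) , trans (sym s) (cong suc d)) , λ Pz →
              ℕ.<⇒≱ (ℕ.≤-reflexive s) (subst (λ t → dim t ℕ.≤ _) (antichain Py Pz (⊑-trans y⊑v v⊑z)) (dim-mono y⊑v)))
            (λ ((_ , d) , _) → d) (ℕ.s≤s ℕ.z≤n) (ℕ.≤-trans (ℕ.+-mono-≤ (ℕ.<⇒≤ j<K) (ℕ.<⇒≤ j<K)) 2K≤n)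
          shadow-bound : b * i ≤ b′ * i′
          shadow-bound = *-cancelˡ-≤ (0<br j) (≤-trans (≤-reflexive left) (≤-trans (*-monoˡ (<⇒≤ (0<inv-star (suc j) j<K)) shadow) (≤-reflexive
              (solve 3 (λ i r b → i :* (r :* b) := r :* (b :* i)) refl i′ (br (suc j)) b′))))
            where
            left : br (suc j) * (b * i) ≡ i′ * (b * br (n ℕ.∸ suc j))
            left = trans (solve 3 (λ r b i → r :* (b :* i) := (i :* r) :* b) refl (br (suc j)) b i)
              (trans (cong (_* b) (star-ratio j (ℕ.<-≤-trans j<K K≤n)))
                     (solve 3 (λ i m b → (i :* m) :* b := i :* (b :* m)) refl i′ (br (n ℕ.∸ suc j)) b))

        above-bound : ∀ j → j ℕ.< K → ∑ (downFrom (suc j)) (λ i → # (at P? (suc i)) * inv (star i)) ≤ # (above? (suc j)) * inv (star j)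
        above-bound zero    j<K = ≤-trans (≤-reflexive (+-identityʳ _)) (*-monoʳ (<⇒≤ (0<inv-star 0 j<K))
          (∑-mono elems (λ x → ⟦⟧-mono (at P? 1 x) (above? 1 x) (λ (Px , d) → (x , Px , ⊑-refl) , d))))
        above-bound (suc j) j<K = ≤-trans (≤-reflexive (+-comm (t (suc j)) (∑ (downFrom (suc j)) t)))
          (≤-trans (+-monoˡ-≤ (t (suc j)) (above-bound j (ℕ.<-trans (ℕ.n<1+n j) j<K))) (above-step j j<K))
          where
          t : ℕ → ℚ
          t i = # (at P? (suc i)) * inv (star i)

        antichain-weight : weight P? ≤ 1ℚ
        antichain-weight = by K refl
          where
          by : ∀ m → m ≡ K → weight P? ≤ 1ℚ
          by zero    refl = 0≤1
          by (suc j) refl = ≤-trans (above-bound j ℕ.≤-refl) (*-cancelˡ-≤ (0<star j (ℕ.<-≤-trans (ℕ.n<1+n j) K≤n))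
            (≤-trans (≤-reflexive (trans (solve 3 (λ s a i → s :* (a :* i) := (i :* s) :* a) refl (star j) a (inv (star j)))
                                         (trans (cong (_* a) (inv-* _ (0<star j (ℕ.<-≤-trans (ℕ.n<1+n j) K≤n)))) (*-identityˡ a))))
                     (≤-trans a≤star (≤-reflexive (sym (*-identityʳ (star j)))))))
            where
            a = # (above? (suc j))
            a≤star : a ≤ star j
            a≤star = *-cancelˡ-≤ (br-mono-< {0} (ℕ.<-≤-trans (ℕ.s≤s (ℕ.z≤n {j})) K≤n))
              (≤-trans (≤-reflexive (*-comm (br n) a))
              (≤-trans (KneserSpectrum.erdős-ko-rado G (suc j) 2K≤n (above? (suc j)) proj₂ Above-meet (ℕ.s≤s ℕ.z≤n))
                       (≤-reflexive (trans (*-comm (br (suc j)) _) (level-star j)))))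

      weight-split : {P : El → Set} (P? : ∀ x → Dec (P x)) → weight P? ≡ weight (minimal? P?) + weight (next? P?)
      weight-split P? = trans (∑-cong (downFrom K) (λ j → trans (cong (_* inv (star j)) (trans (∑-cong elems (pointwise (suc j)))
          (∑-distrib-+ elems (λ x → ⟦ at (minimal? P?) (suc j) x ⟧) (λ x → ⟦ at (next? P?) (suc j) x ⟧))))
          (*-distribʳ-+ (inv (star j)) (# (at (minimal? P?) (suc j))) (# (at (next? P?) (suc j))))))
        (∑-distrib-+ (downFrom K) (λ j → # (at (minimal? P?) (suc j)) * inv (star j)) (λ j → # (at (next? P?) (suc j)) * inv (star j)))
        where
        pointwise : ∀ j x → ⟦ at P? j x ⟧ ≡ ⟦ at (minimal? P?) j x ⟧ + ⟦ at (next? P?) j x ⟧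
        pointwise j x = separate (P? x) (∃? (λ y → P? y ×-dec ((y ⊑? x) ×-dec (dim y ℕ.<? dim x)))) (dim x ℕ.≟ j)
          where
          separate : {A B C : Set} (a : Dec A) (b : Dec B) (c : Dec C) →
                     ⟦ a ×-dec c ⟧ ≡ ⟦ (a ×-dec ¬? b) ×-dec c ⟧ + ⟦ (a ×-dec b) ×-dec c ⟧
          separate (no _)  _       _       = refl
          separate (yes _) (yes _) (yes _) = refl
          separate (yes _) (no _)  (yes _) = refl
          separate (yes _) (yes _) (no _)  = refl
          separate (yes _) (no _)  (no _)  = refl

      -- `layer P (suc k)` unfolds to `layer (next P) k`, so the hypothesis passes unchanged to the
      -- members that are not minimal, while the minimal ones weigh at most 1.
      sperner-weight : ∀ k {P : El → Set} (P? : ∀ x → Dec (P x)) → (∀ {x y} → P x → P y → dim (x ⊓ y) ≢ 0) →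
                       (∀ x → ¬ layer P k x) → weight P? ≤ ∑ (downFrom k) (λ _ → 1ℚ)
      sperner-weight zero    P? meet none = ≤-reflexive (∑-zero (downFrom K) (λ j →
        trans (cong (_* inv (star j)) (∑-none (at P? (suc j)) (λ x (Px , _) → none x Px))) (*-zeroˡ (inv (star j)))))
      sperner-weight (suc k) {P} P? meet none = ≤-trans (≤-reflexive (weight-split P?)) (+-mono-≤
        (antichain-weight (minimal? P?) (λ (p , _) (q , _) → meet p q) minimal-antichain)
        (sperner-weight k (next? P?) (λ (p , _) (q , _) → meet p q) none))
        where
        minimal-antichain : ∀ {x y} → P x × _ → P y × ¬ (∃ λ z → P z × z ⊑ y × dim z ℕ.< dim y) → x ⊑ y → x ≡ y
        minimal-antichain {x} {y} (Px , _) (_ , ¬below) x⊑y = dim-≡ x⊑y (ℕ.≤-antisym (dim-mono x⊑y)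
          (ℕ.≮⇒≥ (λ lt → ¬below (x , Px , x⊑y , lt))))

-- Vectors over a finite field, coded by numbers

module Vectors where

  open import Algebra.Bundles using (CommutativeRing)
  import Algebra.Properties.Ring as RingProperties
  open import Data.Fin using (Fin; zero; suc; finToFun; funToFin; combine)
  open import Data.Fin.Properties using (funToFin-finToFin; finToFun-funToFin)
  open import Data.Nat as ℕ using (ℕ; zero; suc)
  open import Data.Product using (_,_)
  open import Function.Bundles using (Inverse)
  open import Level using (0ℓ)
  open import Relation.Binary.PropositionalEquality
  open import Defs using (FiniteField)

  funToFin-cong : ∀ {m n} {f g : Fin m → Fin n} → f ≗ g → funToFin f ≡ funToFin g
  funToFin-cong {zero}  e = refl
  funToFin-cong {suc m} e = cong₂ combine (e zero) (funToFin-cong (λ i → e (suc i)))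

  module Encoding {q : ℕ} (F : FiniteField q) where
    open FiniteField F

    ring : CommutativeRing 0ℓ 0ℓ
    ring = record { isCommutativeRing = isCommutativeRing }

    private
      module R = CommutativeRing ring
      module RP = RingProperties R.ring

    toFin : Carrier → Fin q
    toFin = Inverse.to card

    fromFin : Fin q → Carrier
    fromFin = Inverse.from card

    fromFin-toFin : ∀ c → fromFin (toFin c) ≡ c
    fromFin-toFin = Inverse.strictlyInverseʳ card

    toFin-fromFin : ∀ i → toFin (fromFin i) ≡ i
    toFin-fromFin = Inverse.strictlyInverseˡ card

    -- On codes, pointwise equality of coordinate functions becomes decidable propositional
    -- equality, and sums over all vectors become sums over a `Fin`.
    encode : ∀ {m} → (Fin m → Carrier) → Fin (q ℕ.^ m)
    encode v = funToFin (λ i → toFin (v i))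

    decode : ∀ {m} → Fin (q ℕ.^ m) → Fin m → Carrier
    decode u i = fromFin (finToFun u i)

    decode-encode : ∀ {m} (v : Fin m → Carrier) → decode (encode v) ≗ v
    decode-encode v i = trans (cong fromFin (finToFun-funToFin (λ i → toFin (v i)) i)) (fromFin-toFin (v i))

    encode-cong : ∀ {m} {v w : Fin m → Carrier} → v ≗ w → encode v ≡ encode w
    encode-cong e = funToFin-cong (λ i → cong toFin (e i))

    encode-decode : ∀ {m} (u : Fin (q ℕ.^ m)) → encode {m} (decode u) ≡ u
    encode-decode {m} u = trans (funToFin-cong {m} {q} (λ i → toFin-fromFin (finToFun {q} {m} u i))) (funToFin-finToFin {m} {q} u)

    decode-injective : ∀ {m} {u v : Fin (q ℕ.^ m)} → decode {m} u ≗ decode v → u ≡ v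
    decode-injective {m} {u} {v} e = trans (sym (encode-decode {m} u)) (trans (encode-cong e) (encode-decode {m} v))

    module Space (n : ℕ) where

      infixl 6 _⊕_ _⊖_
      infixl 7 _∙_

      E : Set
      E = Fin (q ℕ.^ n)

      𝟎 : E
      𝟎 = encode {n} (λ _ → 0#)

      _⊕_ : E → E → E
      u ⊕ v = encode {n} (λ i → decode u i + decode v i)

      _∙_ : Carrier → E → E
      c ∙ v = encode {n} (λ i → c * decode v i)

      _⊖_ : E → E → E
      u ⊖ v = u ⊕ (- 1#) ∙ v

      private
        dec : E → Fin n → Carrier
        dec = decode {n}

        ext : ∀ {u v} → dec u ≗ dec v → u ≡ v
        ext = decode-injective {n}

      decode-⊕ : ∀ u v i → decode {n} (u ⊕ v) i ≡ decode u i + decode v i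
      decode-⊕ u v = decode-encode {n} _

      decode-∙ : ∀ c v i → decode {n} (c ∙ v) i ≡ c * decode v i
      decode-∙ c v = decode-encode {n} _

      decode-𝟎 : ∀ i → decode {n} 𝟎 i ≡ 0#
      decode-𝟎 = decode-encode {n} _

      decode-⊖ : ∀ u v i → decode {n} (u ⊖ v) i ≡ decode u i + (- decode v i)
      decode-⊖ u v i = trans (decode-⊕ u ((- 1#) ∙ v) i) (cong (dec u i +_) (trans (decode-∙ (- 1#) v i) (RP.-1*x≈-x (dec v i))))

      ⊖-⊕ : ∀ u v → (u ⊖ v) ⊕ v ≡ u
      ⊖-⊕ u v = ext λ i → trans (decode-⊕ (u ⊖ v) v i) (trans (cong (_+ dec v i) (decode-⊖ u v i))
        (trans (R.+-assoc _ _ _) (trans (cong (dec u i +_) (R.-‿inverseˡ (dec v i))) (R.+-identityʳ _))))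

      ⊕-⊖ : ∀ u v → (u ⊕ v) ⊖ v ≡ u
      ⊕-⊖ u v = ext λ i → trans (decode-⊖ (u ⊕ v) v i) (trans (cong (_+ (- dec v i)) (decode-⊕ u v i))
        (trans (R.+-assoc _ _ _) (trans (cong (dec u i +_) (R.-‿inverseʳ (dec v i))) (R.+-identityʳ _))))

      ⊕-comm : ∀ u v → u ⊕ v ≡ v ⊕ u
      ⊕-comm u v = ext λ i → trans (decode-⊕ u v i) (trans (R.+-comm _ _) (sym (decode-⊕ v u i)))

      ⊖-self : ∀ u → u ⊖ u ≡ 𝟎
      ⊖-self u = ext λ i → trans (decode-⊖ u u i) (trans (R.-‿inverseʳ (dec u i)) (sym (decode-𝟎 i)))

      ⊖-𝟎 : ∀ u → u ⊖ 𝟎 ≡ u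
      ⊖-𝟎 u = ext λ i → trans (decode-⊖ u 𝟎 i) (trans (cong (λ z → dec u i + (- z)) (decode-𝟎 i))
        (trans (cong (dec u i +_) RP.-0#≈0#) (R.+-identityʳ _)))

      ⊖-⊕-assoc : ∀ s u v → s ⊖ (u ⊕ v) ≡ (s ⊖ v) ⊖ u
      ⊖-⊕-assoc s u v = ext λ i → trans (decode-⊖ s (u ⊕ v) i) (trans (cong (λ z → dec s i + (- z)) (decode-⊕ u v i))
        (trans (cong (dec s i +_) (trans (sym (RP.-‿+-comm (dec u i) (dec v i))) (R.+-comm _ _)))
        (trans (sym (R.+-assoc _ _ _)) (sym (trans (decode-⊖ (s ⊖ v) u i) (cong (_+ (- dec u i)) (decode-⊖ s v i)))))))

      ⊕-⊖-interchange : ∀ s t u v → (s ⊕ t) ⊖ (u ⊕ v) ≡ (s ⊖ u) ⊕ (t ⊖ v)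
      ⊕-⊖-interchange s t u v = ext λ i → trans (decode-⊖ (s ⊕ t) (u ⊕ v) i) (trans (cong₂ (λ x y → x + (- y)) (decode-⊕ s t i) (decode-⊕ u v i))
        (trans (cong ((dec s i + dec t i) +_) (sym (RP.-‿+-comm (dec u i) (dec v i))))
        (trans (interchange (dec s i) (dec t i) (- dec u i) (- dec v i))
        (sym (trans (decode-⊕ (s ⊖ u) (t ⊖ v) i) (cong₂ _+_ (decode-⊖ s u i) (decode-⊖ t v i)))))))
        where open import Algebra.Properties.CommutativeSemigroup R.+-commutativeSemigroup using (interchange)

      ∙-⊖ : ∀ c s v → c ∙ s ⊖ c ∙ v ≡ c ∙ (s ⊖ v)
      ∙-⊖ c s v = ext λ i → trans (decode-⊖ (c ∙ s) (c ∙ v) i) (trans (cong₂ (λ x y → x + (- y)) (decode-∙ c s i) (decode-∙ c v i))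
        (trans (cong ((c * dec s i) +_) (RP.-‿distribʳ-* c (dec v i))) (trans (sym (R.distribˡ _ _ _))
        (sym (trans (decode-∙ c (s ⊖ v) i) (cong (c *_) (decode-⊖ s v i)))))))

      ∙-assoc : ∀ c d v → c ∙ (d ∙ v) ≡ (c * d) ∙ v
      ∙-assoc c d v = ext λ i → trans (decode-∙ c (d ∙ v) i) (trans (cong (c *_) (decode-∙ d v i))
        (trans (sym (R.*-assoc _ _ _)) (sym (decode-∙ (c * d) v i))))

      ∙-distrib : ∀ c d v → c ∙ v ⊕ d ∙ v ≡ (c + d) ∙ v
      ∙-distrib c d v = ext λ i → trans (decode-⊕ (c ∙ v) (d ∙ v) i) (trans (cong₂ _+_ (decode-∙ c v i) (decode-∙ d v i))
        (trans (sym (R.distribʳ _ _ _)) (sym (decode-∙ (c + d) v i))))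

      ∙-𝟎 : ∀ c → c ∙ 𝟎 ≡ 𝟎
      ∙-𝟎 c = ext λ i → trans (decode-∙ c 𝟎 i) (trans (cong (c *_) (decode-𝟎 i)) (trans (R.zeroʳ c) (sym (decode-𝟎 i))))

      𝟎-⊕ : 𝟎 ⊕ 𝟎 ≡ 𝟎
      𝟎-⊕ = ext λ i → trans (decode-⊕ 𝟎 𝟎 i) (trans (cong (dec 𝟎 i +_) (decode-𝟎 i)) (R.+-identityʳ (dec 𝟎 i)))

      0∙ : ∀ v → 0# ∙ v ≡ 𝟎
      0∙ v = ext λ i → trans (decode-∙ 0# v i) (trans (R.zeroˡ _) (sym (decode-𝟎 i)))

      1∙ : ∀ v → 1# ∙ v ≡ v
      1∙ v = ext λ i → trans (decode-∙ 1# v i) (R.*-identityˡ _)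

      ∙-cancel : ∀ {c d v} → v ≢ 𝟎 → c ∙ v ≡ d ∙ v → c ≡ d
      ∙-cancel {c} {d} {v} v≢0 e = decided (toFin (c + (- d)) Fin.≟ toFin 0#)
        where
        import Data.Fin as Fin
        open import Data.Empty using (⊥-elim)
        open import Relation.Nullary using (Dec; yes; no)
        difference : (c + (- d)) ∙ v ≡ 𝟎
        difference = trans (sym (∙-distrib c (- d) v)) (trans (cong (_⊕ (- d) ∙ v) e)
          (trans (∙-distrib d (- d) v) (trans (cong (_∙ v) (R.-‿inverseʳ d)) (0∙ v))))
        decided : Dec (toFin (c + (- d)) ≡ toFin 0#) → c ≡ d
        decided (yes p) = RP.x∙y⁻¹≈ε⇒x≈y c d (trans (sym (fromFin-toFin _)) (trans (cong fromFin p) (fromFin-toFin 0#)))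
        decided (no ¬p) with inverse (c + (- d)) (λ z → ¬p (cong toFin z))
        ... | y , cy≡1 = ⊥-elim (v≢0 (trans (sym (1∙ v)) (trans (cong (_∙ v) (trans (sym cy≡1) (R.*-comm _ y)))
                (trans (sym (∙-assoc y (c + (- d)) v)) (trans (cong (y ∙_) difference) (∙-𝟎 y))))))

-- The subspaces of a finite vector space as a geometry

module SubspaceGeometry where

  open Prelude
  open import Data.Bool as Bool using (Bool; true; false)
  import Data.Bool.Properties as Bool
  open import Data.Fin as Fin using (Fin; zero; suc)
  open import Data.Fin.Properties using (all?; any?)
  import Data.Integer as ℤ
  import Data.Integer.Properties as ℤ
  open import Data.List as List using (List; []; _∷_; _++_)
  open import Data.List.Membership.Propositional using (_∈_)
  open import Data.List.Relation.Unary.Any using (here; there)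
  import Data.Nat as ℕ
  import Data.Nat.Coprimality as Coprimality
  import Data.Nat.Properties as ℕ
  open import Data.Unit using (⊤; tt)
  open import Data.Vec using (Vec; []; _∷_; lookup; tabulate)
  open import Data.Vec.Properties using (≡-dec; lookup∘tabulate; tabulate∘lookup; tabulate-cong)
  open import Defs using (FiniteField; ofℕ)
  open FiniteSums
  open Arithmetic
  open SubspaceLattices
  open LinearSystems using (module Rank)
  open Vectors

  -- `ofℕ` normalises a fraction; with the denominator 1 exposed, the rational operations reduce to
  -- those on integers.
  ofℕ-mkℚ : ∀ m → ofℕ m ≡ mkℚ (ℤ.+ m) 0 (Coprimality.sym (Coprimality.1-coprimeTo m))
  ofℕ-mkℚ m = ↥p/↧p≡p (mkℚ (ℤ.+ m) 0 (Coprimality.sym (Coprimality.1-coprimeTo m)))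

  ofℕ-+ : ∀ a b → ofℕ (a ℕ.+ b) ≡ ofℕ a + ofℕ b
  ofℕ-+ a b = sym (trans (cong₂ _+_ (ofℕ-mkℚ a) (ofℕ-mkℚ b))
    (cong (_/ 1) (cong₂ ℤ._+_ (ℤ.*-identityʳ (ℤ.+ a)) (ℤ.*-identityʳ (ℤ.+ b)))))

  ofℕ-* : ∀ a b → ofℕ (a ℕ.* b) ≡ ofℕ a * ofℕ b
  ofℕ-* a b = sym (trans (cong₂ _*_ (ofℕ-mkℚ a) (ofℕ-mkℚ b)) (cong (_/ 1) (sym (ℤ.pos-* a b))))

  0≤ofℕ : ∀ m → 0ℚ ≤ ofℕ m
  0≤ofℕ zero    = ≤-refl
  0≤ofℕ (suc m) = ≤-trans (+-nonneg 0≤1 (0≤ofℕ m)) (≤-reflexive (sym (ofℕ-+ 1 m)))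

  ∑-tabulate : ∀ {A : Set} {m} (g : Fin m → A) (f : A → ℚ) → ∑ (List.tabulate g) f ≡ ∑ (List.allFin m) (λ i → f (g i))
  ∑-tabulate {m = zero}  g f = refl
  ∑-tabulate {m = suc m} g f = cong (f (g zero) +_) (trans (∑-tabulate (λ i → g (suc i)) f) (sym (∑-tabulate suc (λ i → f (g i)))))

  ∑-ones : ∀ m → ∑ (List.allFin m) (λ _ → 1ℚ) ≡ ofℕ m
  ∑-ones zero    = refl
  ∑-ones (suc m) = trans (cong (1ℚ +_) (trans (∑-tabulate {m = m} suc (λ _ → 1ℚ)) (∑-ones m))) (sym (ofℕ-+ 1 m))

  finiteFin : ∀ m → Finite (Fin m)
  finiteFin m = record { _≟ᶠ_ = Fin._≟_ ; elems = List.allFin m ; ∑-δ-1 = once }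
    where
    once : ∀ {m} (a : Fin m) → ∑ (List.allFin m) (λ i → ⟦ i Fin.≟ a ⟧) ≡ 1ℚ
    once {suc m} zero    = trans (cong (1ℚ +_) (trans (∑-tabulate {m = m} suc (λ i → ⟦ i Fin.≟ zero ⟧)) (∑-zero (List.allFin m) (λ _ → refl)))) (+-identityʳ 1ℚ)
    once {suc m} (suc a) = trans (+-identityˡ _) (trans (∑-tabulate {m = m} suc (λ i → ⟦ i Fin.≟ suc a ⟧))
      (trans (∑-cong (List.allFin m) (λ i → ⟦⟧-cong (suc i Fin.≟ suc a) (i Fin.≟ a) (λ { refl → refl }) (cong suc))) (once a)))

  bits : ∀ m → List (Vec Bool m)
  bits zero    = [] ∷ []
  bits (suc m) = List.map (true ∷_) (bits m) ++ List.map (false ∷_) (bits m)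

  finiteBits : ∀ m → Finite (Vec Bool m)
  finiteBits m = record { _≟ᶠ_ = ≡-dec Bool._≟_ ; elems = bits m ; ∑-δ-1 = once m }
    where
    open import Data.Vec.Properties using (∷-injectiveˡ; ∷-injectiveʳ)
    _≟ᵛ_ : ∀ {m} (x y : Vec Bool m) → Dec (x ≡ y)
    _≟ᵛ_ = ≡-dec Bool._≟_
    once : ∀ m (a : Vec Bool m) → ∑ (bits m) (λ x → ⟦ x ≟ᵛ a ⟧) ≡ 1ℚ
    with-head : ∀ {m} b c (a : Vec Bool m) → ∑ (List.map (b ∷_) (bits m)) (λ x → ⟦ x ≟ᵛ (c ∷ a) ⟧) ≡ ⟦ b Bool.≟ c ⟧
    with-head {m} b c a = trans (∑-map (b ∷_) (bits m) _) (by (b Bool.≟ c))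
      where
      by : (d : Dec (b ≡ c)) → ∑ (bits m) (λ x → ⟦ (b ∷ x) ≟ᵛ (c ∷ a) ⟧) ≡ ⟦ d ⟧
      by (yes refl) = trans (∑-cong (bits m) (λ x → ⟦⟧-cong ((b ∷ x) ≟ᵛ (b ∷ a)) (x ≟ᵛ a) ∷-injectiveʳ (cong (b ∷_)))) (once m a)
      by (no b≢c)   = ∑-zero (bits m) (λ x → ⟦⟧-no ((b ∷ x) ≟ᵛ (c ∷ a)) (λ e → b≢c (∷-injectiveˡ e)))
    once zero    []      = +-identityʳ 1ℚ
    once (suc m) (c ∷ a) = trans (∑-++ (List.map (true ∷_) (bits m)) (List.map (false ∷_) (bits m)) _)
      (trans (cong₂ _+_ (with-head true c a) (with-head false c a)) (one c))
      where
      one : ∀ c → ⟦ true Bool.≟ c ⟧ + ⟦ false Bool.≟ c ⟧ ≡ 1ℚ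
      one true  = refl
      one false = refl

  module FieldOrder {q : ℕ} (F : FiniteField q) where
    open FiniteField F using (0#; 1#; 0≢1)
    open Encoding F

    2≤q : 2 ℕ.≤ q
    2≤q = by (toFin 0#) (toFin 1#) (λ e → 0≢1 (trans (sym (fromFin-toFin 0#)) (trans (cong fromFin e) (fromFin-toFin 1#))))
      where
      by : ∀ {m} (i j : Fin m) → i ≢ j → 2 ℕ.≤ m
      by {suc zero}    zero zero ne = ⊥-elim (ne refl)
      by {suc (suc m)} _    _    _  = ℕ.s≤s (ℕ.s≤s ℕ.z≤n)

    Q : ℚ
    Q = ofℕ q

    1<Q : 1ℚ < Q
    1<Q = by 2≤q
      where
      by : ∀ {m} → 2 ℕ.≤ m → 1ℚ < ofℕ m
      by {suc zero} (ℕ.s≤s ())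
      by {suc (suc m)} _ = <-≤-trans (≤-<-trans (≤-reflexive (sym (+-identityʳ 1ℚ))) (+-monoʳ-< 1ℚ (<-≤-trans 0<1
        (≤-trans (≤-reflexive (sym (+-identityʳ 1ℚ))) (≤-trans (+-monoʳ-≤ 1ℚ (0≤ofℕ m)) (≤-reflexive (sym (ofℕ-+ 1 m))))))))
        (≤-reflexive (sym (ofℕ-+ 1 (suc m))))

    1≤Q : 1ℚ ≤ Q
    1≤Q = <⇒≤ 1<Q

    open QNumbers Q 1≤Q

    pw-ofℕ : ∀ m → pw m ≡ ofℕ (q ℕ.^ m)
    pw-ofℕ zero    = refl
    pw-ofℕ (suc m) = trans (cong (Q *_) (pw-ofℕ m)) (sym (ofℕ-* q (q ℕ.^ m)))

    pw-mono-< : ∀ {a b} → a ℕ.< b → pw a < pw b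
    pw-mono-< {a} {b} a<b = <-≤-trans (≤-<-trans (≤-reflexive (sym (*-identityˡ (pw a)))) (*-monoˡ-<-pos (pw a) {{positive (0<pw a)}} 1<Q)) (pw-mono a<b)

    pw-cancel-≤ : ∀ {a b} → pw a ≤ pw b → a ℕ.≤ b
    pw-cancel-≤ {a} {b} le = ℕ.≮⇒≥ (λ b<a → <-irrefl refl (<-≤-trans (pw-mono-< b<a) le))

    pw-injective : ∀ {a b} → pw a ≡ pw b → a ≡ b
    pw-injective e = ℕ.≤-antisym (pw-cancel-≤ (≤-reflexive e)) (pw-cancel-≤ (≤-reflexive (sym e)))

  module Construction {q : ℕ} (F : FiniteField q) (n : ℕ) where
    open FiniteField F using (0#; 1#; 0≢1)
    private
      module K = FiniteField F
    open Encoding F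
    open Space n

    open FieldOrder F
    open QNumbers Q 1≤Q

    finiteE : Finite E
    finiteE = finiteFin _

    private
      vs : List E
      vs = Finite.elems finiteE
      _≟ᵉ_ : (u v : E) → Dec (u ≡ v)
      _≟ᵉ_ = Finite._≟ᶠ_ finiteE

    Subset : Set
    Subset = Vec Bool (q ℕ.^ n)

    infix 4 _∈ˢ_ _∈ˢ?_
    _∈ˢ_ : E → Subset → Set
    u ∈ˢ s = lookup s u ≡ true

    _∈ˢ?_ : ∀ u s → Dec (u ∈ˢ s)
    u ∈ˢ? s = lookup s u Bool.≟ true

    subset : {P : E → Set} → (∀ u → Dec (P u)) → Subset
    subset P? = tabulate (λ u → does (P? u))

    ∈-subset⁺ : {P : E → Set} (P? : ∀ u → Dec (P u)) → ∀ {u} → P u → u ∈ˢ subset P?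
    ∈-subset⁺ P? {u} p = trans (lookup∘tabulate (λ u → does (P? u)) u) (dec-true (P? u) p)

    ∈-subset⁻ : {P : E → Set} (P? : ∀ u → Dec (P u)) → ∀ {u} → u ∈ˢ subset P? → P u
    ∈-subset⁻ P? {u} e = by (P? u) (trans (sym (lookup∘tabulate (λ u → does (P? u)) u)) e)
      where
      by : ∀ {A : Set} (d : Dec A) → does d ≡ true → A
      by (yes a) _ = a

    -- Scalars range over codes in `Fin q`, which makes closure decidable by search; decidability is
    -- what allows the irrelevant proof in `El` to be recomputed.
    Closed : Subset → Set
    Closed s = 𝟎 ∈ˢ s × (∀ u v → u ∈ˢ s → v ∈ˢ s → u ⊕ v ∈ˢ s) × (∀ (i : Fin q) v → v ∈ˢ s → fromFin i ∙ v ∈ˢ s)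

    closed? : ∀ s → Dec (Closed s)
    closed? s = (𝟎 ∈ˢ? s) ×-dec (all? (λ u → all? (λ v → (u ∈ˢ? s) →-dec ((v ∈ˢ? s) →-dec (u ⊕ v ∈ˢ? s)))))
      ×-dec (all? (λ i → all? (λ v → (v ∈ˢ? s) →-dec (fromFin i ∙ v ∈ˢ? s))))

    -- Without function extensionality the predicates of LinAlg.Subspace have no decidable equality;
    -- bit vectors indexed by the codes of the vectors do, and the proof of closure is irrelevant.
    record El : Set where
      constructor mk
      field
        set     : Subset
        .closed : Closed set
    open El

    private
      laws : ∀ x → Closed (set x)
      laws (mk s c) = recompute (closed? s) c

    infix 4 _∈ᵉ_ _∈ᵉ?_
    _∈ᵉ_ : E → El → Set
    u ∈ᵉ x = u ∈ˢ set x

    _∈ᵉ?_ : ∀ u x → Dec (u ∈ᵉ x)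
    u ∈ᵉ? x = u ∈ˢ? set x

    𝟎∈ : ∀ x → 𝟎 ∈ᵉ x
    𝟎∈ x = proj₁ (laws x)

    ⊕∈ : ∀ x {u v} → u ∈ᵉ x → v ∈ᵉ x → u ⊕ v ∈ᵉ x
    ⊕∈ x = proj₁ (proj₂ (laws x)) _ _

    ∙∈ : ∀ x c {v} → v ∈ᵉ x → c ∙ v ∈ᵉ x
    ∙∈ x c {v} v∈x = subst (λ c → c ∙ v ∈ᵉ x) (fromFin-toFin c) (proj₂ (proj₂ (laws x)) (toFin c) v v∈x)

    ⊖∈ : ∀ x {u v} → u ∈ᵉ x → v ∈ᵉ x → u ⊖ v ∈ᵉ x
    ⊖∈ x u∈x v∈x = ⊕∈ x u∈x (∙∈ x (K.- 1#) v∈x)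

    subspace : {P : E → Set} (P? : ∀ u → Dec (P u)) → P 𝟎 → (∀ {u v} → P u → P v → P (u ⊕ v)) → (∀ c {v} → P v → P (c ∙ v)) → El
    subspace P? p0 p+ p∙ = mk (subset P?) (∈-subset⁺ P? p0 ,
      (λ u v u∈ v∈ → ∈-subset⁺ P? (p+ (∈-subset⁻ P? u∈) (∈-subset⁻ P? v∈))) ,
      (λ i v v∈ → ∈-subset⁺ P? (p∙ (fromFin i) (∈-subset⁻ P? v∈))))

    infix 4 _⊑_ _⊑?_
    _⊑_ : El → El → Set
    x ⊑ y = ∀ u → u ∈ᵉ x → u ∈ᵉ y

    _⊑?_ : ∀ x y → Dec (x ⊑ y)
    x ⊑? y = all? (λ u → (u ∈ᵉ? x) →-dec (u ∈ᵉ? y))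

    El-≡ : ∀ {x y} → set x ≡ set y → x ≡ y
    El-≡ {mk _ _} {mk _ _} refl = refl

    ⊑-antisym : ∀ x y → x ⊑ y → y ⊑ x → x ≡ y
    ⊑-antisym x y x⊑y y⊑x = El-≡ (trans (sym (tabulate∘lookup (set x)))
      (trans (tabulate-cong (λ u → same (x⊑y u) (y⊑x u))) (tabulate∘lookup (set y))))
      where
      same : ∀ {a b : Bool} → (a ≡ true → b ≡ true) → (b ≡ true → a ≡ true) → a ≡ b
      same {true}          f g = sym (f refl)
      same {false} {true}  f g = g refl
      same {false} {false} f g = refl

    finiteEl : Finite El
    finiteEl = record { _≟ᶠ_ = _≟ˢ_ ; elems = subs (bits _) ; ∑-δ-1 = λ a → trans (∑-subs (bits _) a) (Finite.∑-δ-1 (finiteBits _) (set a)) }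
      where
      _≟ˢ_ : (x y : El) → Dec (x ≡ y)
      x ≟ˢ y = map′ El-≡ (cong set) (≡-dec Bool._≟_ (set x) (set y))
      subs : List Subset → List El
      subs [] = []
      subs (s ∷ ss) with closed? s
      ... | yes c = mk s c ∷ subs ss
      ... | no _  = subs ss
      ∑-subs : ∀ ss a → ∑ (subs ss) (λ x → ⟦ x ≟ˢ a ⟧) ≡ ∑ ss (λ s → ⟦ ≡-dec Bool._≟_ s (set a) ⟧)
      ∑-subs [] a = refl
      ∑-subs (s ∷ ss) a with closed? s
      ... | yes c = cong₂ _+_ (⟦⟧-cong (mk s c ≟ˢ a) (≡-dec Bool._≟_ s (set a)) (cong set) El-≡) (∑-subs ss a)
      ... | no ¬c = trans (∑-subs ss a) (trans (sym (+-identityˡ _))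
              (cong (_+ _) (sym (⟦⟧-no (≡-dec Bool._≟_ s (set a)) (λ { refl → ¬c (laws a) })))))

    size : El → ℚ
    size x = ∑ vs (λ u → ⟦ u ∈ᵉ? x ⟧)

    size-mono : ∀ x y → x ⊑ y → size x ≤ size y
    size-mono x y x⊑y = ∑-mono vs (λ u → ⟦⟧-mono (u ∈ᵉ? x) (u ∈ᵉ? y) (x⊑y u))

    size-difference : ∀ x y → x ⊑ y → ∑ vs (λ u → ⟦ (u ∈ᵉ? y) ×-dec ¬? (u ∈ᵉ? x) ⟧) ≡ size y - size x
    size-difference x y x⊑y = trans (∑-cong vs (λ u → pointwise (u ∈ᵉ? x) (u ∈ᵉ? y) (x⊑y u)))
        (∑-distrib-- vs (λ u → ⟦ u ∈ᵉ? y ⟧) (λ u → ⟦ u ∈ᵉ? x ⟧))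
      where
      pointwise : ∀ {A B : Set} (a : Dec A) (b : Dec B) → (A → B) → ⟦ b ×-dec ¬? a ⟧ ≡ ⟦ b ⟧ - ⟦ a ⟧
      pointwise (yes _) (yes _) f = refl
      pointwise (yes a) (no ¬b) f = ⊥-elim (¬b (f a))
      pointwise (no _)  (yes _) f = refl
      pointwise (no _)  (no _)  f = refl

    size-≡ : ∀ x y → x ⊑ y → size x ≡ size y → x ≡ y
    size-≡ x y x⊑y e = ⊑-antisym x y x⊑y λ u u∈y → by u u∈y (u ∈ᵉ? x)
      where
      by : ∀ u → u ∈ᵉ y → Dec (u ∈ᵉ x) → u ∈ᵉ x
      by u u∈y (yes u∈x) = u∈x
      by u u∈y (no u∉x)  = ⊥-elim (<-irrefl refl (<-≤-trans 0<1 (≤-trans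
        (Finite.∑-witness finiteE u (λ u → (u ∈ᵉ? y) ×-dec ¬? (u ∈ᵉ? x)) (u∈y , u∉x))
        (≤-reflexive (trans (size-difference x y x⊑y) (trans (cong (_- size x) (sym e)) (+-inverseʳ (size x))))))))

    infixl 7 _⊓_
    infixl 6 _⊔_
    _⊓_ _⊔_ : El → El → El
    x ⊓ y = subspace (λ u → (u ∈ᵉ? x) ×-dec (u ∈ᵉ? y)) (𝟎∈ x , 𝟎∈ y)
      (λ (ux , uy) (vx , vy) → ⊕∈ x ux vx , ⊕∈ y uy vy) (λ c (vx , vy) → ∙∈ x c vx , ∙∈ y c vy)
    x ⊔ y = subspace (λ s → any? (λ v → (v ∈ᵉ? x) ×-dec (s ⊖ v ∈ᵉ? y)))
      (𝟎 , 𝟎∈ x , subst (_∈ᵉ y) (sym (⊖-self 𝟎)) (𝟎∈ y))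
      (λ {s} {t} (u , ux , s-u) (v , vx , t-v) → u ⊕ v , ⊕∈ x ux vx , subst (_∈ᵉ y) (sym (⊕-⊖-interchange s t u v)) (⊕∈ y s-u t-v))
      (λ c {s} (v , vx , s-v) → c ∙ v , ∙∈ x c vx , subst (_∈ᵉ y) (sym (∙-⊖ c s v)) (∙∈ y c s-v))

    ∈⊓⁻ : ∀ x y {u} → u ∈ᵉ x ⊓ y → u ∈ᵉ x × u ∈ᵉ y
    ∈⊓⁻ x y = ∈-subset⁻ (λ u → (u ∈ᵉ? x) ×-dec (u ∈ᵉ? y))

    ∈⊓⁺ : ∀ x y {u} → u ∈ᵉ x × u ∈ᵉ y → u ∈ᵉ x ⊓ y
    ∈⊓⁺ x y = ∈-subset⁺ (λ u → (u ∈ᵉ? x) ×-dec (u ∈ᵉ? y))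

    ∈⊔⁻ : ∀ x y {s} → s ∈ᵉ x ⊔ y → ∃ λ v → v ∈ᵉ x × s ⊖ v ∈ᵉ y
    ∈⊔⁻ x y = ∈-subset⁻ (λ s → any? (λ v → (v ∈ᵉ? x) ×-dec (s ⊖ v ∈ᵉ? y)))

    ∈⊔⁺ : ∀ x y {s} → (∃ λ v → v ∈ᵉ x × s ⊖ v ∈ᵉ y) → s ∈ᵉ x ⊔ y
    ∈⊔⁺ x y = ∈-subset⁺ (λ s → any? (λ v → (v ∈ᵉ? x) ×-dec (s ⊖ v ∈ᵉ? y)))

    ⊔-upperˡ : ∀ x y → x ⊑ x ⊔ y
    ⊔-upperˡ x y u ux = ∈⊔⁺ x y (u , ux , subst (_∈ᵉ y) (sym (⊖-self u)) (𝟎∈ y))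

    ⊔-upperʳ : ∀ x y → y ⊑ x ⊔ y
    ⊔-upperʳ x y u uy = ∈⊔⁺ x y (𝟎 , 𝟎∈ x , subst (_∈ᵉ y) (sym (⊖-𝟎 u)) uy)

    ⊔-least : ∀ x y z → x ⊑ z → y ⊑ z → x ⊔ y ⊑ z
    ⊔-least x y z x⊑z y⊑z s s∈ = let (v , vx , s-v) = ∈⊔⁻ x y s∈ in
      subst (_∈ᵉ z) (⊖-⊕ s v) (⊕∈ z (y⊑z _ s-v) (x⊑z v vx))

    ∑-shift : ∀ v (g : E → ℚ) → ∑ vs (λ s → g (s ⊖ v)) ≡ ∑ vs g
    ∑-shift v g = begin
      ∑ vs (λ s → g (s ⊖ v))                             ≡⟨ ∑-cong vs (λ s → sym (Finite.∑-δ finiteE (s ⊖ v) g)) ⟩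
      ∑ vs (λ s → ∑ vs (λ t → ⟦ t ≟ᵉ (s ⊖ v) ⟧ * g t))   ≡⟨ ∑-swap vs vs _ ⟩
      ∑ vs (λ t → ∑ vs (λ s → ⟦ t ≟ᵉ (s ⊖ v) ⟧ * g t))   ≡⟨ ∑-cong vs (λ t → trans (∑-*ʳ vs (g t) _) (cong (_* g t)
          (Finite.∑-unique finiteE (t ⊕ v) (λ s → t ≟ᵉ (s ⊖ v)) (sym (⊕-⊖ t v)) (λ s e → trans (sym (⊖-⊕ s v)) (cong (_⊕ v) (sym e)))))) ⟩
      ∑ vs (λ t → 1ℚ * g t)                              ≡⟨ ∑-cong vs (λ t → *-identityˡ (g t)) ⟩
      ∑ vs g                                             ∎

    -- Counting the pairs (v , w) of elements of x and y by their sum s = v ⊕ w.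
    size-⊔ : ∀ x y → size (x ⊔ y) * size (x ⊓ y) ≡ size x * size y
    size-⊔ x y = begin
      size (x ⊔ y) * size (x ⊓ y)
        ≡⟨ trans (*-comm (size (x ⊔ y)) (size (x ⊓ y))) (sym (∑-*ˡ vs (size (x ⊓ y)) _)) ⟩
      ∑ vs (λ s → size (x ⊓ y) * ⟦ s ∈ᵉ? x ⊔ y ⟧)
        ≡⟨ ∑-cong vs (λ s → sym (∑-fiber vs (size (x ⊓ y)) (s ∈ᵉ? x ⊔ y) (R? s) (λ {v} r → ∈⊔⁺ x y (v , r)) (λ s∈ → fiber s (∈⊔⁻ x y s∈)))) ⟩
      ∑ vs (λ s → ∑ vs (λ v → ⟦ R? s v ⟧))
        ≡⟨ ∑-swap vs vs _ ⟩
      ∑ vs (λ v → ∑ vs (λ s → ⟦ R? s v ⟧))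
        ≡⟨ ∑-cong vs (λ v → ∑-fiber vs (size y) (v ∈ᵉ? x) (λ s → R? s v) proj₁ (λ vx →
             trans (∑-cong vs (λ s → ⟦⟧-cong (R? s v) (s ⊖ v ∈ᵉ? y) proj₂ (vx ,_))) (∑-shift v (λ t → ⟦ t ∈ᵉ? y ⟧)))) ⟩
      ∑ vs (λ v → size y * ⟦ v ∈ᵉ? x ⟧)
        ≡⟨ trans (∑-*ˡ vs (size y) _) (*-comm (size y) (size x)) ⟩
      size x * size y ∎
      where
      R? : ∀ s v → Dec (v ∈ᵉ x × s ⊖ v ∈ᵉ y)
      R? s v = (v ∈ᵉ? x) ×-dec (s ⊖ v ∈ᵉ? y)
      fiber : ∀ s → (∃ λ v → v ∈ᵉ x × s ⊖ v ∈ᵉ y) → ∑ vs (λ v → ⟦ R? s v ⟧) ≡ size (x ⊓ y)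
      fiber s (v₀ , v₀x , s-v₀) = trans (∑-cong vs (λ v → ⟦⟧-cong (R? s v) (v ⊖ v₀ ∈ᵉ? x ⊓ y)
          (λ (vx , s-v) → ∈⊓⁺ x y (⊖∈ x vx v₀x , subst (_∈ᵉ y) (swap v) (⊖∈ y s-v₀ s-v)))
          (λ m → let (dx , dy) = ∈⊓⁻ x y m in subst (_∈ᵉ x) (⊖-⊕ v v₀) (⊕∈ x dx v₀x) ,
                 subst (_∈ᵉ y) (back v) (⊖∈ y s-v₀ dy))))
        (∑-shift v₀ (λ t → ⟦ t ∈ᵉ? x ⊓ y ⟧))
        where
        back : ∀ v → (s ⊖ v₀) ⊖ (v ⊖ v₀) ≡ s ⊖ v
        back v = trans (sym (⊖-⊕-assoc s (v ⊖ v₀) v₀)) (cong (s ⊖_) (⊖-⊕ v v₀))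
        swap : ∀ v → (s ⊖ v₀) ⊖ (s ⊖ v) ≡ v ⊖ v₀
        swap v = trans (sym (⊖-⊕-assoc s w v₀)) (trans (cong (s ⊖_) (⊕-comm w v₀)) (trans (⊖-⊕-assoc s v₀ w) (cong (_⊖ v₀) s⊖w)))
          where
          w = s ⊖ v
          s⊖w : s ⊖ w ≡ v
          s⊖w = trans (cong (_⊖ w) (sym (trans (⊕-comm v w) (⊖-⊕ s v)))) (⊕-⊖ v w)

    bot top : El
    bot = subspace (_≟ᵉ 𝟎) refl (λ { refl refl → 𝟎-⊕ }) (λ { c refl → ∙-𝟎 c })
    top = subspace {λ _ → ⊤} (λ _ → yes tt) tt (λ _ _ → tt) (λ _ _ → tt)

    ∈bot : ∀ {u} → u ∈ᵉ bot → u ≡ 𝟎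
    ∈bot = ∈-subset⁻ (_≟ᵉ 𝟎)

    bot-min : ∀ x → bot ⊑ x
    bot-min x u u∈ = subst (_∈ᵉ x) (sym (∈bot u∈)) (𝟎∈ x)

    top-max : ∀ x → x ⊑ top
    top-max x u _ = ∈-subset⁺ {λ _ → ⊤} (λ _ → yes tt) {u} tt

    line : E → El
    line v = subspace (λ u → any? (λ i → u ≟ᵉ (fromFin i ∙ v)))
      (member 0# (sym (0∙ v)))
      (λ { (i , refl) (j , refl) → member (fromFin i K.+ fromFin j) (∙-distrib (fromFin i) (fromFin j) v) })
      (λ { c (i , refl) → member (c K.* fromFin i) (∙-assoc c (fromFin i) v) })
      where
      member : ∀ c {u} → u ≡ c ∙ v → ∃ λ i → u ≡ fromFin i ∙ v
      member c e = toFin c , trans e (cong (_∙ v) (sym (fromFin-toFin c)))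

    ∈line⁻ : ∀ v {u} → u ∈ᵉ line v → ∃ λ i → u ≡ fromFin i ∙ v
    ∈line⁻ v = ∈-subset⁻ (λ u → any? (λ i → u ≟ᵉ (fromFin i ∙ v)))

    ∈line⁺ : ∀ v {u} → (∃ λ i → u ≡ fromFin i ∙ v) → u ∈ᵉ line v
    ∈line⁺ v = ∈-subset⁺ (λ u → any? (λ i → u ≟ᵉ (fromFin i ∙ v)))

    self∈line : ∀ v → v ∈ᵉ line v
    self∈line v = ∈line⁺ v (toFin 1# , trans (sym (1∙ v)) (cong (_∙ v) (sym (fromFin-toFin 1#))))

    line⊑ : ∀ x {v} → v ∈ᵉ x → line v ⊑ x
    line⊑ x {v} v∈x u u∈ = let (i , e) = ∈line⁻ v u∈ in subst (_∈ᵉ x) (sym e) (∙∈ x (fromFin i) v∈x)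

    size-bot : size bot ≡ 1ℚ
    size-bot = Finite.∑-unique finiteE 𝟎 (λ u → u ∈ᵉ? bot) (𝟎∈ bot) (λ u → ∈bot)

    size-top : size top ≡ pw n
    size-top = trans (∑-cong vs (λ u → ⟦⟧-yes (u ∈ᵉ? top) (everything u)))
                     (trans (∑-ones (q ℕ.^ n)) (sym (pw-ofℕ n)))
      where
      everything : ∀ u → u ∈ᵉ top
      everything u = ∈-subset⁺ {λ _ → ⊤} (λ _ → yes tt) {u} tt

    size-line : ∀ {v} → v ≢ 𝟎 → size (line v) ≡ Q
    size-line {v} v≢0 = begin
      ∑ vs (λ u → ⟦ u ∈ᵉ? line v ⟧)
        ≡⟨ ∑-cong vs (λ u → trans (sym (*-identityˡ _)) (sym (∑-fiber is 1ℚ (u ∈ᵉ? line v) (λ i → u ≟ᵉ (fromFin i ∙ v))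
             (λ {i} e → ∈line⁺ v (i , e)) (λ u∈ → let (i , e) = ∈line⁻ v u∈ in
               Finite.∑-unique (finiteFin q) i (λ i → u ≟ᵉ (fromFin i ∙ v)) e (λ j e′ → index≡ (trans (sym e′) e)))))) ⟩
      ∑ vs (λ u → ∑ is (λ i → ⟦ u ≟ᵉ (fromFin i ∙ v) ⟧))
        ≡⟨ ∑-swap vs is _ ⟩
      ∑ is (λ i → ∑ vs (λ u → ⟦ u ≟ᵉ (fromFin i ∙ v) ⟧))
        ≡⟨ ∑-cong is (λ i → Finite.∑-δ-1 finiteE (fromFin i ∙ v)) ⟩
      ∑ is (λ _ → 1ℚ)
        ≡⟨ ∑-ones q ⟩
      Q ∎
      where
      is : List (Fin q)
      is = List.allFin q
      index≡ : ∀ {i j} → fromFin i ∙ v ≡ fromFin j ∙ v → i ≡ j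
      index≡ {i} {j} e = trans (sym (toFin-fromFin i)) (trans (cong toFin (∙-cancel v≢0 e)) (toFin-fromFin j))

    -- The line meets `x` in zero only, since a nonzero multiple of `v` in `x` could be scaled back
    -- to `v`; the rest is `size-⊔`.
    size-extend : ∀ x {v} → ¬ (v ∈ᵉ x) → size (x ⊔ line v) ≡ Q * size x
    size-extend x {v} v∉x = begin
      size (x ⊔ line v)                          ≡⟨ *-identityʳ _ ⟨
      size (x ⊔ line v) * 1ℚ                     ≡⟨ cong (size (x ⊔ line v) *_) (trans (cong size meet≡bot) size-bot) ⟨
      size (x ⊔ line v) * size (x ⊓ line v)      ≡⟨ size-⊔ x (line v) ⟩
      size x * size (line v)                     ≡⟨ cong (size x *_) (size-line v≢0) ⟩
      size x * Q                                 ≡⟨ *-comm (size x) Q ⟩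
      Q * size x                                 ∎
      where
      v≢0 : v ≢ 𝟎
      v≢0 e = v∉x (subst (_∈ᵉ x) (sym e) (𝟎∈ x))
      meet≡bot : x ⊓ line v ≡ bot
      meet≡bot = ⊑-antisym (x ⊓ line v) bot only-𝟎 (bot-min (x ⊓ line v))
        where
        scalar : ∀ {u} → u ∈ᵉ x → (i : Fin q) → u ≡ fromFin i ∙ v → Dec (i ≡ toFin 0#) → u ≡ 𝟎
        scalar u∈x i e (yes refl) = trans e (trans (cong (_∙ v) (fromFin-toFin 0#)) (0∙ v))
        scalar {u} u∈x i e (no i≢0) with K.inverse (fromFin i) (λ z → i≢0 (trans (sym (toFin-fromFin i)) (cong toFin z)))
        ... | y , iy≡1 = ⊥-elim (v∉x (subst (_∈ᵉ x) back (∙∈ x y u∈x)))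
          where
          back : y ∙ u ≡ v
          back = trans (cong (y ∙_) e) (trans (∙-assoc y (fromFin i) v) (trans (cong (_∙ v)
            (trans (CommutativeRing.*-comm ring y (fromFin i)) iy≡1)) (1∙ v)))
            where open import Algebra.Bundles using (module CommutativeRing)
        only-𝟎 : x ⊓ line v ⊑ bot
        only-𝟎 u u∈ = let (u∈x , u∈l) = ∈⊓⁻ x (line v) u∈
                          (i , e) = ∈line⁻ v u∈l
                      in subst (_∈ᵉ bot) (sym (scalar u∈x i e (i Fin.≟ toFin 0#))) (𝟎∈ bot)

    -- Running through all vectors and adjoining the line of each one in `x` not yet covered
    -- multiplies the size by Q each time. Dimension is defined as the resulting exponent, so that
    -- monotonicity and modularity become statements about cardinalities.
    size-power : ∀ x → Σ ℕ λ d → size x ≡ pw d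
    size-power x with build vs
      where
      build : ∀ us → Σ El λ y → y ⊑ x × (∀ u → u ∈ us → u ∈ᵉ x → u ∈ᵉ y) × Σ ℕ λ d → size y ≡ pw d
      build [] = bot , bot-min x , (λ _ ()) , 0 , size-bot
      build (u ∷ us) with build us
      ... | y , y⊑x , cover , d , e with (u ∈ᵉ? x) ×-dec ¬? (u ∈ᵉ? y)
      ...   | yes (u∈x , u∉y) = y ⊔ line u , ⊔-least y (line u) x y⊑x (line⊑ x u∈x) , cover′ , suc d , trans (size-extend y u∉y) (cong (Q *_) e)
        where
        cover′ : ∀ v → v ∈ u ∷ us → v ∈ᵉ x → v ∈ᵉ y ⊔ line u
        cover′ v (here refl) _   = ⊔-upperʳ y (line u) u (self∈line u)
        cover′ v (there v∈)  v∈x = ⊔-upperˡ y (line u) v (cover v v∈ v∈x)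
      ...   | no ¬new = y , y⊑x , cover′ , d , e
        where
        cover′ : ∀ v → v ∈ u ∷ us → v ∈ᵉ x → v ∈ᵉ y
        cover′ v (there v∈)  v∈x = cover v v∈ v∈x
        cover′ v (here refl) v∈x with v ∈ᵉ? y
        ... | yes v∈y = v∈y
        ... | no v∉y  = ⊥-elim (¬new (v∈x , v∉y))
    ... | y , y⊑x , cover , d , e = d , trans (cong size (⊑-antisym x y (λ u → cover u (Rank.∈-elems finiteE u)) y⊑x)) e

    dim : El → ℕ
    dim x = proj₁ (size-power x)

    size-dim : ∀ x → size x ≡ pw (dim x)
    size-dim x = proj₂ (size-power x)

    dim-unique : ∀ x {d} → size x ≡ pw d → dim x ≡ d
    dim-unique x e = pw-injective (trans (sym (size-dim x)) e)

    dim-mono : ∀ x y → x ⊑ y → dim x ℕ.≤ dim y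
    dim-mono x y x⊑y = pw-cancel-≤ (≤-trans (≤-reflexive (sym (size-dim x))) (≤-trans (size-mono x y x⊑y) (≤-reflexive (size-dim y))))

    dim-≡ : ∀ x y → x ⊑ y → dim x ≡ dim y → x ≡ y
    dim-≡ x y x⊑y e = size-≡ x y x⊑y (trans (size-dim x) (trans (cong pw e) (sym (size-dim y))))

    modular : ∀ x y → dim (x ⊔ y) ℕ.+ dim (x ⊓ y) ≡ dim x ℕ.+ dim y
    modular x y = pw-injective (begin
      pw (dim (x ⊔ y) ℕ.+ dim (x ⊓ y))       ≡⟨ pw-+ (dim (x ⊔ y)) (dim (x ⊓ y)) ⟩
      pw (dim (x ⊔ y)) * pw (dim (x ⊓ y))    ≡⟨ cong₂ _*_ (size-dim (x ⊔ y)) (size-dim (x ⊓ y)) ⟨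
      size (x ⊔ y) * size (x ⊓ y)            ≡⟨ size-⊔ x y ⟩
      size x * size y                        ≡⟨ cong₂ _*_ (size-dim x) (size-dim y) ⟩
      pw (dim x) * pw (dim y)                ≡⟨ pw-+ (dim x) (dim y) ⟨
      pw (dim x ℕ.+ dim y)                   ∎)

    _⋖_ : El → El → Set
    x ⋖ y = x ⊑ y × suc (dim x) ≡ dim y

    _⋖?_ : ∀ x y → Dec (x ⋖ y)
    x ⋖? y = (x ⊑? y) ×-dec (suc (dim x) ℕ.≟ dim y)

    -- Every u in y outside x lies in exactly one cover of x, and each cover z has Q ^ dim z - Q ^ dim x such elements.
    up-count : ∀ x y → x ⊑ y → ∀ {d} → dim x ℕ.+ d ≡ dim y → ∑ (Finite.elems finiteEl) (λ z → ⟦ (x ⋖? z) ×-dec (z ⊑? y) ⟧) ≡ br d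
    up-count x y x⊑y {d} e = *-cancelˡ-≡ (*-pos (<⇒0<- 1<Q) (0<pw (dim x))) (begin
      c * ∑ zs (λ z → ⟦ (x ⋖? z) ×-dec (z ⊑? y) ⟧)
        ≡⟨ ∑-*ˡ zs c _ ⟨
      ∑ zs (λ z → c * ⟦ (x ⋖? z) ×-dec (z ⊑? y) ⟧)
        ≡⟨ ∑-cong zs (λ z → sym (∑-fiber vs c ((x ⋖? z) ×-dec (z ⊑? y)) (λ u → R? z u) proj₁ (new z))) ⟩
      ∑ zs (λ z → ∑ vs (λ u → ⟦ R? z u ⟧))
        ≡⟨ ∑-swap zs vs _ ⟩
      ∑ vs (λ u → ∑ zs (λ z → ⟦ R? z u ⟧))
        ≡⟨ ∑-cong vs (λ u → trans (∑-fiber zs 1ℚ ((u ∈ᵉ? y) ×-dec ¬? (u ∈ᵉ? x)) (λ z → R? z u)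
             (λ ((_ , z⊑y) , u∈z , u∉x) → z⊑y u u∈z , u∉x) (unique u)) (*-identityˡ _)) ⟩
      ∑ vs (λ u → ⟦ (u ∈ᵉ? y) ×-dec ¬? (u ∈ᵉ? x) ⟧)
        ≡⟨ size-difference x y x⊑y ⟩
      size y - size x
        ≡⟨ cong₂ _-_ (trans (size-dim y) (trans (cong pw (sym e)) (pw-+ (dim x) d))) (size-dim x) ⟩
      pw (dim x) * pw d - pw (dim x)
        ≡⟨ solve 2 (λ p r → p :* r :- p := p :* (r :- con 1ℚ)) refl (pw (dim x)) (pw d) ⟩
      pw (dim x) * (pw d - 1ℚ)
        ≡⟨ cong (pw (dim x) *_) (pw-br d) ⟩
      pw (dim x) * ((Q - 1ℚ) * br d)
        ≡⟨ solve 3 (λ p q b → p :* (q :* b) := q :* p :* b) refl (pw (dim x)) (Q - 1ℚ) (br d) ⟩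
      c * br d ∎)
      where
      zs : List El
      zs = Finite.elems finiteEl
      c = (Q - 1ℚ) * pw (dim x)
      R? : ∀ z u → Dec ((x ⋖ z × z ⊑ y) × (u ∈ᵉ z × ¬ (u ∈ᵉ x)))
      R? z u = ((x ⋖? z) ×-dec (z ⊑? y)) ×-dec ((u ∈ᵉ? z) ×-dec ¬? (u ∈ᵉ? x))
      new : ∀ z → x ⋖ z × z ⊑ y → ∑ vs (λ u → ⟦ R? z u ⟧) ≡ c
      new z (x⋖z , z⊑y) = begin
        ∑ vs (λ u → ⟦ R? z u ⟧)
          ≡⟨ ∑-cong vs (λ u → ⟦⟧-cong (R? z u) ((u ∈ᵉ? z) ×-dec ¬? (u ∈ᵉ? x)) proj₂ ((x⋖z , z⊑y) ,_)) ⟩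
        ∑ vs (λ u → ⟦ (u ∈ᵉ? z) ×-dec ¬? (u ∈ᵉ? x) ⟧)
          ≡⟨ size-difference x z (proj₁ x⋖z) ⟩
        size z - size x
          ≡⟨ cong₂ _-_ (trans (size-dim z) (cong pw (sym (proj₂ x⋖z)))) (size-dim x) ⟩
        Q * pw (dim x) - pw (dim x)
          ≡⟨ solve 2 (λ q p → q :* p :- p := (q :- con 1ℚ) :* p) refl Q (pw (dim x)) ⟩
        c ∎
      unique : ∀ u → u ∈ᵉ y × ¬ (u ∈ᵉ x) → ∑ zs (λ z → ⟦ R? z u ⟧) ≡ 1ℚ
      unique u (u∈y , u∉x) = Finite.∑-unique finiteEl (x ⊔ line u) (λ z → R? z u)
          (((⊔-upperˡ x (line u) , sym dim-ext) , ⊔-least x (line u) y x⊑y (line⊑ y u∈y)) , ⊔-upperʳ x (line u) u (self∈line u) , u∉x)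
          (λ z (((x⊑z , s) , _) , u∈z , _) → sym (dim-≡ (x ⊔ line u) z (⊔-least x (line u) z x⊑z (line⊑ z u∈z)) (trans dim-ext s)))
        where
        dim-ext : dim (x ⊔ line u) ≡ suc (dim x)
        dim-ext = dim-unique (x ⊔ line u) (trans (size-extend x u∉x) (cong (Q *_) (size-dim x)))

    geometry : Geometry Q 1≤Q n
    geometry = record
      { El = El ; finite = finiteEl ; _⊑_ = _⊑_ ; _⊑?_ = _⊑?_
      ; ⊑-refl = λ u u∈x → u∈x
      ; ⊑-trans = λ x⊑y y⊑z u u∈x → y⊑z u (x⊑y u u∈x)
      ; _⊓_ = _⊓_ ; _⊔_ = _⊔_
      ; ⊓-lowerˡ = λ x y u u∈ → proj₁ (∈⊓⁻ x y u∈)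
      ; ⊓-lowerʳ = λ x y u u∈ → proj₂ (∈⊓⁻ x y u∈)
      ; ⊓-greatest = λ {x} {y} z⊑x z⊑y u u∈ → ∈⊓⁺ x y (z⊑x u u∈ , z⊑y u u∈)
      ; ⊔-upperˡ = ⊔-upperˡ ; ⊔-upperʳ = ⊔-upperʳ
      ; ⊔-least = λ {x} {y} {z} → ⊔-least x y z
      ; bot = bot ; top = top ; bot-min = bot-min ; top-max = top-max
      ; dim = dim ; dim-bot = dim-unique bot size-bot ; dim-top = dim-unique top size-top
      ; dim-mono = λ {x} {y} → dim-mono x y ; dim-≡ = λ {x} {y} → dim-≡ x y ; modular = modular
      ; up-count = λ {x} {y} → up-count x y
      }

-- From indexed families to predicates on the lattice

module IndexedFamilies where

  open Prelude
  open import Data.Fin as Fin using (Fin; zero; suc)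
  import Data.Fin.Properties as Fin
  open import Data.List as List using (List; downFrom)
  import Data.Nat as ℕ
  import Data.Nat.Properties as ℕ
  open import Data.Sum using (_⊎_; inj₁; inj₂)
  open import Function.Definitions using (Injective)
  open import Relation.Binary.Definitions using (tri<; tri≈; tri>)
  open import Defs using (ofℕ; count)
  open FiniteSums
  open Arithmetic
  open SubspaceLattices
  open SpernerFamilies
  open SubspaceGeometry using (ofℕ-+; finiteFin; ∑-tabulate)

  ∑-downFrom-1 : ∀ k → ∑ (downFrom k) (λ _ → 1ℚ) ≡ ofℕ k
  ∑-downFrom-1 zero    = refl
  ∑-downFrom-1 (suc k) = trans (cong (1ℚ +_) (∑-downFrom-1 k)) (sym (ofℕ-+ 1 k))

  count-∑ : ∀ m (d : Fin m → ℕ) j → ofℕ (count m d j) ≡ ∑ (List.allFin m) (λ i → ⟦ d i ℕ.≟ j ⟧)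
  count-∑ zero    d j = refl
  count-∑ (suc m) d j = trans (step (count-∑ m (λ i → d (suc i)) j))
      (cong (⟦ d zero ℕ.≟ j ⟧ +_) (sym (∑-tabulate {m = m} suc (λ i → ⟦ d i ℕ.≟ j ⟧))))
    where
    step : ∀ {s} → ofℕ (count m (λ i → d (suc i)) j) ≡ s → ofℕ (count (suc m) d j) ≡ ⟦ d zero ℕ.≟ j ⟧ + s
    step e with d zero ℕ.≟ j
    ... | yes p = trans (ofℕ-+ 1 (count m (λ i → d (suc i)) j)) (cong₂ _+_ (sym (⟦⟧-yes (d zero ℕ.≟ j) p)) e)
    ... | no ¬p = trans (trans e (sym (+-identityˡ _))) (cong (_+ _) (sym (⟦⟧-no (d zero ℕ.≟ j) ¬p)))

  module _ {Q : ℚ} {1≤Q : 1ℚ ≤ Q} {n : ℕ} (G : Geometry Q 1≤Q n) where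
    open Families G

    module _ {m : ℕ} (el : Fin m → El) (el-injective : ∀ i i′ → el i ≡ el i′ → i ≡ i′)
             (el-meet : ∀ i i′ → i ≢ i′ → dim (el i ⊓ el i′) ≢ 0) where

      private
        -- The zero subspace is excluded because it meets itself trivially, whereas the intersecting
        -- property is demanded here of every pair, equal members included.
        Member : El → Set
        Member x = (∃ λ i → el i ≡ x) × dim x ≢ 0

        member? : ∀ x → Dec (Member x)
        member? x = Fin.any? (λ i → el i ≟ᶠ x) ×-dec ¬? (dim x ℕ.≟ 0)

        member-meet : ∀ {x y} → Member x → Member y → dim (x ⊓ y) ≢ 0
        member-meet ((i , refl) , x≢0) ((i′ , refl) , _) with i Fin.≟ i′
        ... | yes refl = λ e → x≢0 (trans (cong dim (sym (⊓≡ ⊑-refl))) e)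
        ... | no i≢i′  = el-meet i i′ i≢i′

        -- Indices and lattice elements determine each other by injectivity of `el`; dimension j + 1
        -- is positive, so no index counted here was lost in `Member`.
        count-member : (d : Fin m → ℕ) → (∀ i → dim (el i) ≡ d i) → ∀ j → ofℕ (count m d (suc j)) ≡ # (at member? (suc j))
        count-member d dim-el j = begin
          ofℕ (count m d (suc j))
            ≡⟨ count-∑ m d (suc j) ⟩
          ∑ is (λ i → ⟦ d i ℕ.≟ suc j ⟧)
            ≡⟨ ∑-cong is (λ i → trans (sym (*-identityˡ _)) (sym (∑-fiber elems 1ℚ (d i ℕ.≟ suc j) (λ x → R? i x) proj₂
                 (λ e → trans (∑-cong elems (λ x → ⟦⟧-cong (R? i x) (x ≟ᶠ el i) (λ (p , _) → sym p) (λ p → sym p , e))) (∑-δ-1 (el i)))))) ⟩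
          ∑ is (λ i → ∑ elems (λ x → ⟦ R? i x ⟧))
            ≡⟨ ∑-swap is elems _ ⟩
          ∑ elems (λ x → ∑ is (λ i → ⟦ R? i x ⟧))
            ≡⟨ ∑-cong elems (λ x → trans (∑-fiber is 1ℚ (at member? (suc j) x) (λ i → R? i x) (λ {i} → into x i) (once x)) (*-identityˡ _)) ⟩
          # (at member? (suc j)) ∎
          where
          is : List (Fin m)
          is = List.allFin m
          R? : ∀ i x → Dec (el i ≡ x × d i ≡ suc j)
          R? i x = (el i ≟ᶠ x) ×-dec (d i ℕ.≟ suc j)
          into : ∀ x i → el i ≡ x × d i ≡ suc j → Member x × dim x ≡ suc j
          into x i (refl , e) = ((i , refl) , λ z → ℕ.1+n≢0 (trans (sym e) (trans (sym (dim-el i)) z))) , trans (dim-el i) e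
          once : ∀ x → Member x × dim x ≡ suc j → ∑ is (λ i → ⟦ R? i x ⟧) ≡ 1ℚ
          once x (((i , refl) , _) , e) = Finite.∑-unique (finiteFin m) i (λ i → R? i x) (refl , trans (sym (dim-el i)) e)
            (λ i′ (p , _) → el-injective i′ i p)

      family-weight : ∀ K → K ℕ.+ K ℕ.≤ n → ∀ k →
        (∀ c (S : Fin c → Fin m) → Injective _≡_ _≡_ S → (∀ a b → el (S a) ⊑ el (S b) ⊎ el (S b) ⊑ el (S a)) → c ℕ.≤ k) →
        (d : Fin m → ℕ) → (∀ i → dim (el i) ≡ d i) →
        ∑ (downFrom K) (λ j → ofℕ (count m d (suc j)) * inv (star j)) ≤ ofℕ k
      family-weight K 2K≤n k chains d dim-el = ≤-trans
        (≤-reflexive (∑-cong (downFrom K) (λ j → cong (_* inv (star j)) (count-member d dim-el j))))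
        (≤-trans (sperner-weight K 2K≤n k member? member-meet no-layer) (≤-reflexive (∑-downFrom-1 k)))
        where
        no-layer : ∀ x → ¬ layer Member k x
        -- The layer would yield k + 1 members in a chain; strictly growing dimensions make the
        -- indices that represent them distinct, one index too many.
        no-layer x l with layer-chain k l
        ... | c , Mc , mono = ℕ.1+n≰n (chains (suc k) S S-injective comparable)
          where
          S : Fin (suc k) → Fin m
          S a = proj₁ (proj₁ (Mc a))
          el-S : ∀ a → el (S a) ≡ c a
          el-S a = proj₂ (proj₁ (Mc a))
          S-injective : Injective _≡_ _≡_ S
          S-injective {a} {b} e with Fin.<-cmp a b
          ... | tri≈ _ a≡b _ = a≡b
          ... | tri< a<b _ _ = ⊥-elim (ℕ.<⇒≢ (proj₂ (mono a b a<b)) (cong dim (trans (sym (el-S a)) (trans (cong el e) (el-S b)))))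
          ... | tri> _ _ b<a = ⊥-elim (ℕ.<⇒≢ (proj₂ (mono b a b<a)) (cong dim (trans (sym (el-S b)) (trans (cong el (sym e)) (el-S a)))))
          comparable : ∀ a b → el (S a) ⊑ el (S b) ⊎ el (S b) ⊑ el (S a)
          comparable a b with Fin.<-cmp a b
          ... | tri≈ _ refl _ = inj₁ ⊑-refl
          ... | tri< a<b _ _ = inj₁ (subst₂ _⊑_ (sym (el-S a)) (sym (el-S b)) (proj₁ (mono a b a<b)))
          ... | tri> _ _ b<a = inj₂ (subst₂ _⊑_ (sym (el-S b)) (sym (el-S a)) (proj₁ (mono b a b<a)))

-- The product formula for Gaussian coefficients

module GaussianCoefficients where

  open Prelude
  open import Data.List using (applyUpTo; downFrom)
  import Data.Nat as ℕ
  import Data.Nat.Properties as ℕ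
  open import Defs using (FiniteField; ofℕ; sumℚ; _÷₀_; gauss)
  open FiniteSums
  open Arithmetic
  open SubspaceLattices
  open SpernerFamilies
  open SubspaceGeometry

  ÷₀-* : ∀ p r → 0ℚ < r → (p ÷₀ r) * r ≡ p
  ÷₀-* p r 0<r with r ≟ 0ℚ
  ... | yes refl = ⊥-elim (<-irrefl refl 0<r)
  ... | no r≢0   = trans (*-assoc p (1/r) r) (trans (cong (p *_) (*-inverseˡ r {{≢-nonZero r≢0}})) (*-identityʳ p))
    where 1/r = 1/_ r {{≢-nonZero r≢0}}

  ÷₀≡*inv : ∀ p r → 0ℚ < r → p ÷₀ r ≡ p * inv r
  ÷₀≡*inv p r 0<r = *-cancelˡ-≡ 0<r (begin
    r * (p ÷₀ r)    ≡⟨ *-comm r (p ÷₀ r) ⟩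
    (p ÷₀ r) * r    ≡⟨ ÷₀-* p r 0<r ⟩
    p               ≡⟨ *-identityʳ p ⟨
    p * 1ℚ          ≡⟨ cong (p *_) (inv-* r 0<r) ⟨
    p * (inv r * r) ≡⟨ solve 3 (λ p i r → p :* (i :* r) := r :* (p :* i)) refl p (inv r) r ⟩
    r * (p * inv r) ∎)

  sumℚ-downFrom : ∀ f K → sumℚ (applyUpTo f K) ≡ ∑ (downFrom K) f
  sumℚ-downFrom f zero    = refl
  sumℚ-downFrom f (suc K) = trans (snoc f K) (trans (cong (_+ f K) (sumℚ-downFrom f K)) (+-comm _ (f K)))
    where
    snoc : ∀ f K → sumℚ (applyUpTo f (suc K)) ≡ sumℚ (applyUpTo f K) + f K
    snoc f zero    = +-comm (f 0) 0ℚ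
    snoc f (suc K) = trans (cong (f 0 +_) (snoc (λ i → f (suc i)) K)) (sym (+-assoc (f 0) _ (f (suc K))))

  module _ {q : ℕ} (F : FiniteField q) where
    open FieldOrder F using (Q; 1≤Q; 1<Q; pw-ofℕ)
    open QNumbers Q 1≤Q

    private
      w : ℕ → ℚ
      w m = ofℕ (q ℕ.^ m) - 1ℚ

      w-br : ∀ m → w m ≡ (Q - 1ℚ) * br m
      w-br m = trans (cong (_- 1ℚ) (sym (pw-ofℕ m))) (pw-br m)

      0<w : ∀ m → 0ℚ < w (suc m)
      0<w m = <-≤-trans (*-pos (<⇒0<- 1<Q) (0<br m)) (≤-reflexive (sym (w-br (suc m))))

    -- Splits off the factor i = 0 of the product; the remaining factors are those of `gauss q N k`
    -- by computation.
    gauss-head : ∀ N k → gauss q (suc N) (suc k) * w (suc k) ≡ w (suc N) * gauss q N k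
    gauss-head N k = begin
      (w (suc N) ÷₀ w (suc k)) * gauss q N k * w (suc k)
        ≡⟨ solve 3 (λ a b c → a :* b :* c := (a :* c) :* b) refl (w (suc N) ÷₀ w (suc k)) (gauss q N k) (w (suc k)) ⟩
      (w (suc N) ÷₀ w (suc k)) * w (suc k) * gauss q N k
        ≡⟨ cong (_* gauss q N k) (÷₀-* (w (suc N)) (w (suc k)) (0<w k)) ⟩
      w (suc N) * gauss q N k ∎

    -- The product unfolds by lowering both arguments, while `star` raises the lower one alone. The
    -- induction passes between the two patterns by applying `gauss-head` on either side.
    gauss-step : ∀ N k → k ℕ.≤ N → gauss q (suc N) (suc k) * w (suc k) ≡ gauss q (suc N) k * w (suc N ℕ.∸ k)
    gauss-step N       zero    _   = trans (gauss-head N 0) (*-comm (w (suc N)) 1ℚ)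
    gauss-step (suc N) (suc k) (ℕ.s≤s k≤N) = *-cancelˡ-≡ (0<w k) (begin
      w (suc k) * (gauss q (suc (suc N)) (suc (suc k)) * w (suc (suc k)))
        ≡⟨ cong (w (suc k) *_) (gauss-head (suc N) (suc k)) ⟩
      w (suc k) * (w (suc (suc N)) * gauss q (suc N) (suc k))
        ≡⟨ solve 3 (λ a b c → a :* (b :* c) := b :* (c :* a)) refl (w (suc k)) (w (suc (suc N))) (gauss q (suc N) (suc k)) ⟩
      w (suc (suc N)) * (gauss q (suc N) (suc k) * w (suc k))
        ≡⟨ cong (w (suc (suc N)) *_) (gauss-step N k k≤N) ⟩
      w (suc (suc N)) * (gauss q (suc N) k * w (suc N ℕ.∸ k))
        ≡⟨ *-assoc (w (suc (suc N))) (gauss q (suc N) k) (w (suc N ℕ.∸ k)) ⟨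
      w (suc (suc N)) * gauss q (suc N) k * w (suc N ℕ.∸ k)
        ≡⟨ cong (_* w (suc N ℕ.∸ k)) (gauss-head (suc N) k) ⟨
      gauss q (suc (suc N)) (suc k) * w (suc k) * w (suc N ℕ.∸ k)
        ≡⟨ solve 3 (λ a b c → a :* b :* c := b :* (a :* c)) refl (gauss q (suc (suc N)) (suc k)) (w (suc k)) (w (suc N ℕ.∸ k)) ⟩
      w (suc k) * (gauss q (suc (suc N)) (suc k) * w (suc N ℕ.∸ k)) ∎)

    gauss≡star : ∀ {n} (G : Geometry Q 1≤Q n) j → j ℕ.< n → gauss q (n ℕ.∸ 1) j ≡ Families.star G j
    gauss≡star G zero    _   = refl
    gauss≡star {suc (suc N)} G (suc j) (ℕ.s≤s (ℕ.s≤s j≤N)) = begin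
      gauss q (suc N) (suc j)
        ≡⟨ *-identityʳ _ ⟨
      gauss q (suc N) (suc j) * 1ℚ
        ≡⟨ cong (gauss q (suc N) (suc j) *_) (inv-* b (0<br j)) ⟨
      gauss q (suc N) (suc j) * (inv b * b)
        ≡⟨ solve 3 (λ g i b → g :* (i :* b) := (g :* b) :* i) refl (gauss q (suc N) (suc j)) (inv b) b ⟩
      gauss q (suc N) (suc j) * b * inv b
        ≡⟨ cong (_* inv b) step ⟩
      gauss q (suc N) j * br (suc N ℕ.∸ j) * inv b
        ≡⟨ cong (λ s → s * br (suc N ℕ.∸ j) * inv b) (gauss≡star G j (ℕ.s≤s (ℕ.m≤n⇒m≤1+n j≤N))) ⟩
      Families.star G (suc j) ∎
      where
      b = br (suc j)
      step : gauss q (suc N) (suc j) * b ≡ gauss q (suc N) j * br (suc N ℕ.∸ j)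
      step = *-cancelˡ-≡ (<⇒0<- 1<Q) (begin
        (Q - 1ℚ) * (gauss q (suc N) (suc j) * b)
          ≡⟨ solve 3 (λ r g b → r :* (g :* b) := g :* (r :* b)) refl (Q - 1ℚ) (gauss q (suc N) (suc j)) b ⟩
        gauss q (suc N) (suc j) * ((Q - 1ℚ) * b)
          ≡⟨ cong (gauss q (suc N) (suc j) *_) (w-br (suc j)) ⟨
        gauss q (suc N) (suc j) * w (suc j)
          ≡⟨ gauss-step N j j≤N ⟩
        gauss q (suc N) j * w (suc N ℕ.∸ j)
          ≡⟨ cong (gauss q (suc N) j *_) (w-br (suc N ℕ.∸ j)) ⟩
        gauss q (suc N) j * ((Q - 1ℚ) * br (suc N ℕ.∸ j))
          ≡⟨ solve 3 (λ g r b → g :* (r :* b) := r :* (g :* b)) refl (gauss q (suc N) j) (Q - 1ℚ) (br (suc N ℕ.∸ j)) ⟩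
        (Q - 1ℚ) * (gauss q (suc N) j * br (suc N ℕ.∸ j)) ∎)

-- Subspaces given by predicates and bases as lattice elements

module Realisation where

  open import Data.Bool as Bool using (Bool; true; false; _∧_)
  open import Data.Empty using (⊥-elim)
  open import Data.Fin as Fin using (Fin; zero; suc)
  open import Data.List as List using (List; applyUpTo; downFrom)
  open import Data.Nat as ℕ using (ℕ; zero; suc)
  open import Data.Product using (_×_; _,_; proj₁; proj₂; Σ)
  open import Data.Rational using (ℚ; 1ℚ; _*_)
  open import Data.Rational.Properties using (*-identityˡ)
  open import Algebra.Bundles using (CommutativeRing)
  import Algebra.Properties.Ring as RingProperties
  open import Relation.Nullary using (Dec; ¬_)
  open import Relation.Binary.PropositionalEquality
  open import Defs using (FiniteField; module LinAlg; ofℕ)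
  open FiniteSums
  open Arithmetic
  open SubspaceLattices
  open Vectors
  open SubspaceGeometry
  open ≡-Reasoning

  module _ {q : ℕ} (F : FiniteField q) (n : ℕ) where
    open LinAlg F n
    open Encoding F
    open Space n
    open FieldOrder F using (Q; 1≤Q; pw-ofℕ)
    open Construction F n
    open QNumbers Q 1≤Q
    private
      module K = FiniteField F
      module R = CommutativeRing ring
      module RP = RingProperties R.ring
      vs : List E
      vs = Finite.elems finiteE

    dec : E → Vector
    dec = decode {n}

    enc : Vector → E
    enc = encode {n}

    lincomb-cong : ∀ j {c d} (b : Fin j → Vector) → c ≗ d → lincomb j c b ≗ lincomb j d b
    lincomb-cong zero    b e x = refl
    lincomb-cong (suc j) b e x = cong₂ K._+_ (cong (K._* b zero x) (e zero)) (lincomb-cong j (λ i → b (suc i)) (λ i → e (suc i)) x)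

    lincomb-difference : ∀ j c d (b : Fin j → Vector) x →
      lincomb j (λ i → c i K.+ (K.- d i)) b x ≡ lincomb j c b x K.+ (K.- lincomb j d b x)
    lincomb-difference zero    c d b x = sym (R.-‿inverseʳ K.0#)
    lincomb-difference (suc j) c d b x = begin
      ((c zero K.+ (K.- d zero)) K.* b zero x) K.+ lincomb j (λ i → c (suc i) K.+ (K.- d (suc i))) (λ i → b (suc i)) x
        ≡⟨ cong₂ K._+_ (trans (R.distribʳ (b zero x) (c zero) (K.- d zero)) (cong (c₀ K.+_) (sym (RP.-‿distribˡ-* (d zero) (b zero x)))))
             (lincomb-difference j (λ i → c (suc i)) (λ i → d (suc i)) (λ i → b (suc i)) x) ⟩
      (c₀ K.+ (K.- d₀)) K.+ (c₊ K.+ (K.- d₊))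
        ≡⟨ interchange c₀ (K.- d₀) c₊ (K.- d₊) ⟩
      (c₀ K.+ c₊) K.+ ((K.- d₀) K.+ (K.- d₊))
        ≡⟨ cong ((c₀ K.+ c₊) K.+_) (RP.-‿+-comm d₀ d₊) ⟩
      (c₀ K.+ c₊) K.+ (K.- (d₀ K.+ d₊)) ∎
      where
      open import Algebra.Properties.CommutativeSemigroup R.+-commutativeSemigroup using (interchange)
      c₀ = c zero K.* b zero x
      d₀ = d zero K.* b zero x
      c₊ = lincomb j (λ i → c (suc i)) (λ i → b (suc i)) x
      d₊ = lincomb j (λ i → d (suc i)) (λ i → b (suc i)) x

    lincomb-injective : ∀ j {c d} (b : Fin j → Vector) → LinIndep j b → lincomb j c b ≗ lincomb j d b → c ≗ d
    lincomb-injective j {c} {d} b indep e i = RP.x∙y⁻¹≈ε⇒x≈y (c i) (d i)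
      (indep (λ i → c i K.+ (K.- d i)) (λ x → trans (lincomb-difference j c d b x)
        (trans (cong (K._+ (K.- lincomb j d b x)) (e x)) (R.-‿inverseʳ (lincomb j d b x)))) i)

    module _ (V : Subspace) {j : ℕ} (V-dim : HasDim V j) where

      private
        b : Fin j → Vector
        b = proj₁ V-dim

        indep : LinIndep j b
        indep = proj₁ (proj₂ V-dim)

        spans : Spans j b V
        spans = proj₂ (proj₂ V-dim)

      -- `mem V` is a Boolean function of coordinate functions, and the fields of `Subspace` do not
      -- make it respect pointwise equality. The spanning clause of `HasDim` does, because it
      -- depends on the values of a vector only.
      mem-cong : ∀ {v w} → v ≗ w → mem V v ≡ true → mem V w ≡ true
      mem-cong {v} {w} e v∈ = let (c , p) = proj₁ (spans v) v∈ in proj₂ (spans w) (c , λ x → trans (sym (e x)) (p x))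

      private
        mem? : ∀ u → Dec (mem V (dec u) ≡ true)
        mem? u = mem V (dec u) Bool.≟ true

      element : El
      element = subspace mem? (mem-cong (λ i → sym (decode-𝟎 i)) (mem-0 V))
        (λ {u} {v} u∈ v∈ → mem-cong (λ i → sym (decode-⊕ u v i)) (mem-+ V (dec u) (dec v) u∈ v∈))
        (λ c {v} v∈ → mem-cong (λ i → sym (decode-∙ c v i)) (mem-· V c (dec v) v∈))

      ∈element⁺ : ∀ {v} → mem V v ≡ true → enc v ∈ᵉ element
      ∈element⁺ {v} v∈ = ∈-subset⁺ mem? (mem-cong (λ i → sym (decode-encode {n} v i)) v∈)

      ∈element⁻ : ∀ {v} → enc v ∈ᵉ element → mem V v ≡ true
      ∈element⁻ {v} v∈ = mem-cong (decode-encode {n} v) (∈-subset⁻ mem? v∈)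

      -- Since `dim` is read off the cardinality, counting suffices: coordinates with respect to the
      -- basis put the vectors in bijection with the codes in `Fin (q ^ j)`.
      dim-element : dim element ≡ j
      dim-element = dim-unique element (begin
        ∑ vs (λ u → ⟦ u ∈ᵉ? element ⟧)
          ≡⟨ ∑-cong vs (λ u → trans (sym (*-identityˡ _)) (sym (∑-fiber cs 1ℚ (u ∈ᵉ? element) (λ c → R? u c)
               (λ {c} e → subst (_∈ᵉ element) (sym e) (∈element⁺ (proj₂ (spans (combination c)) (decode c , λ _ → refl))))
               (λ u∈ → coordinates u (proj₁ (spans (dec u)) (∈-subset⁻ mem? u∈)))))) ⟩
        ∑ vs (λ u → ∑ cs (λ c → ⟦ R? u c ⟧))
          ≡⟨ ∑-swap vs cs _ ⟩
        ∑ cs (λ c → ∑ vs (λ u → ⟦ R? u c ⟧))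
          ≡⟨ ∑-cong cs (λ c → Finite.∑-δ-1 finiteE (enc (combination c))) ⟩
        ∑ cs (λ _ → 1ℚ)
          ≡⟨ ∑-ones (q ℕ.^ j) ⟩
        ofℕ (q ℕ.^ j)
          ≡⟨ pw-ofℕ j ⟨
        pw j ∎)
        where
        cs : List (Fin (q ℕ.^ j))
        cs = List.allFin (q ℕ.^ j)
        combination : Fin (q ℕ.^ j) → Vector
        combination c = lincomb j (decode {j} c) b
        R? : ∀ u c → Dec (u ≡ enc (combination c))
        R? u c = Finite._≟ᶠ_ finiteE u (enc (combination c))
        coordinates : ∀ u → (Σ (Fin j → K.Carrier) λ c → ∀ x → dec u x ≡ lincomb j c b x) → ∑ cs (λ c → ⟦ R? u c ⟧) ≡ 1ℚ
        coordinates u (c , e) = Finite.∑-unique (finiteFin (q ℕ.^ j)) (encode {j} c) (λ c → R? u c)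
            (trans (sym (encode-decode {n} u)) (encode-cong (λ x → trans (e x) (lincomb-cong j b (λ i → sym (decode-encode {j} c i)) x))))
            (λ c′ e′ → decode-injective {j} (λ i → lincomb-injective j b indep (λ x → trans (sym (decode-encode {n} (combination c′) x))
              (trans (cong (λ u → dec u x) (sym e′)) (trans (e x) (lincomb-cong j b (λ i → sym (decode-encode {j} c i)) x)))) i))

    element-⊑ : ∀ V W {i j} (dV : HasDim V i) (dW : HasDim W j) → element V dV ⊑ element W dW → V ⊆ W
    element-⊑ V W dV dW V⊑W v v∈ = ∈element⁻ W dW (V⊑W (enc v) (∈element⁺ V dV v∈))

    element-injective : ∀ V W {i j} (dV : HasDim V i) (dW : HasDim W j) → element V dV ≡ element W dW → V ≐ W
    element-injective V W dV dW e v = both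
      (element-⊑ V W dV dW (λ u u∈ → subst (u ∈ᵉ_) e u∈) v)
      (element-⊑ W V dW dV (λ u u∈ → subst (u ∈ᵉ_) (sym e) u∈) v)
      where
      both : ∀ {a b : Bool} → (a ≡ true → b ≡ true) → (b ≡ true → a ≡ true) → a ≡ b
      both {true}          f g = sym (f refl)
      both {false} {true}  f g = g refl
      both {false} {false} f g = refl

    -- The intersection hypothesis speaks of every d for which `HasDim (V ∩ W) d` holds, so refuting
    -- it takes an actual witness for d = 0, the empty basis.
    trivial-meet : ∀ V W {i j} (dV : HasDim V i) (dW : HasDim W j) → dim (element V dV ⊓ element W dW) ≡ 0 → HasDim (V ∩ W) 0
    trivial-meet V W dV dW d = (λ ()) , (λ _ _ ()) , λ v → zero-only v , zero-in v
      where
      x = element V dV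
      y = element W dW
      bot≡ : bot ≡ x ⊓ y
      bot≡ = dim-≡ bot (x ⊓ y) (bot-min (x ⊓ y)) (trans (dim-unique bot size-bot) (sym d))
      ∧-true : ∀ {a b} → (a ∧ b) ≡ true → a ≡ true × b ≡ true
      ∧-true {true} {true} _ = refl , refl
      zero-only : ∀ v → mem (V ∩ W) v ≡ true → Σ (Fin 0 → K.Carrier) λ c → ∀ i → v i ≡ lincomb 0 c (λ ()) i
      zero-only v v∈ = (λ ()) , λ i → trans (sym (decode-encode {n} v i)) (trans (cong (λ u → dec u i)
          (∈bot (subst (enc v ∈ᵉ_) (sym bot≡) (∈⊓⁺ x y (∈element⁺ V dV (proj₁ (∧-true v∈)) , ∈element⁺ W dW (proj₂ (∧-true v∈)))))))
          (decode-𝟎 i))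
      zero-in : ∀ v → (Σ (Fin 0 → K.Carrier) λ c → ∀ i → v i ≡ lincomb 0 c (λ ()) i) → mem (V ∩ W) v ≡ true
      zero-in v (_ , e) = cong₂ _∧_ (mem-cong V dV (λ i → sym (e i)) (mem-0 V)) (mem-cong W dW (λ i → sym (e i)) (mem-0 W))

-- The bound for intersecting k-Sperner families of subspaces

open import Defs
open import Data.Nat using (ℕ; suc; _≤_; _<_; _∸_; _/_)
open import Data.Fin using (Fin)
open import Data.Product using (Σ; _×_)
open import Data.Sum using (_⊎_)
open import Data.List using (applyUpTo)
open import Data.Rational as ℚ using (ℚ)
open import Relation.Nullary using (¬_)
open import Relation.Binary.PropositionalEquality using (_≡_; _≢_)
open import Function.Definitions using (Injective)

theorem2p4 : (q : ℕ) → IsPrimePower q → (F : FiniteField q) → (n k m : ℕ)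
    → (𝒱 : Fin m → LinAlg.Subspace F n)
    → (∀ i i′ → i ≢ i′ → ¬ LinAlg._≐_ F n (𝒱 i) (𝒱 i′))
    → (∀ i i′ → i ≢ i′ → ∀ d → LinAlg.HasDim F n (LinAlg._∩_ F n (𝒱 i) (𝒱 i′)) d → 0 < d)
    → (∀ c (S : Fin c → Fin m) → Injective _≡_ _≡_ S
         → (∀ a b → LinAlg._⊆_ F n (𝒱 (S a)) (𝒱 (S b)) ⊎ LinAlg._⊆_ F n (𝒱 (S b)) (𝒱 (S a)))
         → c ≤ k)
    → (dim : Fin m → ℕ) → (∀ i → LinAlg.HasDim F n (𝒱 i) (dim i))
    → (∀ i → dim i ≤ n / 2)
    → sumℚ (applyUpTo (λ j → ofℕ (count m dim (suc j)) ÷₀ gauss q (n ∸ 1) j) (n / 2))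
        ℚ.≤ ofℕ k
theorem2p4 q _ F n k m 𝒱 distinct intersecting sperner dim hasDim _ = ℚ.≤-trans (ℚ.≤-reflexive rewriting)
    (family-weight geometry el el-injective el-meet (n / 2) half+half≤n k chains dim (λ i → dim-element F n (𝒱 i) (hasDim i)))
  where
  import Data.Fin as Fin
  open import Data.Empty using (⊥-elim)
  open import Data.List using (downFrom)
  import Data.Nat as ℕ
  import Data.Sum as Sum
  open import Data.Nat.DivMod using (m/n*n≤m)
  import Data.Nat.Properties as ℕ
  import Data.Rational.Properties as ℚ
  open import Relation.Binary.PropositionalEquality using (refl; sym; trans; cong; subst)
  open import Relation.Nullary.Decidable using (decidable-stable)
  open FiniteSums using (∑)
  open Arithmetic using (inv)
  open SpernerFamilies
  open IndexedFamilies using (family-weight)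
  open GaussianCoefficients
  open Realisation
  open SubspaceGeometry.Construction F n using (El; geometry; _⊓_) renaming (dim to rank)
  open Families geometry using (star; 0<star)
  open IsotypicDecomposition using (∑-downFrom-cong)

  el : Fin m → El
  el i = element F n (𝒱 i) (hasDim i)

  el-injective : ∀ i i′ → el i ≡ el i′ → i ≡ i′
  -- `distinct` can only refute i ≢ i′; decidability of equality in `Fin m` removes the double
  -- negation.
  el-injective i i′ e = decidable-stable (i Fin.≟ i′)
    (λ i≢i′ → distinct i i′ i≢i′ (element-injective F n (𝒱 i) (𝒱 i′) (hasDim i) (hasDim i′) e))

  el-meet : ∀ i i′ → i ≢ i′ → rank (el i ⊓ el i′) ≢ 0
  el-meet i i′ i≢i′ d = ℕ.<-irrefl refl
    (intersecting i i′ i≢i′ 0 (trivial-meet F n (𝒱 i) (𝒱 i′) (hasDim i) (hasDim i′) d))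

  chains : ∀ c (S : Fin c → Fin m) → Injective _≡_ _≡_ S → _ → c ≤ k
  chains c S inj comparable = sperner c S inj (λ a b → Sum.map
    (element-⊑ F n (𝒱 (S a)) (𝒱 (S b)) (hasDim (S a)) (hasDim (S b)))
    (element-⊑ F n (𝒱 (S b)) (𝒱 (S a)) (hasDim (S b)) (hasDim (S a))) (comparable a b))

  half+half≤n : n / 2 ℕ.+ n / 2 ≤ n
  half+half≤n = ℕ.≤-trans (ℕ.≤-reflexive (trans (cong (n / 2 ℕ.+_) (sym (ℕ.+-identityʳ (n / 2)))) (ℕ.*-comm 2 (n / 2)))) (m/n*n≤m n 2)

  rewriting : sumℚ (applyUpTo (λ j → ofℕ (count m dim (suc j)) ÷₀ gauss q (n ∸ 1) j) (n / 2))
              ≡ ∑ (downFrom (n / 2)) (λ j → ofℕ (count m dim (suc j)) ℚ.* inv (star j))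
  rewriting = trans (sumℚ-downFrom _ (n / 2)) (∑-downFrom-cong (n / 2) (λ j j<K →
    let j<n = ℕ.<-≤-trans j<K (ℕ.≤-trans (ℕ.m≤m+n (n / 2) (n / 2)) half+half≤n) in
    trans (cong (ofℕ (count m dim (suc j)) ÷₀_) (gauss≡star F geometry j j<n)) (÷₀≡*inv _ (star j) (0<star j j<n))))
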